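{- There exists an absolute constant $C_1>0$ such that for all integers $a\ge 2$ and $n\ge 3$, $$\mathrm{Pr}(a^{n}-1)\ \ge\ (a^{n}-1)^{C_1/\ln\ln n}.$$
   Context: For $n=p_1^{l_1}\cdots p_k^{l_k}$ ($p_i$ distinct primes, $l_i\ge1$) and an integer $a\ge 2$, the primitive primover cofactor of $a^n-1$ is $$\mathrm{Pr}(a^n-1)=\frac{\prod_{\varepsilon\in\{0,1\}^k,\ \varepsilon_1+\dots+\varepsilon_k\ \text{even}} \bigl(a^{p_1^{l_1-\varepsilon_1}\cdots p_k^{l_k-\varepsilon_k}}-1\bigr)}{\prod_{\varepsilon\in\{0,1\}^k,\ \varepsilon_1+\dots+\varepsilon_k\ \text{odd}} \bigl(a^{p_1^{l_1-\varepsilon_1}\cdots p_k^{l_k-\varepsilon_k}}-1\bigr)},$$ a positive integer dividing $a^n-1$. -}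

module Defs where

open import Data.Nat.Base as ℕ using (ℕ; zero; suc; z≤n; s≤s; _!)
import Data.Nat.Properties as ℕ
open import Data.Nat.Divisibility using (_∣?_)
open import Data.Nat.ListAction using (product)
open import Data.Nat.ListAction.Properties using (product≢0)
open import Data.Nat.Primality using (Prime; prime⇒nonZero)
import Data.Nat.Primality.Factorisation as Factorisation
open Factorisation using (PrimeFactorisation; factors)
open import Data.Nat.Coprimality using (1-coprimeTo) renaming (sym to coprime-sym)
open import Data.Integer.Base as ℤ using (+_)
import Data.Integer.Properties as ℤ
open import Data.Rational.Base
open import Data.Rational.Properties
open import Data.Fin.Base as Fin using (Fin; toℕ)
open import Data.Fin.Patterns using (0F; 1F)
open import Data.List.Base as List using (List; []; _∷_; _++_; filter; tabulate)
open import Data.List.Relation.Unary.All as All using (All; []; _∷_)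
import Data.List.Relation.Unary.All.Properties as All
open import Data.List.Relation.Unary.AllPairs using (AllPairs; []; _∷_)
open import Data.Maybe.Base using (Maybe; just; nothing)
open import Data.Vec.Base as Vec using (Vec; []; _∷_)
open import Data.Product.Base using (Σ-syntax; _×_; _,_; proj₁; proj₂)
open import Data.Sum.Base using (inj₁; inj₂)
open import Level using (0ℓ)
open import Relation.Nullary.Decidable using (yes; no; ¬?; from-yes)
open import Relation.Nullary.Negation using (contradiction)
open import Relation.Binary.PropositionalEquality
open import Tactic.RingSolver using (solve-∀)
open import Tactic.RingSolver.Core.AlmostCommutativeRing using (AlmostCommutativeRing; fromCommutativeRing)

ℚ-ring : AlmostCommutativeRing 0ℓ 0ℓ
ℚ-ring = fromCommutativeRing +-*-commutativeRing isZero
  where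
  isZero : ∀ q → Maybe (0ℚ ≡ q)
  isZero q with 0ℚ ≟ q
  ... | yes e = just e
  ... | no  _ = nothing


2ℚ : ℚ
2ℚ = 1ℚ + 1ℚ

0<1 : 0ℚ < 1ℚ
0<1 = from-yes (0ℚ <? 1ℚ)

0≤1 : 0ℚ ≤ 1ℚ
0≤1 = <⇒≤ 0<1

0<2 : 0ℚ < 2ℚ
0<2 = from-yes (0ℚ <? 2ℚ)

*-monoˡ : ∀ {p q} r → 0ℚ ≤ r → p ≤ q → r * p ≤ r * q
*-monoˡ r 0≤r = *-monoˡ-≤-nonNeg r {{nonNegative 0≤r}}

*-monoʳ : ∀ {p q} r → 0ℚ ≤ r → p ≤ q → p * r ≤ q * r
*-monoʳ r 0≤r = *-monoʳ-≤-nonNeg r {{nonNegative 0≤r}}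

*-mono : ∀ {p q r s} → 0ℚ ≤ q → 0ℚ ≤ r → p ≤ q → r ≤ s → p * r ≤ q * s
*-mono {q = q} {r} 0≤q 0≤r p≤q r≤s = ≤-trans (*-monoʳ r 0≤r p≤q) (*-monoˡ q 0≤q r≤s)

0≤* : ∀ {p q} → 0ℚ ≤ p → 0ℚ ≤ q → 0ℚ ≤ p * q
0≤* {p} {q} 0≤p 0≤q = subst (_≤ p * q) (*-zeroʳ p) (*-monoˡ p 0≤p 0≤q)

0<* : ∀ {p q} → 0ℚ < p → 0ℚ < q → 0ℚ < p * q
0<* {p} {q} 0<p 0<q = subst (_< p * q) (*-zeroʳ p) (*-monoʳ-<-pos p {{positive 0<p}} 0<q)

0≤+ : ∀ {p q} → 0ℚ ≤ p → 0ℚ ≤ q → 0ℚ ≤ p + q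
0≤+ 0≤p 0≤q = +-mono-≤ 0≤p 0≤q

p≤p+q : ∀ {p q} → 0ℚ ≤ q → p ≤ p + q
p≤p+q {p} {q} 0≤q = subst (_≤ p + q) (+-identityʳ p) (+-monoʳ-≤ p 0≤q)

p≤q⇒0≤q-p : ∀ {p q} → p ≤ q → 0ℚ ≤ q - p
p≤q⇒0≤q-p {p} {q} p≤q = subst (_≤ q - p) (+-inverseʳ p) (+-monoˡ-≤ (- p) p≤q)

p<q⇒0<q-p : ∀ {p q} → p < q → 0ℚ < q - p
p<q⇒0<q-p {p} {q} p<q = subst (_< q - p) (+-inverseʳ p) (+-monoˡ-< (- p) p<q)

p-q≤p : ∀ {p q} → 0ℚ ≤ q → p - q ≤ p
p-q≤p {p} {q} 0≤q = subst (p - q ≤_) (+-identityʳ p) (+-monoʳ-≤ p (neg-antimono-≤ 0≤q))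

∣p∣≤ : ∀ {p b} → p ≤ b → - p ≤ b → ∣ p ∣ ≤ b
∣p∣≤ {p} {b} p≤b -p≤b with ∣p∣≡p∨∣p∣≡-p p
... | inj₁ e = subst (_≤ b) (sym e) p≤b
... | inj₂ e = subst (_≤ b) (sym e) -p≤b

p≤∣p∣ : ∀ p → p ≤ ∣ p ∣
p≤∣p∣ p with ≤-total 0ℚ p
... | inj₁ 0≤p = ≤-reflexive (sym (0≤p⇒∣p∣≡p 0≤p))
... | inj₂ p≤0 = ≤-trans p≤0 (0≤∣p∣ p)

∣p-q∣-sym : ∀ p q → ∣ p - q ∣ ≡ ∣ q - p ∣
∣p-q∣-sym p q = trans (cong ∣_∣ (eq p q)) (∣-p∣≡∣p∣ (q - p))
  where
  eq : ∀ p q → p - q ≡ - (q - p)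
  eq = solve-∀ ℚ-ring

triangle : ∀ p q r → ∣ p - r ∣ ≤ ∣ p - q ∣ + ∣ q - r ∣
triangle p q r = subst (λ t → ∣ t ∣ ≤ ∣ p - q ∣ + ∣ q - r ∣) (eq p q r) (∣p+q∣≤∣p∣+∣q∣ (p - q) (q - r))
  where
  eq : ∀ p q r → (p - q) + (q - r) ≡ p - r
  eq = solve-∀ ℚ-ring

∣p∣≤∣q∣+∣p-q∣ : ∀ p q → ∣ p ∣ ≤ ∣ q ∣ + ∣ p - q ∣
∣p∣≤∣q∣+∣p-q∣ p q = subst (λ t → ∣ t ∣ ≤ ∣ q ∣ + ∣ p - q ∣) (eq p q) (∣p+q∣≤∣p∣+∣q∣ q (p - q))
  where
  eq : ∀ p q → q + (p - q) ≡ p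
  eq = solve-∀ ℚ-ring

-- Total reciprocal on ℚ, with the junk value 0 at 0.
recip : ℚ → ℚ
recip q with q ≟ 0ℚ
... | yes _  = 0ℚ
... | no q≢0 = (1/ q) {{≢-nonZero q≢0}}

recip-inverse : ∀ {q} → 0ℚ < q → q * recip q ≡ 1ℚ
recip-inverse {q} 0<q with q ≟ 0ℚ
... | yes q≡0 = contradiction (sym q≡0) (<⇒≢ 0<q)
... | no q≢0  = *-inverseʳ q {{≢-nonZero q≢0}}

0<recip : ∀ {q} → 0ℚ < q → 0ℚ < recip q
0<recip {q} 0<q with q ≟ 0ℚ
... | yes q≡0 = contradiction (sym q≡0) (<⇒≢ 0<q)
... | no q≢0  = positive⁻¹ _ {{1/pos⇒pos q {{positive 0<q}}}}

recip-anti : ∀ {p q} → 0ℚ < p → p ≤ q → recip q ≤ recip p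
recip-anti {p} {q} 0<p p≤q = begin
  recip q                   ≡⟨ sym (*-identityʳ _) ⟩
  recip q * 1ℚ              ≡⟨ cong (recip q *_) (sym (recip-inverse 0<p)) ⟩
  recip q * (p * recip p)   ≤⟨ *-monoˡ _ (<⇒≤ (0<recip 0<q)) (*-monoʳ _ (<⇒≤ (0<recip 0<p)) p≤q) ⟩
  recip q * (q * recip p)   ≡⟨ eq (recip q) q (recip p) ⟩
  (q * recip q) * recip p   ≡⟨ cong (_* recip p) (recip-inverse 0<q) ⟩
  1ℚ * recip p              ≡⟨ *-identityˡ _ ⟩
  recip p                   ∎
  where
  open ≤-Reasoning
  0<q : 0ℚ < q
  0<q = <-≤-trans 0<p p≤q
  eq : ∀ a b c → a * (b * c) ≡ (b * a) * c
  eq = solve-∀ ℚ-ring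

infixr 8 _^ℚ_

_^ℚ_ : ℚ → ℕ → ℚ
q ^ℚ zero  = 1ℚ
q ^ℚ suc n = q * q ^ℚ n

-- sumTo t k = t 0 + ⋯ + t (k - 1)
sumTo : (ℕ → ℚ) → ℕ → ℚ
sumTo t zero    = 0ℚ
sumTo t (suc k) = sumTo t k + t k

ι : ℕ → ℚ
ι n = + n / 1

ι-mk : ∀ n → ι n ≡ mkℚ (+ n) 0 (coprime-sym (1-coprimeTo n))
ι-mk n = normalize-coprime (coprime-sym (1-coprimeTo n))

ι-mono : ∀ {m n} → m ℕ.≤ n → ι m ≤ ι n
ι-mono {m} {n} m≤n = subst₂ _≤_ (sym (ι-mk m)) (sym (ι-mk n))
  (*≤* (subst₂ ℤ._≤_ (sym (ℤ.*-identityʳ (+ m))) (sym (ℤ.*-identityʳ (+ n))) (ℤ.+≤+ m≤n)))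

0≤ι : ∀ n → 0ℚ ≤ ι n
0≤ι n = ι-mono {0} {n} z≤n

ι-* : ∀ m n → ι (m ℕ.* n) ≡ ι m * ι n
ι-* m n = trans (cong (_/ 1) (ℤ.pos-* m n)) (sym (cong₂ _*_ (ι-mk m) (ι-mk n)))

ι-suc : ∀ n → ι (suc n) ≡ 1ℚ + ι n
ι-suc n = trans (cong (_/ 1) (cong (λ t → + 1 ℤ.+ t) (sym (ℤ.*-identityʳ (+ n)))))
                (sym (cong (λ t → 1ℚ + t) (ι-mk n)))

ι-^ : ∀ m n → ι (m ℕ.^ n) ≡ ι m ^ℚ n
ι-^ m zero    = refl
ι-^ m (suc n) = trans (ι-* m (m ℕ.^ n)) (cong (ι m *_) (ι-^ m n))

archimedean : ∀ q → Σ[ n ∈ ℕ ] q ≤ ι n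
archimedean q@(mkℚ i d c) = n , subst (q ≤_) (sym (ι-mk n)) (*≤* le)
  where
  n = ℤ.∣ i ∣
  i≤n : ∀ i → i ℤ.≤ + ℤ.∣ i ∣
  i≤n (+ n)         = ℤ.≤-refl
  i≤n (ℤ.-[1+ n ]) = ℤ.-≤+
  le : i ℤ.* + 1 ℤ.≤ + n ℤ.* + suc d
  le = subst (ℤ._≤ + n ℤ.* + suc d) (sym (ℤ.*-identityʳ i))
    (ℤ.≤-trans (i≤n i) (subst (+ n ℤ.≤_) (ℤ.pos-* n (suc d)) (ℤ.+≤+ (ℕ.m≤m*n n (suc d)))))

inv : ∀ m .{{_ : ℕ.NonZero m}} → ℚ
inv m = + 1 / m

inv-inverse : ∀ m .{{_ : ℕ.NonZero m}} → inv m * ι m ≡ 1ℚ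
inv-inverse (suc m) = trans
  (cong₂ _*_ (normalize-coprime (1-coprimeTo (suc m))) (ι-mk (suc m)))
  (*-inverseˡ (mkℚ (+ suc m) 0 (coprime-sym (1-coprimeTo (suc m)))))

0≤inv : ∀ m .{{_ : ℕ.NonZero m}} → 0ℚ ≤ inv m
0≤inv m = nonNegative⁻¹ _ {{normalize-nonNeg 1 m}}

inv≤1 : ∀ m .{{_ : ℕ.NonZero m}} → inv m ≤ 1ℚ
inv≤1 (suc m) = subst₂ _≤_ (*-identityʳ _) (inv-inverse (suc m))
  (*-monoˡ _ (0≤inv (suc m)) (ι-mono {1} {suc m} (s≤s z≤n)))

0≤^ : ∀ {q} → 0ℚ ≤ q → ∀ n → 0ℚ ≤ q ^ℚ n
0≤^ 0≤q zero    = 0≤1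
0≤^ 0≤q (suc n) = 0≤* 0≤q (0≤^ 0≤q n)

^≤1 : ∀ {q} → 0ℚ ≤ q → q ≤ 1ℚ → ∀ n → q ^ℚ n ≤ 1ℚ
^≤1 0≤q q≤1 zero    = ≤-refl
^≤1 0≤q q≤1 (suc n) = *-mono 0≤1 (0≤^ 0≤q n) q≤1 (^≤1 0≤q q≤1 n)

^-+ : ∀ q m n → q ^ℚ (m ℕ.+ n) ≡ q ^ℚ m * q ^ℚ n
^-+ q zero    n = sym (*-identityˡ _)
^-+ q (suc m) n = trans (cong (q *_) (^-+ q m n)) (sym (*-assoc q _ _))

^-* : ∀ p q n → (p * q) ^ℚ n ≡ p ^ℚ n * q ^ℚ n
^-* p q zero    = refl
^-* p q (suc n) = trans (cong (p * q *_) (^-* p q n)) (eq p q (p ^ℚ n) (q ^ℚ n))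
  where
  eq : ∀ a b c d → a * b * (c * d) ≡ a * c * (b * d)
  eq = solve-∀ ℚ-ring

∣^∣≤ : ∀ {u ρ} → ∣ u ∣ ≤ ρ → ∀ n → ∣ u ^ℚ n ∣ ≤ ρ ^ℚ n
∣^∣≤ {u} {ρ} h zero    = ≤-refl
∣^∣≤ {u} {ρ} h (suc n) = subst (_≤ ρ * ρ ^ℚ n) (sym (∣p*q∣≡∣p∣*∣q∣ u (u ^ℚ n)))
  (*-mono (≤-trans (0≤∣p∣ u) h) (0≤∣p∣ (u ^ℚ n)) h (∣^∣≤ h n))

^-lipschitz : ∀ {u v ρ} → ∣ u ∣ ≤ ρ → ∣ v ∣ ≤ ρ → ∀ n →
              ∣ u ^ℚ suc n - v ^ℚ suc n ∣ ≤ (ι (suc n) * ρ ^ℚ n) * ∣ u - v ∣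
^-lipschitz {u} {v} {ρ} hu hv zero = ≤-reflexive (trans
  (cong ∣_∣ (cong₂ _-_ (*-identityʳ u) (*-identityʳ v)))
  (sym (*-identityˡ _)))
^-lipschitz {u} {v} {ρ} hu hv (suc n) = begin
  ∣ u * p - v * q ∣                                  ≡⟨ cong ∣_∣ (eq₁ u v p q) ⟩
  ∣ u * (p - q) + (u - v) * q ∣                      ≤⟨ ∣p+q∣≤∣p∣+∣q∣ (u * (p - q)) ((u - v) * q) ⟩
  ∣ u * (p - q) ∣ + ∣ (u - v) * q ∣                  ≡⟨ cong₂ _+_ (∣p*q∣≡∣p∣*∣q∣ u (p - q)) (∣p*q∣≡∣p∣*∣q∣ (u - v) q) ⟩
  ∣ u ∣ * ∣ p - q ∣ + ∣ u - v ∣ * ∣ q ∣              ≤⟨ +-mono-≤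
      (*-mono 0≤ρ (0≤∣p∣ (p - q)) hu (^-lipschitz hu hv n))
      (*-monoˡ _ (0≤∣p∣ (u - v)) (∣^∣≤ hv (suc n))) ⟩
  ρ * ((ι (suc n) * ρ ^ℚ n) * d) + d * (ρ * ρ ^ℚ n)  ≡⟨ eq₂ ρ (ι (suc n)) (ρ ^ℚ n) d ⟩
  ((1ℚ + ι (suc n)) * (ρ * ρ ^ℚ n)) * d              ≡⟨ cong (λ t → t * (ρ * ρ ^ℚ n) * d) (sym (ι-suc (suc n))) ⟩
  (ι (suc (suc n)) * (ρ * ρ ^ℚ n)) * d               ∎
  where
  open ≤-Reasoning
  p = u ^ℚ suc n
  q = v ^ℚ suc n
  d = ∣ u - v ∣
  0≤ρ : 0ℚ ≤ ρ
  0≤ρ = ≤-trans (0≤∣p∣ u) hu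
  eq₁ : ∀ u v p q → u * p - v * q ≡ u * (p - q) + (u - v) * q
  eq₁ = solve-∀ ℚ-ring
  eq₂ : ∀ r i q d → r * ((i * q) * d) + d * (r * q) ≡ ((1ℚ + i) * (r * q)) * d
  eq₂ = solve-∀ ℚ-ring

module Geometric (θ : ℚ) (0≤θ : 0ℚ ≤ θ) (θ<1 : θ < 1ℚ) where

  d : ℚ
  d = 1ℚ - θ

  0<d : 0ℚ < d
  0<d = p<q⇒0<q-p θ<1

  sum-≤ : ∀ k → sumTo (θ ^ℚ_) k ≤ recip d
  sum-≤ k = begin
    s                 ≡⟨ sym (*-identityʳ s) ⟩
    s * 1ℚ            ≡⟨ cong (s *_) (sym (recip-inverse 0<d)) ⟩
    s * (d * recip d) ≡⟨ eq s d (recip d) ⟩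
    (d * s) * recip d ≤⟨ *-monoʳ _ (<⇒≤ (0<recip 0<d)) (telescope k) ⟩
    1ℚ * recip d      ≡⟨ *-identityˡ _ ⟩
    recip d           ∎
    where
    open ≤-Reasoning
    s = sumTo (θ ^ℚ_) k
    eq : ∀ a b c → a * (b * c) ≡ (b * a) * c
    eq = solve-∀ ℚ-ring
    eq′ : ∀ θ s q → (1ℚ - θ) * (s + q) ≡ (1ℚ - θ) * s + (q - θ * q)
    eq′ = solve-∀ ℚ-ring
    eq″ : ∀ q r → (1ℚ - q) + (q - r) ≡ 1ℚ - r
    eq″ = solve-∀ ℚ-ring
    identity : ∀ k → d * sumTo (θ ^ℚ_) k ≡ 1ℚ - θ ^ℚ k
    identity zero    = *-zeroʳ d
    identity (suc k) = trans (eq′ θ (sumTo (θ ^ℚ_) k) (θ ^ℚ k))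
      (trans (cong (_+ (θ ^ℚ k - θ * θ ^ℚ k)) (identity k)) (eq″ (θ ^ℚ k) (θ * θ ^ℚ k)))
    telescope : ∀ k → d * sumTo (θ ^ℚ_) k ≤ 1ℚ
    telescope k = subst (_≤ 1ℚ) (sym (identity k)) (p-q≤p (0≤^ 0≤θ k))

  bernoulli : ∀ k → θ ^ℚ k * (1ℚ + ι k * d) ≤ 1ℚ
  bernoulli zero    = ≤-reflexive (trans (*-identityˡ _) (cong (λ t → 1ℚ + t) (*-zeroˡ d)))
  bernoulli (suc k) = begin
    θ * q * (1ℚ + ι (suc k) * d)           ≡⟨ cong (λ t → θ * q * (1ℚ + t * d)) (ι-suc k) ⟩
    θ * q * (1ℚ + (1ℚ + ι k) * d)          ≡⟨ eq θ q (ι k) d ⟩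
    θ * (q * (1ℚ + ι k * d)) + d * (θ * q) ≤⟨ +-mono-≤ (*-monoˡ θ 0≤θ (bernoulli k))
                                                (*-monoˡ d (<⇒≤ 0<d) (^≤1 0≤θ (<⇒≤ θ<1) (suc k))) ⟩
    θ * 1ℚ + (1ℚ - θ) * 1ℚ                 ≡⟨ eq′ θ ⟩
    1ℚ                                     ∎
    where
    open ≤-Reasoning
    q = θ ^ℚ k
    eq : ∀ t q i d → t * q * (1ℚ + (1ℚ + i) * d) ≡ t * (q * (1ℚ + i * d)) + d * (t * q)
    eq = solve-∀ ℚ-ring
    eq′ : ∀ t → t * 1ℚ + (1ℚ - t) * 1ℚ ≡ 1ℚ
    eq′ = solve-∀ ℚ-ring

  pow-small : ∀ ε → 0ℚ < ε → Σ[ N ∈ ℕ ] (∀ k → N ℕ.≤ k → θ ^ℚ k ≤ ε)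
  pow-small ε 0<ε = N , bound
    where
    open ≤-Reasoning
    0<dε : 0ℚ < d * ε
    0<dε = 0<* 0<d 0<ε
    N = proj₁ (archimedean (recip (d * ε)))
    bound : ∀ k → N ℕ.≤ k → θ ^ℚ k ≤ ε
    bound k N≤k = begin
      q                              ≡⟨ sym (*-identityʳ q) ⟩
      q * 1ℚ                         ≡⟨ cong (q *_) (sym (recip-inverse 0<dε)) ⟩
      q * (d * ε * recip (d * ε))    ≤⟨ *-monoˡ q 0≤q (*-monoˡ _ (<⇒≤ 0<dε)
                                          (≤-trans (proj₂ (archimedean (recip (d * ε)))) (ι-mono N≤k))) ⟩
      q * (d * ε * ι k)              ≡⟨ eq q d ε (ι k) ⟩
      ε * (q * (ι k * d))            ≤⟨ *-monoˡ ε (<⇒≤ 0<ε) (*-monoˡ q 0≤q le) ⟩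
      ε * (q * (1ℚ + ι k * d))       ≤⟨ *-monoˡ ε (<⇒≤ 0<ε) (bernoulli k) ⟩
      ε * 1ℚ                         ≡⟨ *-identityʳ ε ⟩
      ε                              ∎
      where
      q = θ ^ℚ k
      0≤q = 0≤^ 0≤θ k
      eq : ∀ q d e i → q * (d * e * i) ≡ e * (q * (i * d))
      eq = solve-∀ ℚ-ring
      le : ι k * d ≤ 1ℚ + ι k * d
      le = subst (_≤ 1ℚ + ι k * d) (+-identityˡ _) (+-monoˡ-≤ (ι k * d) 0≤1)

Eventually : (ℕ → Set) → Set
Eventually P = Σ[ N ∈ ℕ ] (∀ k → N ℕ.≤ k → P k)

Cauchy : (ℕ → ℚ) → Set
Cauchy x = ∀ ε → 0ℚ < ε → Σ[ N ∈ ℕ ] (∀ j k → N ℕ.≤ j → N ℕ.≤ k → ∣ x j - x k ∣ ≤ ε)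

cauchy-scaled : ∀ x K → 0ℚ < K →
  (∀ ε → 0ℚ < ε → Σ[ N ∈ ℕ ] (∀ j k → N ℕ.≤ j → N ℕ.≤ k → ∣ x j - x k ∣ ≤ K * ε)) → Cauchy x
cauchy-scaled x K 0<K h ε 0<ε with h (recip K * ε) (0<* (0<recip 0<K) 0<ε)
... | N , f = N , λ j k N≤j N≤k → subst (∣ x j - x k ∣ ≤_) eq (f j k N≤j N≤k)
  where
  eq : K * (recip K * ε) ≡ ε
  eq = trans (sym (*-assoc K _ ε)) (trans (cong (_* ε) (recip-inverse 0<K)) (*-identityˡ ε))

cauchy⇒bounded : ∀ x → Cauchy x → Σ[ M ∈ ℕ ] Eventually (λ k → ∣ x k ∣ ≤ ι (suc M))
cauchy⇒bounded x cx with cx 1ℚ 0<1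
... | N , f with archimedean ∣ x N ∣
... | M , xN≤M = M , N , λ k N≤k → ≤-trans (∣p∣≤∣q∣+∣p-q∣ (x k) (x N))
  (subst (∣ x N ∣ + ∣ x k - x N ∣ ≤_) (trans (+-comm (ι M) 1ℚ) (sym (ι-suc M)))
    (+-mono-≤ xN≤M (f k N N≤k ℕ.≤-refl)))

m≤m⊔n⊔o : ∀ m n o → m ℕ.≤ m ℕ.⊔ n ℕ.⊔ o
m≤m⊔n⊔o m n o = ℕ.≤-trans (ℕ.m≤m⊔n m n) (ℕ.m≤m⊔n _ o)

n≤m⊔n⊔o : ∀ m n o → n ℕ.≤ m ℕ.⊔ n ℕ.⊔ o
n≤m⊔n⊔o m n o = ℕ.≤-trans (ℕ.m≤n⊔m m n) (ℕ.m≤m⊔n _ o)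

-- A function series with terms bounded by, and Lipschitz with constant,
-- A θʲ on D may be evaluated diagonally along a Cauchy sequence lying in D.
series-cauchy :
  (t : ℕ → ℚ → ℚ) (D : ℚ → Set) (A θ : ℚ) → 0ℚ < A → 0ℚ ≤ θ → θ < 1ℚ →
  (∀ j u → D u → ∣ t j u ∣ ≤ A * θ ^ℚ j) →
  (∀ j u v → D u → D v → ∣ t j u - t j v ∣ ≤ (A * θ ^ℚ j) * ∣ u - v ∣) →
  ∀ x → Cauchy x → Eventually (λ k → D (x k)) →
  Cauchy (λ k → sumTo (λ j → t j (x k)) k)
series-cauchy t D A θ 0<A 0≤θ θ<1 bnd lip x cx (N₀ , inD) =
  cauchy-scaled (λ k → S (x k) k) (K * (1ℚ + 2ℚ)) (0<* 0<K (from-yes (0ℚ <? (1ℚ + 2ℚ)))) main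
  where
  open Geometric θ 0≤θ θ<1
  open ≤-Reasoning
  S : ℚ → ℕ → ℚ
  S u = sumTo (λ j → t j u)
  K : ℚ
  K = A * recip d
  0<K : 0ℚ < K
  0<K = 0<* 0<A (0<recip 0<d)
  S-lip : ∀ k u v → D u → D v → ∣ S u k - S v k ∣ ≤ (A * sumTo (θ ^ℚ_) k) * ∣ u - v ∣
  S-lip zero u v _ _ = ≤-reflexive (sym (trans (cong (_* ∣ u - v ∣) (*-zeroʳ A)) (*-zeroˡ ∣ u - v ∣)))
  S-lip (suc k) u v Du Dv = begin
    ∣ (S u k + t k u) - (S v k + t k v) ∣            ≡⟨ cong ∣_∣ (eq (S u k) (t k u) (S v k) (t k v)) ⟩
    ∣ (S u k - S v k) + (t k u - t k v) ∣            ≤⟨ ∣p+q∣≤∣p∣+∣q∣ (S u k - S v k) (t k u - t k v) ⟩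
    ∣ S u k - S v k ∣ + ∣ t k u - t k v ∣            ≤⟨ +-mono-≤ (S-lip k u v Du Dv) (lip k u v Du Dv) ⟩
    (A * sumTo (θ ^ℚ_) k) * e + (A * θ ^ℚ k) * e     ≡⟨ eq′ A (sumTo (θ ^ℚ_) k) (θ ^ℚ k) e ⟩
    (A * (sumTo (θ ^ℚ_) k + θ ^ℚ k)) * e             ∎
    where
    e = ∣ u - v ∣
    eq : ∀ a b c d → (a + b) - (c + d) ≡ (a - c) + (b - d)
    eq = solve-∀ ℚ-ring
    eq′ : ∀ a s q e → (a * s) * e + (a * q) * e ≡ (a * (s + q)) * e
    eq′ = solve-∀ ℚ-ring
  S-tail : ∀ N i u → D u → ∣ S u (i ℕ.+ N) - S u N ∣ ≤ (A * sumTo (θ ^ℚ_) i) * θ ^ℚ N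
  S-tail N zero u Du = ≤-reflexive (trans (cong ∣_∣ (+-inverseʳ (S u N)))
    (sym (trans (cong (_* θ ^ℚ N) (*-zeroʳ A)) (*-zeroˡ (θ ^ℚ N)))))
  S-tail N (suc i) u Du = begin
    ∣ (a + b) - c ∣                           ≡⟨ cong ∣_∣ (eq a b c) ⟩
    ∣ (a - c) + b ∣                           ≤⟨ ∣p+q∣≤∣p∣+∣q∣ (a - c) b ⟩
    ∣ a - c ∣ + ∣ b ∣                         ≤⟨ +-mono-≤ (S-tail N i u Du) (bnd (i ℕ.+ N) u Du) ⟩
    (A * s) * q + A * θ ^ℚ (i ℕ.+ N)          ≡⟨ cong (λ z → (A * s) * q + A * z) (^-+ θ i N) ⟩
    (A * s) * q + A * (θ ^ℚ i * q)            ≡⟨ eq′ A s (θ ^ℚ i) q ⟩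
    (A * (s + θ ^ℚ i)) * q                    ∎
    where
    a = S u (i ℕ.+ N)
    b = t (i ℕ.+ N) u
    c = S u N
    s = sumTo (θ ^ℚ_) i
    q = θ ^ℚ N
    eq : ∀ a b c → (a + b) - c ≡ (a - c) + b
    eq = solve-∀ ℚ-ring
    eq′ : ∀ a s p q → (a * s) * q + a * (p * q) ≡ (a * (s + p)) * q
    eq′ = solve-∀ ℚ-ring
  tail : ∀ N k u → D u → N ℕ.≤ k → ∣ S u k - S u N ∣ ≤ K * θ ^ℚ N
  tail N k u Du N≤k = subst (λ k → ∣ S u k - S u N ∣ ≤ K * θ ^ℚ N) (ℕ.m∸n+n≡m N≤k)
    (≤-trans (S-tail N (k ℕ.∸ N) u Du)
      (*-monoʳ _ (0≤^ 0≤θ N) (*-monoˡ A (<⇒≤ 0<A) (sum-≤ (k ℕ.∸ N)))))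
  main : ∀ ε → 0ℚ < ε → Σ[ N ∈ ℕ ] (∀ j k → N ℕ.≤ j → N ℕ.≤ k →
         ∣ S (x j) j - S (x k) k ∣ ≤ K * (1ℚ + 2ℚ) * ε)
  main ε 0<ε = N , bound
    where
    N₁ = proj₁ (cx ε 0<ε)
    N₂ = proj₁ (pow-small ε 0<ε)
    N  = N₀ ℕ.⊔ N₁ ℕ.⊔ N₂
    θᴺ≤ε : θ ^ℚ N ≤ ε
    θᴺ≤ε = proj₂ (pow-small ε 0<ε) N (ℕ.m≤n⊔m (N₀ ℕ.⊔ N₁) N₂)
    N₁≤N = n≤m⊔n⊔o N₀ N₁ N₂
    N₀≤N = m≤m⊔n⊔o N₀ N₁ N₂
    bound : ∀ j k → N ℕ.≤ j → N ℕ.≤ k → ∣ S (x j) j - S (x k) k ∣ ≤ K * (1ℚ + 2ℚ) * ε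
    bound j k N≤j N≤k = begin
      ∣ S (x j) j - S (x k) k ∣                                         ≤⟨ triangle (S (x j) j) (S (x k) j) (S (x k) k) ⟩
      ∣ S (x j) j - S (x k) j ∣ + ∣ S (x k) j - S (x k) k ∣             ≤⟨ +-mono-≤ part₁ part₂ ⟩
      K * ε + (K * ε + K * ε)                                           ≡⟨ eq K ε ⟩
      K * (1ℚ + 2ℚ) * ε                                                 ∎
      where
      Dj = inD j (ℕ.≤-trans N₀≤N N≤j)
      Dk = inD k (ℕ.≤-trans N₀≤N N≤k)
      eq : ∀ K e → K * e + (K * e + K * e) ≡ K * (1ℚ + (1ℚ + 1ℚ)) * e
      eq = solve-∀ ℚ-ring
      part₁ : ∣ S (x j) j - S (x k) j ∣ ≤ K * ε
      part₁ = ≤-trans (S-lip j (x j) (x k) Dj Dk)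
        (*-mono (<⇒≤ 0<K) (0≤∣p∣ (x j - x k)) (*-monoˡ A (<⇒≤ 0<A) (sum-≤ j))
          (proj₂ (cx ε 0<ε) j k (ℕ.≤-trans N₁≤N N≤j) (ℕ.≤-trans N₁≤N N≤k)))
      tail-ε : ∀ i → N ℕ.≤ i → ∣ S (x k) i - S (x k) N ∣ ≤ K * ε
      tail-ε i N≤i = ≤-trans (tail N i (x k) Dk N≤i) (*-monoˡ K (<⇒≤ 0<K) θᴺ≤ε)
      part₂ : ∣ S (x k) j - S (x k) k ∣ ≤ K * ε + K * ε
      part₂ = ≤-trans (triangle (S (x k) j) (S (x k) N) (S (x k) k))
        (+-mono-≤ (tail-ε j N≤j)
          (subst (_≤ K * ε) (∣p-q∣-sym (S (x k) k) (S (x k) N)) (tail-ε k N≤k)))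

record ℝ : Set where
  constructor mkℝ
  field
    seq    : ℕ → ℚ
    cauchy : Cauchy seq

open ℝ public

infix 4 _<ℝ_ _≤ℝ_

_<ℝ_ : ℝ → ℝ → Set
x <ℝ y = Σ[ ε ∈ ℚ ] (0ℚ < ε × Eventually (λ k → seq x k + ε ≤ seq y k))

_≤ℝ_ : ℝ → ℝ → Set
x ≤ℝ y = ∀ ε → 0ℚ < ε → Eventually (λ k → seq x k ≤ seq y k + ε)

ℚ→ℝ : ℚ → ℝ
ℚ→ℝ q = mkℝ (λ _ → q) (λ ε 0<ε → 0 , λ _ _ _ _ → subst (λ t → ∣ t ∣ ≤ ε) (sym (+-inverseʳ q)) (<⇒≤ 0<ε))

ℕ→ℝ : ℕ → ℝ
ℕ→ℝ n = ℚ→ℝ (ι n)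

0ℝ 1ℝ 2ℝ : ℝ
0ℝ = ℕ→ℝ 0
1ℝ = ℕ→ℝ 1
2ℝ = ℕ→ℝ 2

ℝ⁺ : Set
ℝ⁺ = Σ[ x ∈ ℝ ] 0ℝ <ℝ x

infixl 6 _+ℝ_ _-ℝ_
infixl 7 _*ℝ_ _÷ℝ_

_+ℝ_ : ℝ → ℝ → ℝ
x +ℝ y = mkℝ (λ k → seq x k + seq y k) (cauchy-scaled (λ k → seq x k + seq y k) 2ℚ 0<2 main)
  where
  open ≤-Reasoning
  main : ∀ ε → 0ℚ < ε → Σ[ N ∈ ℕ ] (∀ j k → N ℕ.≤ j → N ℕ.≤ k →
         ∣ (seq x j + seq y j) - (seq x k + seq y k) ∣ ≤ 2ℚ * ε)
  main ε 0<ε = N₁ ℕ.⊔ N₂ , λ j k N≤j N≤k → begin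
      ∣ (seq x j + seq y j) - (seq x k + seq y k) ∣    ≡⟨ cong ∣_∣ (eq (seq x j) (seq y j) (seq x k) (seq y k)) ⟩
      ∣ (seq x j - seq x k) + (seq y j - seq y k) ∣    ≤⟨ ∣p+q∣≤∣p∣+∣q∣ (seq x j - seq x k) (seq y j - seq y k) ⟩
      ∣ seq x j - seq x k ∣ + ∣ seq y j - seq y k ∣    ≤⟨ +-mono-≤
          (proj₂ (cauchy x ε 0<ε) j k (ℕ.≤-trans (ℕ.m≤m⊔n N₁ N₂) N≤j) (ℕ.≤-trans (ℕ.m≤m⊔n N₁ N₂) N≤k))
          (proj₂ (cauchy y ε 0<ε) j k (ℕ.≤-trans (ℕ.m≤n⊔m N₁ N₂) N≤j) (ℕ.≤-trans (ℕ.m≤n⊔m N₁ N₂) N≤k)) ⟩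
      ε + ε                                            ≡⟨ eq′ ε ⟩
      2ℚ * ε                                           ∎
    where
    N₁ = proj₁ (cauchy x ε 0<ε)
    N₂ = proj₁ (cauchy y ε 0<ε)
    eq : ∀ a b c d → (a + b) - (c + d) ≡ (a - c) + (b - d)
    eq = solve-∀ ℚ-ring
    eq′ : ∀ e → e + e ≡ (1ℚ + 1ℚ) * e
    eq′ = solve-∀ ℚ-ring

-ℝ_ : ℝ → ℝ
-ℝ x = mkℝ (λ k → - seq x k) λ ε 0<ε → proj₁ (cauchy x ε 0<ε) , λ j k N≤j N≤k →
  subst (_≤ ε) (sym (trans (cong ∣_∣ (eq (seq x j) (seq x k))) (∣-p∣≡∣p∣ (seq x j - seq x k))))
    (proj₂ (cauchy x ε 0<ε) j k N≤j N≤k)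
  where
  eq : ∀ a b → (- a) - (- b) ≡ - (a - b)
  eq = solve-∀ ℚ-ring

_-ℝ_ : ℝ → ℝ → ℝ
x -ℝ y = x +ℝ (-ℝ y)

_*ℝ_ : ℝ → ℝ → ℝ
x *ℝ y = mkℝ (λ k → seq x k * seq y k) (cauchy-scaled (λ k → seq x k * seq y k) (Mx + My) 0<M main)
  where
  open ≤-Reasoning
  bx = cauchy⇒bounded (seq x) (cauchy x)
  by = cauchy⇒bounded (seq y) (cauchy y)
  Mx = ι (suc (proj₁ bx))
  My = ι (suc (proj₁ by))
  0<M : 0ℚ < Mx + My
  0<M = <-≤-trans 0<1 (≤-trans (ι-mono {1} {suc (proj₁ bx)} (s≤s z≤n)) (p≤p+q (0≤ι (suc (proj₁ by)))))
  main : ∀ ε → 0ℚ < ε → Σ[ N ∈ ℕ ] (∀ j k → N ℕ.≤ j → N ℕ.≤ k →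
         ∣ seq x j * seq y j - seq x k * seq y k ∣ ≤ (Mx + My) * ε)
  main ε 0<ε = N , bound
    where
    N₁ = proj₁ (cauchy x ε 0<ε)
    N₂ = proj₁ (cauchy y ε 0<ε)
    N₃ = proj₁ (proj₂ bx) ℕ.⊔ proj₁ (proj₂ by)
    N  = N₁ ℕ.⊔ N₂ ℕ.⊔ N₃
    N₁≤N = m≤m⊔n⊔o N₁ N₂ N₃
    N₂≤N = n≤m⊔n⊔o N₁ N₂ N₃
    N₃≤N = ℕ.m≤n⊔m (N₁ ℕ.⊔ N₂) N₃
    bound : ∀ j k → N ℕ.≤ j → N ℕ.≤ k → ∣ seq x j * seq y j - seq x k * seq y k ∣ ≤ (Mx + My) * ε
    bound j k N≤j N≤k = begin
      ∣ a * b - c * d ∣                       ≡⟨ cong ∣_∣ (eq a b c d) ⟩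
      ∣ a * (b - d) + d * (a - c) ∣           ≤⟨ ∣p+q∣≤∣p∣+∣q∣ (a * (b - d)) (d * (a - c)) ⟩
      ∣ a * (b - d) ∣ + ∣ d * (a - c) ∣       ≡⟨ cong₂ _+_ (∣p*q∣≡∣p∣*∣q∣ a (b - d)) (∣p*q∣≡∣p∣*∣q∣ d (a - c)) ⟩
      ∣ a ∣ * ∣ b - d ∣ + ∣ d ∣ * ∣ a - c ∣   ≤⟨ +-mono-≤
          (*-mono (0≤ι (suc (proj₁ bx))) (0≤∣p∣ (b - d))
            (proj₂ (proj₂ bx) j (ℕ.≤-trans (ℕ.m≤m⊔n _ _) (ℕ.≤-trans N₃≤N N≤j)))
            (proj₂ (cauchy y ε 0<ε) j k (ℕ.≤-trans N₂≤N N≤j) (ℕ.≤-trans N₂≤N N≤k)))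
          (*-mono (0≤ι (suc (proj₁ by))) (0≤∣p∣ (a - c))
            (proj₂ (proj₂ by) k (ℕ.≤-trans (ℕ.m≤n⊔m (proj₁ (proj₂ bx)) _) (ℕ.≤-trans N₃≤N N≤k)))
            (proj₂ (cauchy x ε 0<ε) j k (ℕ.≤-trans N₁≤N N≤j) (ℕ.≤-trans N₁≤N N≤k))) ⟩
      Mx * ε + My * ε                         ≡⟨ sym (*-distribʳ-+ ε Mx My) ⟩
      (Mx + My) * ε                           ∎
      where
      a = seq x j
      b = seq y j
      c = seq x k
      d = seq y k
      eq : ∀ a b c d → a * b - c * d ≡ a * (b - d) + d * (a - c)
      eq = solve-∀ ℚ-ring

recipℝ : ℝ⁺ → ℝ
recipℝ (x , δ , 0<δ , N₀ , δ≤x) =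
  mkℝ (λ k → recip (seq x k)) (cauchy-scaled (λ k → recip (seq x k)) (r * r) (0<* (0<recip 0<δ) (0<recip 0<δ)) main)
  where
  open ≤-Reasoning
  r = recip δ
  lower : ∀ k → N₀ ℕ.≤ k → δ ≤ seq x k
  lower k h = subst (_≤ seq x k) (+-identityˡ δ) (δ≤x k h)
  main : ∀ ε → 0ℚ < ε → Σ[ N ∈ ℕ ] (∀ j k → N ℕ.≤ j → N ℕ.≤ k →
         ∣ recip (seq x j) - recip (seq x k) ∣ ≤ r * r * ε)
  main ε 0<ε = N₀ ℕ.⊔ N₁ , bound
    where
    N₁ = proj₁ (cauchy x ε 0<ε)
    bound : ∀ j k → N₀ ℕ.⊔ N₁ ℕ.≤ j → N₀ ℕ.⊔ N₁ ℕ.≤ k → ∣ recip (seq x j) - recip (seq x k) ∣ ≤ r * r * ε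
    bound j k N≤j N≤k = begin
      ∣ p - q ∣                                ≡⟨ cong ∣_∣ identity ⟩
      ∣ p * q * (v - u) ∣                      ≡⟨ ∣p*q∣≡∣p∣*∣q∣ (p * q) (v - u) ⟩
      ∣ p * q ∣ * ∣ v - u ∣                    ≡⟨ cong (_* ∣ v - u ∣) (0≤p⇒∣p∣≡p (0≤* (<⇒≤ (0<recip 0<u)) (<⇒≤ (0<recip 0<v)))) ⟩
      p * q * ∣ v - u ∣                        ≤⟨ *-mono (0≤* 0≤r 0≤r) (0≤∣p∣ (v - u))
                                                   (*-mono 0≤r (<⇒≤ (0<recip 0<v)) (recip-anti 0<δ δ≤u) (recip-anti 0<δ δ≤v))
                                                   (proj₂ (cauchy x ε 0<ε) k j (ℕ.≤-trans N₁≤N N≤k) (ℕ.≤-trans N₁≤N N≤j)) ⟩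
      r * r * ε                                ∎
      where
      u = seq x j
      v = seq x k
      p = recip u
      q = recip v
      N₀≤N = ℕ.m≤m⊔n N₀ N₁
      N₁≤N = ℕ.m≤n⊔m N₀ N₁
      0≤r = <⇒≤ (0<recip 0<δ)
      δ≤u = lower j (ℕ.≤-trans N₀≤N N≤j)
      δ≤v = lower k (ℕ.≤-trans N₀≤N N≤k)
      0<u = <-≤-trans 0<δ δ≤u
      0<v = <-≤-trans 0<δ δ≤v
      eq : ∀ p q u v → p * q * (v - u) ≡ p * (v * q) - q * (u * p)
      eq = solve-∀ ℚ-ring
      identity : p - q ≡ p * q * (v - u)
      identity = sym (trans (eq p q u v) (cong₂ _-_
        (trans (cong (p *_) (recip-inverse 0<v)) (*-identityʳ p))
        (trans (cong (q *_) (recip-inverse 0<u)) (*-identityʳ q))))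

_÷ℝ_ : ℝ → ℝ⁺ → ℝ
x ÷ℝ y = x *ℝ recipℝ y

expTerm : ℕ → ℚ → ℚ
expTerm j u = u ^ℚ j * ((+ 1 / j !) {{ℕ._!≢0 j}})

pow≤pow*! : ∀ w j → .{{ℕ.NonZero w}} → w ℕ.^ j ℕ.≤ w ℕ.^ w ℕ.* j !
pow≤pow*! w zero    = ℕ.≤-trans (ℕ.m^n>0 w w) (ℕ.≤-reflexive (sym (ℕ.*-identityʳ (w ℕ.^ w))))
pow≤pow*! w (suc j) with ℕ.≤-total (suc j) w
... | inj₁ j<w = ℕ.≤-trans (ℕ.^-monoʳ-≤ w j<w)
                   (ℕ.m≤m*n (w ℕ.^ w) (suc j !) {{ℕ._!≢0 (suc j)}})
... | inj₂ w≤j = ℕ.≤-trans (ℕ.*-mono-≤ w≤j (pow≤pow*! w j)) (ℕ.≤-reflexive (begin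
    suc j ℕ.* (w ℕ.^ w ℕ.* j !) ≡⟨ sym (ℕ.*-assoc (suc j) (w ℕ.^ w) (j !)) ⟩
    suc j ℕ.* w ℕ.^ w ℕ.* j !   ≡⟨ cong (ℕ._* j !) (ℕ.*-comm (suc j) (w ℕ.^ w)) ⟩
    w ℕ.^ w ℕ.* suc j ℕ.* j !   ≡⟨ ℕ.*-assoc (w ℕ.^ w) (suc j) (j !) ⟩
    w ℕ.^ w ℕ.* (suc j ℕ.* j !) ∎))
  where open ≡-Reasoning

inv-cancel : ∀ m n .{{_ : ℕ.NonZero n}} .{{_ : ℕ.NonZero (m ℕ.* n)}} → inv (m ℕ.* n) * ι m ≡ inv n
inv-cancel m n = begin
  i * ι m                   ≡⟨ sym (*-identityʳ _) ⟩
  i * ι m * 1ℚ              ≡⟨ cong (i * ι m *_) (sym (inv-inverse n)) ⟩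
  i * ι m * (inv n * ι n)   ≡⟨ eq i (ι m) (inv n) (ι n) ⟩
  i * (ι m * ι n) * inv n   ≡⟨ cong (λ t → i * t * inv n) (sym (ι-* m n)) ⟩
  i * ι (m ℕ.* n) * inv n   ≡⟨ cong (_* inv n) (inv-inverse (m ℕ.* n)) ⟩
  1ℚ * inv n                ≡⟨ *-identityˡ _ ⟩
  inv n                     ∎
  where
  open ≡-Reasoning
  i = inv (m ℕ.* n)
  eq : ∀ i m j n → i * m * (j * n) ≡ i * (m * n) * j
  eq = solve-∀ ℚ-ring

∣u*c∣ : ∀ u {c} → 0ℚ ≤ c → ∣ u * c ∣ ≡ ∣ u ∣ * c
∣u*c∣ u {c} 0≤c = trans (∣p*q∣≡∣p∣*∣q∣ u c) (cong (∣ u ∣ *_) (0≤p⇒∣p∣≡p 0≤c))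

u*c-v*c : ∀ u v c → u * c - v * c ≡ (u - v) * c
u*c-v*c = solve-∀ ℚ-ring

module ExpBound (M : ℕ) where
  open ≤-Reasoning

  m w : ℕ
  m = suc M
  w = 2 ℕ.* m

  c : ℕ → ℚ
  c j = inv (j !) {{ℕ._!≢0 j}}

  0≤c : ∀ j → 0ℚ ≤ c j
  0≤c j = 0≤inv (j !) {{ℕ._!≢0 j}}

  A′ : ℚ
  A′ = ι (w ℕ.^ w)

  A : ℚ
  A = 2ℚ * A′

  0<A′ : 0ℚ < A′
  0<A′ = <-≤-trans 0<1 (ι-mono {1} {w ℕ.^ w} (ℕ.m^n>0 w w))

  0<A : 0ℚ < A
  0<A = 0<* 0<2 0<A′

  ιm : ι m ≡ ½ * ι w
  ιm = sym (trans (cong (½ *_) (ι-* 2 m)) (trans (sym (*-assoc ½ 2ℚ (ι m))) (*-identityˡ (ι m))))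

  term≤ : ∀ j → ι m ^ℚ j * c j ≤ A′ * ½ ^ℚ j
  term≤ j = begin
    ι m ^ℚ j * c j                   ≡⟨ cong (λ t → t ^ℚ j * c j) ιm ⟩
    (½ * ι w) ^ℚ j * c j             ≡⟨ cong (_* c j) (^-* ½ (ι w) j) ⟩
    ½ ^ℚ j * ι w ^ℚ j * c j          ≡⟨ cong (λ t → ½ ^ℚ j * t * c j) (sym (ι-^ w j)) ⟩
    ½ ^ℚ j * ι (w ℕ.^ j) * c j       ≤⟨ *-monoʳ (c j) (0≤c j) (*-monoˡ (½ ^ℚ j) 0≤½^j
                                          (ι-mono (pow≤pow*! w j))) ⟩
    ½ ^ℚ j * ι (w ℕ.^ w ℕ.* j !) * c j ≡⟨ cong (λ t → ½ ^ℚ j * t * c j) (ι-* (w ℕ.^ w) (j !)) ⟩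
    ½ ^ℚ j * (A′ * ι (j !)) * c j    ≡⟨ eq (½ ^ℚ j) A′ (ι (j !)) (c j) ⟩
    A′ * ½ ^ℚ j * (c j * ι (j !))    ≡⟨ cong (A′ * ½ ^ℚ j *_) (inv-inverse (j !) {{ℕ._!≢0 j}}) ⟩
    A′ * ½ ^ℚ j * 1ℚ                 ≡⟨ *-identityʳ _ ⟩
    A′ * ½ ^ℚ j                      ∎
    where
    0≤½^j = 0≤^ (from-yes (0ℚ ≤? ½)) j
    eq : ∀ h a i c → h * (a * i) * c ≡ a * h * (c * i)
    eq = solve-∀ ℚ-ring

  bnd : ∀ j u → ∣ u ∣ ≤ ι m → ∣ expTerm j u ∣ ≤ A * ½ ^ℚ j
  bnd j u h = begin
    ∣ u ^ℚ j * c j ∣   ≡⟨ ∣u*c∣ (u ^ℚ j) (0≤c j) ⟩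
    ∣ u ^ℚ j ∣ * c j   ≤⟨ *-monoʳ (c j) (0≤c j) (∣^∣≤ h j) ⟩
    ι m ^ℚ j * c j     ≤⟨ term≤ j ⟩
    A′ * ½ ^ℚ j        ≤⟨ *-monoʳ _ (0≤^ (from-yes (0ℚ ≤? ½)) j) A′≤A ⟩
    A * ½ ^ℚ j         ∎
    where
    A′≤A : A′ ≤ A
    A′≤A = subst (A′ ≤_) (eq A′) (p≤p+q (<⇒≤ 0<A′))
      where
      eq : ∀ a → a + a ≡ (1ℚ + 1ℚ) * a
      eq = solve-∀ ℚ-ring

  lip : ∀ j u v → ∣ u ∣ ≤ ι m → ∣ v ∣ ≤ ι m →
        ∣ expTerm j u - expTerm j v ∣ ≤ (A * ½ ^ℚ j) * ∣ u - v ∣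
  lip zero u v hu hv = 0≤* (0≤* (<⇒≤ 0<A) 0≤1) (0≤∣p∣ (u - v))
  lip (suc j) u v hu hv = begin
    ∣ u ^ℚ suc j * c (suc j) - v ^ℚ suc j * c (suc j) ∣  ≡⟨ cong ∣_∣ (u*c-v*c (u ^ℚ suc j) (v ^ℚ suc j) (c (suc j))) ⟩
    ∣ (u ^ℚ suc j - v ^ℚ suc j) * c (suc j) ∣            ≡⟨ ∣u*c∣ (u ^ℚ suc j - v ^ℚ suc j) (0≤c (suc j)) ⟩
    ∣ u ^ℚ suc j - v ^ℚ suc j ∣ * c (suc j)              ≤⟨ *-monoʳ (c (suc j)) (0≤c (suc j)) (^-lipschitz hu hv j) ⟩
    (ι (suc j) * ι m ^ℚ j) * e * c (suc j)               ≡⟨ eq (ι (suc j)) (ι m ^ℚ j) e (c (suc j)) ⟩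
    (ι m ^ℚ j * (c (suc j) * ι (suc j))) * e             ≡⟨ cong (λ t → (ι m ^ℚ j * t) * e)
                                                              (inv-cancel (suc j) (j !) {{ℕ._!≢0 j}} {{ℕ._!≢0 (suc j)}}) ⟩
    (ι m ^ℚ j * c j) * e                                 ≤⟨ *-monoʳ e (0≤∣p∣ (u - v)) (term≤ j) ⟩
    (A′ * ½ ^ℚ j) * e                                    ≡⟨ cong (λ t → (t * ½ ^ℚ j) * e) (sym (*-identityˡ A′)) ⟩
    (½ * 2ℚ * A′ * ½ ^ℚ j) * e                           ≡⟨ eq′ ½ 2ℚ A′ (½ ^ℚ j) e ⟩
    (A * ½ ^ℚ suc j) * e                                 ∎
    where
    e = ∣ u - v ∣
    eq : ∀ i p e c → (i * p) * e * c ≡ (p * (c * i)) * e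
    eq = solve-∀ ℚ-ring
    eq′ : ∀ h t a p e → (h * t * a * p) * e ≡ (t * a * (h * p)) * e
    eq′ = solve-∀ ℚ-ring

-- exp x = Σⱼ xʲ / j!.  The k-th approximation sums k terms at the k-th
-- approximation of x.
exp : ℝ → ℝ
exp x = mkℝ (λ k → sumTo (λ j → expTerm j (seq x k)) k)
  (series-cauchy expTerm (λ u → ∣ u ∣ ≤ ι (suc M)) A ½ 0<A (from-yes (0ℚ ≤? ½)) (from-yes (½ <? 1ℚ)) bnd lip
    (seq x) (cauchy x) (proj₂ (cauchy⇒bounded (seq x) (cauchy x))))
  where
  M = proj₁ (cauchy⇒bounded (seq x) (cauchy x))
  open ExpBound M

∣_∣<1 : ℝ → Set
∣ z ∣<1 = Σ[ ρ ∈ ℚ ] (0ℚ ≤ ρ × ρ < 1ℚ × Eventually (λ k → ∣ seq z k ∣ ≤ ρ))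

artanhTerm : ℕ → ℚ → ℚ
artanhTerm j u = u ^ℚ suc (2 ℕ.* j) * (+ 1 / suc (2 ℕ.* j))

-- artanh z = Σⱼ z²ʲ⁺¹ / (2j + 1)
artanh : (z : ℝ) → ∣ z ∣<1 → ℝ
artanh z (ρ , 0≤ρ , ρ<1 , ∣z∣≤ρ) = mkℝ (λ k → sumTo (λ j → artanhTerm j (seq z k)) k)
  (series-cauchy artanhTerm (λ u → ∣ u ∣ ≤ ρ) 1ℚ (ρ * ρ) 0<1 (0≤* 0≤ρ 0≤ρ) ρ²<1 bnd lip (seq z) (cauchy z) ∣z∣≤ρ)
  where
  open ≤-Reasoning
  ρ²<1 : ρ * ρ < 1ℚ
  ρ²<1 = ≤-<-trans (subst (ρ * ρ ≤_) (*-identityʳ ρ) (*-monoˡ ρ 0≤ρ (<⇒≤ ρ<1))) ρ<1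
  ρ^2j : ∀ j → ρ ^ℚ (2 ℕ.* j) ≡ 1ℚ * (ρ * ρ) ^ℚ j
  ρ^2j j = trans (cong (λ i → ρ ^ℚ (j ℕ.+ i)) (ℕ.+-identityʳ j))
    (trans (^-+ ρ j j) (trans (sym (^-* ρ ρ j)) (sym (*-identityˡ _))))
  bnd : ∀ j u → ∣ u ∣ ≤ ρ → ∣ artanhTerm j u ∣ ≤ 1ℚ * (ρ * ρ) ^ℚ j
  bnd j u h = begin
    ∣ u ^ℚ i * inv i ∣        ≡⟨ ∣u*c∣ (u ^ℚ i) (0≤inv i) ⟩
    ∣ u ^ℚ i ∣ * inv i        ≤⟨ *-mono (0≤^ 0≤ρ i) (0≤inv i) (∣^∣≤ h i) (inv≤1 i) ⟩
    ρ ^ℚ i * 1ℚ               ≡⟨ *-identityʳ _ ⟩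
    ρ * ρ ^ℚ (2 ℕ.* j)        ≤⟨ *-monoʳ _ (0≤^ 0≤ρ (2 ℕ.* j)) (<⇒≤ ρ<1) ⟩
    1ℚ * ρ ^ℚ (2 ℕ.* j)       ≡⟨ *-identityˡ _ ⟩
    ρ ^ℚ (2 ℕ.* j)            ≡⟨ ρ^2j j ⟩
    1ℚ * (ρ * ρ) ^ℚ j         ∎
    where i = suc (2 ℕ.* j)
  lip : ∀ j u v → ∣ u ∣ ≤ ρ → ∣ v ∣ ≤ ρ →
        ∣ artanhTerm j u - artanhTerm j v ∣ ≤ (1ℚ * (ρ * ρ) ^ℚ j) * ∣ u - v ∣
  lip j u v hu hv = begin
    ∣ u ^ℚ i * inv i - v ^ℚ i * inv i ∣       ≡⟨ cong ∣_∣ (u*c-v*c (u ^ℚ i) (v ^ℚ i) (inv i)) ⟩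
    ∣ (u ^ℚ i - v ^ℚ i) * inv i ∣             ≡⟨ ∣u*c∣ (u ^ℚ i - v ^ℚ i) (0≤inv i) ⟩
    ∣ u ^ℚ i - v ^ℚ i ∣ * inv i               ≤⟨ *-monoʳ (inv i) (0≤inv i) (^-lipschitz hu hv (2 ℕ.* j)) ⟩
    (ι i * ρ ^ℚ (2 ℕ.* j)) * e * inv i        ≡⟨ eq (ι i) (ρ ^ℚ (2 ℕ.* j)) e (inv i) ⟩
    (ρ ^ℚ (2 ℕ.* j) * (inv i * ι i)) * e      ≡⟨ cong (λ t → (ρ ^ℚ (2 ℕ.* j) * t) * e) (inv-inverse i) ⟩
    (ρ ^ℚ (2 ℕ.* j) * 1ℚ) * e                 ≡⟨ cong (_* e) (trans (*-identityʳ _) (ρ^2j j)) ⟩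
    (1ℚ * (ρ * ρ) ^ℚ j) * e                   ∎
    where
    i = suc (2 ℕ.* j)
    e = ∣ u - v ∣
    eq : ∀ i p e c → (i * p) * e * c ≡ (p * (c * i)) * e
    eq = solve-∀ ℚ-ring

upper : ∀ x → Σ[ M ∈ ℕ ] Eventually (λ k → seq x k ≤ ι (suc M))
upper x = proj₁ b , proj₁ (proj₂ b) , λ k N≤k → ≤-trans (p≤∣p∣ (seq x k)) (proj₂ (proj₂ b) k N≤k)
  where b = cauchy⇒bounded (seq x) (cauchy x)

0<x+1 : ∀ {x} → 0ℝ <ℝ x → 0ℝ <ℝ x +ℝ 1ℝ
0<x+1 {x} (δ , 0<δ , N , δ≤x) = δ , 0<δ , N , λ k N≤k → ≤-trans (δ≤x k N≤k) (p≤p+q {seq x k} {1ℚ} 0≤1)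

⊔-< : ∀ {p q r} → p < r → q < r → p ⊔ q < r
⊔-< {p} {q} {r} p<r q<r with ⊔-sel p q
... | inj₁ e = subst (_< r) (sym e) p<r
... | inj₂ e = subst (_< r) (sym e) q<r

1-q<1 : ∀ {q} → 0ℚ < q → 1ℚ - q < 1ℚ
1-q<1 {q} 0<q = subst (1ℚ - q <_) (+-identityʳ 1ℚ) (+-monoʳ-< 1ℚ (neg-antimono-< 0<q))

1-q≤1-p : ∀ {p q} → p ≤ q → 1ℚ - q ≤ 1ℚ - p
1-q≤1-p p≤q = +-monoʳ-≤ 1ℚ (neg-antimono-≤ p≤q)

-- The Cayley transform (x - 1) / (x + 1) maps (0 , ∞) onto (-1 , 1).
cayley : ℝ⁺ → ℝ
cayley (x , 0<x) = (x -ℝ 1ℝ) ÷ℝ (x +ℝ 1ℝ , 0<x+1 {x} 0<x)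

∣cayley∣<1 : ∀ x → ∣ cayley x ∣<1
∣cayley∣<1 (x , δ , 0<δ , N₁ , δ≤x) =
  ρ , ≤-trans (0≤∣p∣ (z N)) (bound N ℕ.≤-refl) , ρ<1 , N , bound
  where
  M  = proj₁ (upper x)
  N₂ = proj₁ (proj₂ (upper x))
  N  = N₁ ℕ.⊔ N₂
  z  = seq (cayley (x , δ , 0<δ , N₁ , δ≤x))
  0<M+1 : 0ℚ < ι (suc M) + 1ℚ
  0<M+1 = <-≤-trans 0<1 (≤-trans (ι-mono {1} {suc M} (s≤s z≤n)) (p≤p+q {ι (suc M)} {1ℚ} 0≤1))
  r₀ = recip (ι (suc M) + 1ℚ)
  0<r₀ = 0<recip 0<M+1
  ρ₁ ρ₂ ρ : ℚ
  ρ₁ = 1ℚ - (r₀ + r₀)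
  ρ₂ = 1ℚ - (δ * r₀ + δ * r₀)
  ρ  = ρ₁ ⊔ ρ₂
  ρ<1 : ρ < 1ℚ
  ρ<1 = ⊔-< {ρ₁} {ρ₂} (1-q<1 (+-mono-< 0<r₀ 0<r₀)) (1-q<1 (+-mono-< (0<* 0<δ 0<r₀) (0<* 0<δ 0<r₀)))
  bound : ∀ k → N ℕ.≤ k → ∣ z k ∣ ≤ ρ
  bound k N≤k = ∣p∣≤ {(u - 1ℚ) * r} {ρ}
    (≤-trans (≤-reflexive above) (≤-trans (1-q≤1-p (+-mono-≤ r₀≤r r₀≤r)) (p≤p⊔q ρ₁ ρ₂)))
    (≤-trans (≤-reflexive below) (≤-trans (1-q≤1-p (+-mono-≤ δr₀≤ur δr₀≤ur)) (p≤q⊔p ρ₁ ρ₂)))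
    where
    u = seq x k
    δ≤u : δ ≤ u
    δ≤u = subst (_≤ u) (+-identityˡ δ) (δ≤x k (ℕ.≤-trans (ℕ.m≤m⊔n N₁ N₂) N≤k))
    0<u = <-≤-trans 0<δ δ≤u
    0<u+1 : 0ℚ < u + 1ℚ
    0<u+1 = <-≤-trans 0<u (p≤p+q {u} {1ℚ} 0≤1)
    r = recip (u + 1ℚ)
    r₀≤r : r₀ ≤ r
    r₀≤r = recip-anti 0<u+1 (+-monoˡ-≤ 1ℚ (proj₂ (proj₂ (upper x)) k (ℕ.≤-trans (ℕ.m≤n⊔m N₁ N₂) N≤k)))
    δr₀≤ur : δ * r₀ ≤ u * r
    δr₀≤ur = *-mono (<⇒≤ 0<u) (<⇒≤ 0<r₀) δ≤u r₀≤r
    eq₁ : ∀ u r → (u - 1ℚ) * r ≡ (u + 1ℚ) * r - (r + r)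
    eq₁ = solve-∀ ℚ-ring
    eq₂ : ∀ u r → - ((u - 1ℚ) * r) ≡ (u + 1ℚ) * r - (u * r + u * r)
    eq₂ = solve-∀ ℚ-ring
    above : (u - 1ℚ) * r ≡ 1ℚ - (r + r)
    above = trans (eq₁ u r) (cong (_- (r + r)) (recip-inverse 0<u+1))
    below : - ((u - 1ℚ) * r) ≡ 1ℚ - (u * r + u * r)
    below = trans (eq₂ u r) (cong (_- (u * r + u * r)) (recip-inverse 0<u+1))

-- ln x = 2 artanh ((x - 1) / (x + 1)), valid for every x > 0.
ln : ℝ⁺ → ℝ
ln x = 2ℝ *ℝ artanh (cayley x) (∣cayley∣<1 x)

infixr 8 _^ℝ_

_^ℝ_ : ℝ⁺ → ℝ → ℝ
x ^ℝ t = exp (t *ℝ ln x)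

0≤artanhTerm : ∀ {u} → 0ℚ ≤ u → ∀ j → 0ℚ ≤ artanhTerm j u
0≤artanhTerm 0≤u j = 0≤* (0≤^ 0≤u (suc (2 ℕ.* j))) (0≤inv (suc (2 ℕ.* j)))

sumTo-mono : ∀ t → (∀ j → 0ℚ ≤ t j) → ∀ {m n} → m ℕ.≤ n → sumTo t m ≤ sumTo t n
sumTo-mono t 0≤t m≤n = go (ℕ.≤⇒≤′ m≤n)
  where
  go : ∀ {m n} → m ℕ.≤′ n → sumTo t m ≤ sumTo t n
  go ℕ.≤′-refl       = ≤-refl
  go (ℕ.≤′-step m≤n) = ≤-trans (go m≤n) (p≤p+q (0≤t _))

0<ln : ∀ x (0<x : 0ℝ <ℝ x) → 1ℝ <ℝ x → 0ℝ <ℝ ln (x , 0<x)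
0<ln x 0<x (δ , 0<δ , N₁ , 1+δ≤x) = 2ℚ * (δ * r₀) , 0<* 0<2 (0<* 0<δ 0<r₀) , N , bound
  where
  open ≤-Reasoning
  M  = proj₁ (upper x)
  N₂ = proj₁ (proj₂ (upper x))
  N  = N₁ ℕ.⊔ N₂ ℕ.⊔ 1
  0<M+1 : 0ℚ < ι (suc M) + 1ℚ
  0<M+1 = <-≤-trans 0<1 (≤-trans (ι-mono {1} {suc M} (s≤s z≤n)) (p≤p+q {ι (suc M)} {1ℚ} 0≤1))
  r₀ = recip (ι (suc M) + 1ℚ)
  0<r₀ = 0<recip 0<M+1
  bound : ∀ k → N ℕ.≤ k → 0ℚ + 2ℚ * (δ * r₀) ≤ seq (ln (x , 0<x)) k
  bound k N≤k = begin
    0ℚ + 2ℚ * (δ * r₀)                                ≡⟨ +-identityˡ _ ⟩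
    2ℚ * (δ * r₀)                                     ≤⟨ *-monoˡ 2ℚ (<⇒≤ 0<2) δr₀≤z ⟩
    2ℚ * z                                            ≡⟨ cong (2ℚ *_) (sym (first z)) ⟩
    2ℚ * sumTo (λ j → artanhTerm j z) 1               ≤⟨ *-monoˡ 2ℚ (<⇒≤ 0<2)
                                                           (sumTo-mono _ (0≤artanhTerm 0≤z)
                                                             (ℕ.≤-trans (ℕ.m≤n⊔m (N₁ ℕ.⊔ N₂) 1) N≤k)) ⟩
    2ℚ * sumTo (λ j → artanhTerm j z) k               ∎
    where
    u = seq x k
    r = recip (u + 1ℚ)
    z = (u - 1ℚ) * r
    eq : ∀ d → d ≡ (1ℚ + d) - 1ℚ
    eq = solve-∀ ℚ-ring
    1+δ≤u : 1ℚ + δ ≤ u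
    1+δ≤u = 1+δ≤x k (ℕ.≤-trans (m≤m⊔n⊔o N₁ N₂ 1) N≤k)
    δ≤u-1 : δ ≤ u - 1ℚ
    δ≤u-1 = subst (_≤ u - 1ℚ) (sym (eq δ)) (+-monoˡ-≤ (- 1ℚ) 1+δ≤u)
    0<u+1 : 0ℚ < u + 1ℚ
    0<u+1 = <-≤-trans 0<1 (≤-trans (≤-trans (p≤p+q (<⇒≤ 0<δ)) 1+δ≤u) (p≤p+q 0≤1))
    r₀≤r : r₀ ≤ r
    r₀≤r = recip-anti 0<u+1 (+-monoˡ-≤ 1ℚ (proj₂ (proj₂ (upper x)) k (ℕ.≤-trans (n≤m⊔n⊔o N₁ N₂ 1) N≤k)))
    δr₀≤z : δ * r₀ ≤ z
    δr₀≤z = *-mono (≤-trans (<⇒≤ 0<δ) δ≤u-1) (<⇒≤ 0<r₀) δ≤u-1 r₀≤r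
    0≤z = ≤-trans (0≤* (<⇒≤ 0<δ) (<⇒≤ 0<r₀)) δr₀≤z
    first : ∀ z → sumTo (λ j → artanhTerm j z) 1 ≡ z
    first z = trans (+-identityˡ _) (trans (*-identityʳ _) (*-identityʳ z))

0<ℕ : ∀ n → 1 ℕ.≤ n → 0ℝ <ℝ ℕ→ℝ n
0<ℕ n 1≤n = 1ℚ , 0<1 , 0 , λ _ _ → ι-mono {1} {n} 1≤n

-- ln 3 > 2 (1/2 + (1/2)³ / 3) > 1
1<ln : ∀ n (1≤n : 1 ℕ.≤ n) → 3 ℕ.≤ n → 1ℝ <ℝ ln (ℕ→ℝ n , 0<ℕ n 1≤n)
1<ln n 1≤n 3≤n = + 1 / 12 , from-yes (0ℚ <? (+ 1 / 12)) , 2 , bound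
  where
  open ≤-Reasoning
  u = ι n
  r = recip (u + 1ℚ)
  z = (u - 1ℚ) * r
  0<u+1 : 0ℚ < u + 1ℚ
  0<u+1 = <-≤-trans 0<1 (≤-trans (ι-mono {1} {n} 1≤n) (p≤p+q 0≤1))
  eq : ∀ h u r → (h * (1ℚ + u) * r) + h * (u - (1ℚ + 1ℚ + 1ℚ)) * r ≡ (h + h) * ((u - 1ℚ) * r)
  eq = solve-∀ ℚ-ring
  ½≤z : ½ ≤ z
  ½≤z = begin
    ½                                                           ≡⟨ sym (*-identityʳ ½) ⟩
    ½ * 1ℚ                                                      ≡⟨ cong (½ *_) (sym (trans (cong (_* r) (+-comm 1ℚ u)) (recip-inverse 0<u+1))) ⟩
    ½ * ((1ℚ + u) * r)                                          ≡⟨ sym (*-assoc ½ (1ℚ + u) r) ⟩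
    ½ * (1ℚ + u) * r                                            ≤⟨ p≤p+q (0≤* (0≤* (from-yes (0ℚ ≤? ½)) (p≤q⇒0≤q-p (ι-mono {3} {n} 3≤n))) (<⇒≤ (0<recip 0<u+1))) ⟩
    ½ * (1ℚ + u) * r + ½ * (u - (1ℚ + 1ℚ + 1ℚ)) * r             ≡⟨ eq ½ u r ⟩
    1ℚ * z                                                      ≡⟨ *-identityˡ z ⟩
    z                                                           ∎
  0≤½ = from-yes (0ℚ ≤? ½)
  0≤z = ≤-trans 0≤½ ½≤z
  ^-mono : ∀ j → ½ ^ℚ j ≤ z ^ℚ j
  ^-mono zero    = ≤-refl
  ^-mono (suc j) = *-mono 0≤z (0≤^ 0≤½ j) ½≤z (^-mono j)
  term-mono : ∀ j → artanhTerm j ½ ≤ artanhTerm j z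
  term-mono j = *-monoʳ _ (0≤inv (suc (2 ℕ.* j))) (^-mono (suc (2 ℕ.* j)))
  bound : ∀ k → 2 ℕ.≤ k → 1ℚ + (+ 1 / 12) ≤ 2ℚ * sumTo (λ j → artanhTerm j z) k
  bound k 2≤k = begin
    1ℚ + (+ 1 / 12)                                   ≡⟨⟩
    2ℚ * ((0ℚ + artanhTerm 0 ½) + artanhTerm 1 ½)     ≤⟨ *-monoˡ 2ℚ (<⇒≤ 0<2) (+-mono-≤ (+-monoʳ-≤ 0ℚ (term-mono 0)) (term-mono 1)) ⟩
    2ℚ * ((0ℚ + artanhTerm 0 z) + artanhTerm 1 z)     ≤⟨ *-monoˡ 2ℚ (<⇒≤ 0<2) (sumTo-mono _ (0≤artanhTerm 0≤z) 2≤k) ⟩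
    2ℚ * sumTo (λ j → artanhTerm j z) k               ∎

1<⇒0< : ∀ x → 1ℝ <ℝ x → 0ℝ <ℝ x
1<⇒0< x (ε , 0<ε , N , f) = ε , 0<ε , N , λ k N≤k → ≤-trans (+-monoˡ-≤ ε 0≤1) (f k N≤k)

lnℕ : ∀ n → 3 ℕ.≤ n → ℝ⁺
lnℕ n 3≤n = ln (ℕ→ℝ n , 0<ℕ n 1≤n) , 1<⇒0< (ln (ℕ→ℝ n , 0<ℕ n 1≤n)) (1<ln n 1≤n 3≤n)
  where
  1≤n : 1 ℕ.≤ n
  1≤n = ℕ.≤-trans (s≤s z≤n) 3≤n

-- ln ln n, which is positive for n ≥ 3.
lnln : ∀ n → 3 ℕ.≤ n → ℝ⁺
lnln n 3≤n = ln (lnℕ n 3≤n) ,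
  0<ln (proj₁ (lnℕ n 3≤n)) (proj₂ (lnℕ n 3≤n)) (1<ln n (ℕ.≤-trans (s≤s z≤n) 3≤n) 3≤n)

record PrimePowerFactorisation (n : ℕ) : Set where
  field
    k          : ℕ
    p          : Fin k → ℕ
    l          : Fin k → ℕ
    p-prime    : ∀ i → Prime (p i)
    p-distinct : ∀ {i j} → p i ≡ p j → i ≡ j
    l≥1        : ∀ i → 1 ℕ.≤ l i
    n≡∏p^l     : n ≡ product (tabulate (λ i → p i ℕ.^ l i))

factorise : ∀ n → .{{ℕ.NonZero n}} → PrimePowerFactorisation n
factorise n = record
  { k          = List.length fs
  ; p          = λ i → proj₁ (List.lookup fs i)
  ; l          = λ i → proj₂ (List.lookup fs i)
  ; p-prime    = λ i → proj₁ (lookupAll good i)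
  ; p-distinct = λ {i} {j} → injective distinct i j
  ; l≥1        = λ i → proj₂ (lookupAll good i)
  ; n≡∏p^l     = trans isFactorisation (trans (sym value) (sym (tabulate-power fs)))
  }
  where
  open PrimeFactorisation (Factorisation.factorise n) using (isFactorisation; factorsPrime)

  Good : ℕ × ℕ → Set
  Good (p , l) = Prime p × 1 ℕ.≤ l

  Distinct : List (ℕ × ℕ) → Set
  Distinct = AllPairs (λ x y → proj₁ x ≢ proj₁ y)

  power : ℕ × ℕ → ℕ
  power (p , l) = p ℕ.^ l

  insert : ℕ → List (ℕ × ℕ) → List (ℕ × ℕ)
  insert p [] = (p , 1) ∷ []
  insert p ((q , m) ∷ fs) with p ℕ.≟ q
  ... | yes _ = (q , suc m) ∷ fs
  ... | no  _ = (q , m) ∷ insert p fs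

  insert-good : ∀ {p} fs → Prime p → All Good fs → All Good (insert p fs)
  insert-good [] pp [] = (pp , s≤s z≤n) ∷ []
  insert-good {p} ((q , m) ∷ fs) pp ((pq , _) ∷ gs) with p ℕ.≟ q
  ... | yes _ = (pq , s≤s z≤n) ∷ gs
  insert-good {p} ((q , m) ∷ fs) pp (g ∷ gs) | no _ = g ∷ insert-good fs pp gs

  insert-≢ : ∀ {p q} fs → q ≢ p → All (λ y → q ≢ proj₁ y) fs → All (λ y → q ≢ proj₁ y) (insert p fs)
  insert-≢ [] q≢p [] = q≢p ∷ []
  insert-≢ {p} ((r , m) ∷ fs) q≢p (q≢r ∷ hs) with p ℕ.≟ r
  ... | yes _ = q≢r ∷ hs
  ... | no  _ = q≢r ∷ insert-≢ fs q≢p hs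

  insert-distinct : ∀ p fs → Distinct fs → Distinct (insert p fs)
  insert-distinct p [] [] = [] ∷ []
  insert-distinct p ((q , m) ∷ fs) (h ∷ hs) with p ℕ.≟ q
  ... | yes _  = h ∷ hs
  ... | no p≢q = insert-≢ fs (λ q≡p → p≢q (sym q≡p)) h ∷ insert-distinct p fs hs

  insert-value : ∀ p fs → product (List.map power (insert p fs)) ≡ p ℕ.* product (List.map power fs)
  insert-value p [] = cong (ℕ._* 1) (ℕ.^-identityʳ p)
  insert-value p ((q , m) ∷ fs) with p ℕ.≟ q
  ... | yes refl = ℕ.*-assoc p (p ℕ.^ m) _
  ... | no _     = trans (cong (q ℕ.^ m ℕ.*_) (insert-value p fs)) (begin
      q ℕ.^ m ℕ.* (p ℕ.* v)   ≡⟨ sym (ℕ.*-assoc (q ℕ.^ m) p v) ⟩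
      q ℕ.^ m ℕ.* p ℕ.* v     ≡⟨ cong (ℕ._* v) (ℕ.*-comm (q ℕ.^ m) p) ⟩
      p ℕ.* q ℕ.^ m ℕ.* v     ≡⟨ ℕ.*-assoc p (q ℕ.^ m) v ⟩
      p ℕ.* (q ℕ.^ m ℕ.* v)   ∎)
    where
    open ≡-Reasoning
    v = product (List.map power fs)

  collect : List ℕ → List (ℕ × ℕ)
  collect = List.foldr insert []

  collect-good : ∀ {ps} → All Prime ps → All Good (collect ps)
  collect-good []         = []
  collect-good (pp ∷ pps) = insert-good _ pp (collect-good pps)

  collect-distinct : ∀ ps → Distinct (collect ps)
  collect-distinct []       = []
  collect-distinct (p ∷ ps) = insert-distinct p (collect ps) (collect-distinct ps)

  collect-value : ∀ ps → product (List.map power (collect ps)) ≡ product ps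
  collect-value []       = refl
  collect-value (p ∷ ps) = trans (insert-value p (collect ps)) (cong (p ℕ.*_) (collect-value ps))

  lookupAll : ∀ {P : ℕ × ℕ → Set} {xs} → All P xs → ∀ i → P (List.lookup xs i)
  lookupAll (px ∷ _)   Fin.zero    = px
  lookupAll (_  ∷ pxs) (Fin.suc i) = lookupAll pxs i

  injective : ∀ {xs} → Distinct xs → ∀ i j → proj₁ (List.lookup xs i) ≡ proj₁ (List.lookup xs j) → i ≡ j
  injective (h ∷ hs) Fin.zero    Fin.zero    e = refl
  injective (h ∷ hs) Fin.zero    (Fin.suc j) e = contradiction e (lookupAll h j)
  injective (h ∷ hs) (Fin.suc i) Fin.zero    e = contradiction (sym e) (lookupAll h i)
  injective (h ∷ hs) (Fin.suc i) (Fin.suc j) e = cong Fin.suc (injective hs i j e)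

  tabulate-power : ∀ xs → product (tabulate (λ i → proj₁ (List.lookup xs i) ℕ.^ proj₂ (List.lookup xs i)))
                          ≡ product (List.map power xs)
  tabulate-power []       = refl
  tabulate-power (x ∷ xs) = cong (power x ℕ.*_) (tabulate-power xs)

  fs       = collect (factors (Factorisation.factorise n))
  good     = collect-good factorsPrime
  distinct = collect-distinct (factors (Factorisation.factorise n))
  value    = collect-value (factors (Factorisation.factorise n))

cube : ∀ k → List (Vec (Fin 2) k)
cube zero    = [] ∷ []
cube (suc k) = List.map (0F ∷_) (cube k) ++ List.map (1F ∷_) (cube k)

weight : ∀ {k} → Vec (Fin 2) k → ℕ
weight ε = Vec.sum (Vec.map toℕ ε)

module _ {n : ℕ} (a : ℕ) (F : PrimePowerFactorisation n) where
  open PrimePowerFactorisation F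

  reducedExponent : Vec (Fin 2) k → ℕ
  reducedExponent ε = product (tabulate (λ i → p i ℕ.^ (l i ℕ.∸ toℕ (Vec.lookup ε i))))

  factor : Vec (Fin 2) k → ℕ
  factor ε = a ℕ.^ reducedExponent ε ℕ.∸ 1

  evenProduct oddProduct : ℕ
  evenProduct = product (List.map factor (filter (λ ε → 2 ∣? weight ε) (cube k)))
  oddProduct  = product (List.map factor (filter (λ ε → ¬? (2 ∣? weight ε)) (cube k)))

  module _ (2≤a : 2 ℕ.≤ a) where

    reducedExponent≢0 : ∀ ε → ℕ.NonZero (reducedExponent ε)
    reducedExponent≢0 ε = product≢0 (All.tabulate⁺ λ i →
      ℕ.m^n≢0 (p i) (l i ℕ.∸ toℕ (Vec.lookup ε i)) {{prime⇒nonZero (p-prime i)}})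

    factor≢0 : ∀ ε → ℕ.NonZero (factor ε)
    factor≢0 ε = ℕ.>-nonZero (ℕ.m<n⇒0<n∸m (ℕ.≤-trans 2≤a
      (ℕ.≤-trans (ℕ.≤-reflexive (sym (ℕ.^-identityʳ a)))
        (ℕ.^-monoʳ-≤ a {{ℕ.>-nonZero (ℕ.≤-trans (s≤s z≤n) 2≤a)}} (ℕ.>-nonZero⁻¹ _ {{reducedExponent≢0 ε}})))))

    oddProduct≢0 : ℕ.NonZero oddProduct
    oddProduct≢0 = product≢0 (All.map⁺ (All.universal factor≢0 (filter (λ ε → ¬? (2 ∣? weight ε)) (cube k))))

-- Pr(aⁿ - 1), as an exact quotient in ℚ.
Pr : ∀ {n} a → 2 ℕ.≤ a → PrimePowerFactorisation n → ℚ
Pr a 2≤a F = (+ evenProduct a F / oddProduct a F) {{oddProduct≢0 a F 2≤a}}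

0<aⁿ-1 : ∀ a n → 2 ℕ.≤ a → 3 ℕ.≤ n → 0ℝ <ℝ ℕ→ℝ (a ℕ.^ n ℕ.∸ 1)
0<aⁿ-1 a n 2≤a 3≤n = 0<ℕ _ (ℕ.m<n⇒0<n∸m (ℕ.≤-trans 2≤a
  (ℕ.≤-trans (ℕ.≤-reflexive (sym (ℕ.^-identityʳ a)))
    (ℕ.^-monoʳ-≤ a {{ℕ.>-nonZero (ℕ.≤-trans (s≤s z≤n) 2≤a)}} (ℕ.≤-trans (s≤s z≤n) 3≤n)))))

{-# OPTIONS --safe #-}
-- Pr (aⁿ - 1) is the value Φₙ(a) of the n-th cyclotomic polynomial.  With x = a^(n / rad n) and
-- u = 1/x, the quotient Φₙ(a) / a^φ(n) is (1 - u)^±1 up to factors 1 - u^d with d ≥ 2, and an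
-- induction on the primes of n gives Φₙ(a) ≥ a^φ(n) / 2.
--
-- It remains to see φ(n) ≫ n / ln ln n, that is S = ∏_{p ∣ n} (1 + 1/p) ≪ ln ln n.  Expand S as
-- the sum of 1/d over the squarefree d ∣ n.  The d ≤ 2ᵀ contribute at most T + 1, and the others at
-- most T⁻¹ Σ_d log₂ d / d ≤ S M / T with M = Σ_{p ∣ n} log₂ p / p, so T = 2 M gives S ≤ 2 (T + 1).
-- Finally M ≪ ln ln n: the Chebyshev bound for the primes in (2ⁱ, 2ⁱ⁺¹] shows that each dyadic
-- interval contributes O(1), and the primes above log₂ n contribute at most O(log n) / log n.
--
-- Since exp and ln are given by series, ln is compared with log₂ by splitting the artanh series
-- against the harmonic series, and exp is bounded by iterating (1 - c) exp (x + c) ≤ exp x.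
module Submission where

open import Data.Fin.Base as Fin using (Fin; toℕ)
open import Data.Fin.Patterns using (0F; 1F)
import Data.Integer.Base as ℤ
import Data.Integer.Properties as ℤ
open import Data.List.Base as List using (List; []; _∷_; _++_; filter; tabulate)
open import Data.List.Membership.Propositional using (_∈_)
open import Data.List.Membership.Propositional.Properties using (∈-∃++; ∈-++⁻; ∈-++⁺ˡ; ∈-++⁺ʳ; ∈-applyDownFrom⁺; ∈-filter⁺; ∈-filter⁻; ∈-map⁻)
open import Data.List.Properties using (filter-++; filter-≐; map-++; map-∘; map-cong; filter-none)
open import Data.List.Relation.Unary.All as All using (All; []; _∷_)
import Data.List.Relation.Unary.All.Properties as All
open import Data.List.Relation.Unary.AllPairs using ([]; _∷_)
import Data.List.Relation.Unary.AllPairs.Properties as AllPairs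
open import Data.List.Relation.Unary.Any using (here; there)
open import Data.List.Relation.Unary.Unique.Propositional using (Unique)
import Data.List.Relation.Unary.Unique.Propositional.Properties as Unique
open import Data.Nat.Base as ℕ using (ℕ; zero; suc; z≤n; s≤s; _!; ⌊_/2⌋; ⌈_/2⌉)
open import Data.Nat.Combinatorics using (_C_; nCk+nC[k+1]≡[n+1]C[k+1]; nCk≡n!/k![n-k]!; k![n∸k]!∣n!)
open import Data.Nat.DivMod using (m/n*n≡m)
open import Data.Nat.Divisibility using (_∣_; _∣?_; ∣m+n∣m⇒∣n; ∣-refl; ∣m∣n⇒∣m+n; divides; ∣1⇒≡1; ∣⇒≤; m≤n⇒m!∣n!; m∣m*n; ∣-trans; *-monoʳ-∣; 1∣_)
open import Data.Nat.Induction using (<-wellFounded)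
open import Data.Nat.ListAction using (product; sum)
open import Data.Nat.ListAction.Properties using (∈⇒≤product; product-++; product≢0)
open import Data.Nat.Logarithm using (⌊log₂_⌋)
open import Data.Nat.Logarithm.Core using (⌊log2⌋)
open import Data.Nat.Primality using (Prime; euclidsLemma; prime⇒nonZero; prime⇒nonTrivial; prime⇒irreducible; ¬prime[1])
import Data.Nat.Properties as ℕ
open import Data.Nat.Solver using (module +-*-Solver)
open import Data.Product.Base using (Σ-syntax; _×_; _,_; proj₁; proj₂)
open import Data.Rational.Base
open import Data.Rational.Properties
open import Data.Rational.Unnormalised.Base as ℚᵘ using (mkℚᵘ; *≡*)
import Data.Rational.Unnormalised.Properties as ℚᵘ
open import Data.Sum.Base using (inj₁; inj₂; [_,_]′; _⊎_)
open import Data.Vec.Base as Vec using (Vec; []; _∷_)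
open import Defs
open import Function.Base using (_∘_)
open import Induction.WellFounded using (Acc; acc)
open import Level using (0ℓ)
open import Relation.Binary.Definitions using (tri<; tri≈; tri>)
open import Relation.Binary.PropositionalEquality hiding (J)
open import Relation.Nullary.Decidable using (yes; no; from-yes; ¬?)
open import Relation.Nullary.Negation using (contradiction; ¬_)
open import Relation.Unary using (Pred; Decidable)
open import Tactic.RingSolver using (solve-∀)

-- Harmonic, artanh and exponential sums

-- Reals are rational Cauchy sequences, and the k-th approximation of `exp` or `ln` is a k-term
-- partial sum taken at the k-th approximation of the argument. Every analytic estimate is therefore
-- an inequality between rational partial sums, valid for all k or for all k beyond a threshold, and
-- no functional equation of exp or ln is proved. The estimates lose constant factors, which C₁
-- absorbs; additive constants are converted into factors where they arise.
--
-- The bound for Φₙ(a) has to be uniform in the number of primes of n, so the factors of numerator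
-- and denominator cannot be estimated one by one. A further prime divides one cyclotomic value by
-- another, so the induction must carry bounds from both sides.
--
-- The factor 1/2 in Φₙ(a) ≥ a^φ(n) / 2 is not absorbed by C₁. It is paid for by the gap between
-- 4/3, the bound for exp (1/4), and 2: with β = ⌊log₂ a⌋ the quotient a^φ(n) / (4/3)^(β φ(n)) is at
-- least (3/2)^φ(n), which exceeds 2 because φ(n) ≥ 2 for n ≥ 3.

0≤recip : ∀ {q} → 0ℚ < q → 0ℚ ≤ recip q
0≤recip 0<q = <⇒≤ (0<recip 0<q)

*-cancel-≤ : ∀ {p q} r → 0ℚ < r → p * r ≤ q * r → p ≤ q
*-cancel-≤ r 0<r = *-cancelʳ-≤-pos r {{positive 0<r}}

recip-unique : ∀ {p q} → 0ℚ < q → p * q ≡ 1ℚ → p ≡ recip q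
recip-unique {p} {q} 0<q pq≡1 = begin
  p                  ≡⟨ sym (*-identityʳ p) ⟩
  p * 1ℚ             ≡⟨ cong (p *_) (sym (recip-inverse 0<q)) ⟩
  p * (q * recip q)  ≡⟨ sym (*-assoc p q (recip q)) ⟩
  p * q * recip q    ≡⟨ cong (_* recip q) pq≡1 ⟩
  1ℚ * recip q       ≡⟨ *-identityˡ _ ⟩
  recip q            ∎
  where open ≡-Reasoning

p≤q*recip : ∀ {p q r} → 0ℚ < r → p * r ≤ q → p ≤ q * recip r
p≤q*recip {p} {q} {r} 0<r pr≤q = subst (_≤ q * recip r)
  (trans (*-assoc p r _) (trans (cong (p *_) (recip-inverse 0<r)) (*-identityʳ p)))
  (*-monoʳ (recip r) (0≤recip 0<r) pr≤q)

p*recip≤q : ∀ {p q r} → 0ℚ < r → p ≤ q * r → p * recip r ≤ q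
p*recip≤q {p} {q} {r} 0<r p≤qr = subst (p * recip r ≤_)
  (trans (*-assoc q r _) (trans (cong (q *_) (recip-inverse 0<r)) (*-identityʳ q)))
  (*-monoʳ (recip r) (0≤recip 0<r) p≤qr)

0<ι : ∀ n → 1 ℕ.≤ n → 0ℚ < ι n
0<ι n 1≤n = <-≤-trans 0<1 (ι-mono {1} {n} 1≤n)

0<ι-suc : ∀ n → 0ℚ < ι (suc n)
0<ι-suc n = 0<ι (suc n) (s≤s z≤n)

ι-+ : ∀ m n → ι (m ℕ.+ n) ≡ ι m + ι n
ι-+ zero    n = sym (+-identityˡ _)
ι-+ (suc m) n = trans (ι-suc (m ℕ.+ n)) (trans (cong (1ℚ +_) (ι-+ m n))
  (trans (sym (+-assoc 1ℚ (ι m) (ι n))) (cong (_+ ι n) (sym (ι-suc m)))))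

inv≡recip : ∀ n → inv (suc n) ≡ recip (ι (suc n))
inv≡recip n = recip-unique {inv (suc n)} {ι (suc n)} (0<ι-suc n) (inv-inverse (suc n))

^ℚ-mono : ∀ {p q} → 0ℚ ≤ p → p ≤ q → ∀ n → p ^ℚ n ≤ q ^ℚ n
^ℚ-mono 0≤p p≤q zero    = ≤-refl
^ℚ-mono 0≤p p≤q (suc n) = *-mono (≤-trans 0≤p p≤q) (0≤^ 0≤p n) p≤q (^ℚ-mono 0≤p p≤q n)

^ℚ-anti : ∀ {p m n} → 0ℚ ≤ p → p ≤ 1ℚ → m ℕ.≤ n → p ^ℚ n ≤ p ^ℚ m
^ℚ-anti {n = n} 0≤p p≤1 z≤n   = ^≤1 0≤p p≤1 n
^ℚ-anti {p}     0≤p p≤1 (s≤s m≤n) = *-monoˡ p 0≤p (^ℚ-anti 0≤p p≤1 m≤n)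

sumTo-≤ : ∀ {s t : ℕ → ℚ} k → (∀ j → j ℕ.< k → s j ≤ t j) → sumTo s k ≤ sumTo t k
sumTo-≤ zero    h = ≤-refl
sumTo-≤ (suc k) h = +-mono-≤ (sumTo-≤ k (λ j j<k → h j (ℕ.m<n⇒m<1+n j<k))) (h k ℕ.≤-refl)

0≤sumTo : ∀ {t : ℕ → ℚ} → (∀ j → 0ℚ ≤ t j) → ∀ k → 0ℚ ≤ sumTo t k
0≤sumTo h k = sumTo-mono _ h {0} {k} z≤n

sumTo-+ : ∀ t m n → sumTo t (m ℕ.+ n) ≡ sumTo t m + sumTo (λ j → t (m ℕ.+ j)) n
sumTo-+ t m zero    = trans (cong (sumTo t) (ℕ.+-identityʳ m)) (sym (+-identityʳ _))
sumTo-+ t m (suc n) = trans (cong (sumTo t) (ℕ.+-suc m n))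
  (trans (cong (_+ t (m ℕ.+ n)) (sumTo-+ t m n)) (+-assoc (sumTo t m) _ _))

sumTo-* : ∀ c t k → sumTo (λ j → c * t j) k ≡ c * sumTo t k
sumTo-* c t zero    = sym (*-zeroʳ c)
sumTo-* c t (suc k) = trans (cong (_+ c * t k) (sumTo-* c t k)) (sym (*-distribˡ-+ c _ _))

sumTo-const : ∀ c k → sumTo (λ _ → c) k ≡ ι k * c
sumTo-const c zero    = sym (*-zeroˡ c)
sumTo-const c (suc k) = trans (cong (_+ c) (sumTo-const c k))
  (trans (eq (ι k) c) (cong (_* c) (sym (ι-suc k))))
  where
  eq : ∀ k c → k * c + c ≡ (1ℚ + k) * c
  eq = solve-∀ ℚ-ring

harmonic : ℕ → ℚ
harmonic = sumTo (λ j → recip (ι (suc j)))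

0≤recipι : ∀ n → 0ℚ ≤ recip (ι (suc n))
0≤recipι n = 0≤recip (0<ι-suc n)

-- Each of the J new terms lies between 1/(2J) and 1/J.
harmonic-double : ∀ J → 1 ℕ.≤ J →
  (harmonic (J ℕ.+ J) ≤ harmonic J + 1ℚ) × (harmonic J + ½ ≤ harmonic (J ℕ.+ J))
harmonic-double J 1≤J =
    subst (_≤ harmonic J + 1ℚ) (sym split)
      (+-monoʳ-≤ (harmonic J) (≤-trans (sumTo-≤ J upper′) (≤-reflexive (trans (sumTo-const _ J) (recip-inverse 0<J)))))
  , subst (harmonic J + ½ ≤_) (sym split)
      (+-monoʳ-≤ (harmonic J) (≤-trans (≤-reflexive half) (sumTo-≤ J lower′)))
  where
  split = sumTo-+ (λ j → recip (ι (suc j))) J J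
  0<J = 0<ι J 1≤J
  0<2J = 0<ι (J ℕ.+ J) (ℕ.≤-trans 1≤J (ℕ.m≤m+n J J))
  upper′ : ∀ j → j ℕ.< J → recip (ι (suc (J ℕ.+ j))) ≤ recip (ι J)
  upper′ j _ = recip-anti 0<J (ι-mono (ℕ.m≤n⇒m≤1+n (ℕ.m≤m+n J j)))
  lower′ : ∀ j → j ℕ.< J → recip (ι (J ℕ.+ J)) ≤ recip (ι (suc (J ℕ.+ j)))
  lower′ j j<J = recip-anti (0<ι-suc (J ℕ.+ j)) (ι-mono (ℕ.≤-trans (ℕ.≤-reflexive (sym (ℕ.+-suc J j))) (ℕ.+-monoʳ-≤ J j<J)))
  half : ½ ≡ sumTo (λ _ → recip (ι (J ℕ.+ J))) J
  half = trans (trans (sym (*-identityʳ ½)) (trans (cong (½ *_) (trans (sym (recip-inverse 0<2J)) (cong (_* r) (ι-+ J J))))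
         (eq ½ (ι J) r))) (trans (*-identityˡ _) (sym (sumTo-const r J)))
    where
    r = recip (ι (J ℕ.+ J))
    eq : ∀ h j r → h * ((j + j) * r) ≡ (h + h) * (j * r)
    eq = solve-∀ ℚ-ring

2^suc : ∀ m → 2 ℕ.^ suc m ≡ 2 ℕ.^ m ℕ.+ 2 ℕ.^ m
2^suc m = cong (2 ℕ.^ m ℕ.+_) (ℕ.+-identityʳ _)

1≤2^ : ∀ m → 1 ℕ.≤ 2 ℕ.^ m
1≤2^ m = ℕ.m^n>0 2 m

harmonic-2^≤ : ∀ m → harmonic (2 ℕ.^ m) ≤ ι (suc m)
harmonic-2^≤ zero    = ≤-refl
harmonic-2^≤ (suc m) = subst₂ _≤_ (cong harmonic (sym (2^suc m)))
  (trans (+-comm (ι (suc m)) 1ℚ) (sym (ι-suc (suc m))))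
  (≤-trans (proj₁ (harmonic-double (2 ℕ.^ m) (1≤2^ m))) (+-monoˡ-≤ 1ℚ (harmonic-2^≤ m)))

≤harmonic-2^ : ∀ m → ½ * ι m + 1ℚ ≤ harmonic (2 ℕ.^ m)
≤harmonic-2^ zero    = ≤-refl
≤harmonic-2^ (suc m) = subst₂ _≤_
  (trans (eq ½ (ι m)) (cong (λ t → ½ * t + 1ℚ) (sym (ι-suc m)))) (cong harmonic (sym (2^suc m)))
  (≤-trans (+-monoˡ-≤ ½ (≤harmonic-2^ m)) (proj₂ (harmonic-double (2 ℕ.^ m) (1≤2^ m))))
  where
  eq : ∀ h m → h * m + 1ℚ + h ≡ h * (1ℚ + m) + 1ℚ
  eq = solve-∀ ℚ-ring

artanhSum : ℕ → ℚ → ℚ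
artanhSum k z = sumTo (λ j → artanhTerm j z) k

j≤2j : ∀ j → j ℕ.≤ 2 ℕ.* j
j≤2j j = ℕ.m≤m+n j _

inv-odd≤ : ∀ {i} j → i ℕ.≤ j → inv (suc (2 ℕ.* j)) ≤ recip (ι (suc i))
inv-odd≤ {i} j i≤j = ≤-trans (≤-reflexive (inv≡recip (2 ℕ.* j)))
  (recip-anti (0<ι-suc i) (ι-mono (s≤s (ℕ.≤-trans i≤j (j≤2j j)))))

-- The first 2ᵐ terms are dominated by the harmonic series, the others by a
-- geometric series of ratio z with leading term 2⁻ᵐ.
artanhSum-upper : ∀ m z → 0ℚ ≤ z → z < 1ℚ → 1ℚ ≤ (1ℚ - z) * ι (2 ℕ.^ m) →
                  ∀ k → artanhSum k z ≤ ι (suc m) + 1ℚ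
artanhSum-upper m z 0≤z z<1 1≤[1-z]J k = begin
  -- Padding to J + k terms makes the split at J available even when k < J.
  artanhSum k z                                           ≤⟨ sumTo-mono _ (0≤artanhTerm 0≤z) (ℕ.m≤n+m k J) ⟩
  artanhSum (J ℕ.+ k) z                                   ≡⟨ sumTo-+ _ J k ⟩
  artanhSum J z + sumTo (λ j → artanhTerm (J ℕ.+ j) z) k  ≤⟨ +-mono-≤ (≤-trans (sumTo-≤ J head) (harmonic-2^≤ m)) tail ⟩
  ι (suc m) + 1ℚ                                          ∎
  where
  open ≤-Reasoning
  open Geometric z 0≤z z<1
  J = 2 ℕ.^ m
  head : ∀ j → j ℕ.< J → artanhTerm j z ≤ recip (ι (suc j))
  head j _ = ≤-trans (*-mono 0≤1 (0≤inv (suc (2 ℕ.* j))) (^≤1 0≤z (<⇒≤ z<1) (suc (2 ℕ.* j))) (inv-odd≤ j ℕ.≤-refl))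
    (≤-reflexive (*-identityˡ _))
  term : ∀ j → j ℕ.< k → artanhTerm (J ℕ.+ j) z ≤ recip (ι (suc J)) * z ^ℚ j
  term j _ = ≤-trans
    (*-mono (0≤^ 0≤z j) (0≤inv (suc (2 ℕ.* (J ℕ.+ j))))
      (^ℚ-anti 0≤z (<⇒≤ z<1) (ℕ.m≤n⇒m≤1+n (ℕ.≤-trans (ℕ.m≤n+m j J) (j≤2j (J ℕ.+ j)))))
      (inv-odd≤ (J ℕ.+ j) (ℕ.m≤m+n J j)))
    (≤-reflexive (*-comm (z ^ℚ j) _))
  recip-d≤ : recip d ≤ ι J
  recip-d≤ = subst (_≤ ι J) (*-identityˡ _) (p*recip≤q 0<d (subst (1ℚ ≤_) (*-comm d (ι J)) 1≤[1-z]J))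
  tail : sumTo (λ j → artanhTerm (J ℕ.+ j) z) k ≤ 1ℚ
  tail = begin
    sumTo (λ j → artanhTerm (J ℕ.+ j) z) k        ≤⟨ sumTo-≤ k term ⟩
    sumTo (λ j → recip (ι (suc J)) * z ^ℚ j) k    ≡⟨ sumTo-* (recip (ι (suc J))) (z ^ℚ_) k ⟩
    recip (ι (suc J)) * sumTo (z ^ℚ_) k           ≤⟨ *-monoˡ _ (0≤recipι J) (≤-trans (sum-≤ k) (≤-trans recip-d≤ (ι-mono (ℕ.n≤1+n J)))) ⟩
    recip (ι (suc J)) * ι (suc J)                 ≡⟨ trans (*-comm (recip (ι (suc J))) (ι (suc J))) (recip-inverse (0<ι-suc J)) ⟩
    1ℚ                                            ∎

bernoulli-≥ : ∀ {u} → 0ℚ ≤ u → u ≤ 1ℚ → ∀ n → 1ℚ - ι n * u ≤ (1ℚ - u) ^ℚ n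
bernoulli-≥ {u} 0≤u u≤1 zero    = ≤-reflexive (eq u)
  where
  eq : ∀ u → 1ℚ - 0ℚ * u ≡ 1ℚ
  eq = solve-∀ ℚ-ring
bernoulli-≥ {u} 0≤u u≤1 (suc n) = begin
  1ℚ - ι (suc n) * u                       ≡⟨ cong (λ t → 1ℚ - t * u) (ι-suc n) ⟩
  1ℚ - (1ℚ + ι n) * u                      ≤⟨ p≤p+q (0≤* (0≤ι n) (0≤* 0≤u 0≤u)) ⟩
  1ℚ - (1ℚ + ι n) * u + ι n * (u * u)      ≡⟨ eq (ι n) u ⟩
  (1ℚ - u) * (1ℚ - ι n * u)                ≤⟨ *-monoˡ _ (p≤q⇒0≤q-p u≤1) (bernoulli-≥ 0≤u u≤1 n) ⟩
  (1ℚ - u) * (1ℚ - u) ^ℚ n                 ∎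
  where
  open ≤-Reasoning
  eq : ∀ n u → 1ℚ - (1ℚ + n) * u + n * (u * u) ≡ (1ℚ - u) * (1ℚ - n * u)
  eq = solve-∀ ℚ-ring

-- Bernoulli's inequality keeps the powers of 1 - u above ½ in the first 2ˢ terms.
artanhSum-lower : ∀ s u → 0ℚ ≤ u → u ≤ 1ℚ → ι (2 ℕ.^ suc s) * u ≤ ½ →
                  ∀ k → 2 ℕ.^ s ℕ.≤ k → ½ * ½ * (½ * ι s + 1ℚ) ≤ artanhSum k (1ℚ - u)
artanhSum-lower s u 0≤u u≤1 2Ju≤½ k J≤k = begin
  ½ * ½ * (½ * ι s + 1ℚ)                            ≤⟨ *-monoˡ (½ * ½) (from-yes (0ℚ ≤? ½ * ½)) (≤harmonic-2^ s) ⟩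
  ½ * ½ * harmonic J                                ≡⟨ sym (sumTo-* (½ * ½) _ J) ⟩
  sumTo (λ j → ½ * ½ * recip (ι (suc j))) J         ≤⟨ sumTo-≤ J term ⟩
  artanhSum J z                                     ≤⟨ sumTo-mono _ (0≤artanhTerm (p≤q⇒0≤q-p u≤1)) J≤k ⟩
  artanhSum k z                                     ∎
  where
  open ≤-Reasoning
  J = 2 ℕ.^ s
  z = 1ℚ - u
  0≤½ = from-yes (0ℚ ≤? ½)
  odd≤ : ∀ j → suc (2 ℕ.* j) ℕ.≤ 2 ℕ.* suc j
  odd≤ j = ℕ.≤-trans (ℕ.n≤1+n _) (ℕ.≤-reflexive (sym (ℕ.*-suc 2 j)))
  ½≤pow : ∀ j → j ℕ.< J → ½ ≤ z ^ℚ suc (2 ℕ.* j)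
  ½≤pow j j<J = ≤-trans
    (1-q≤1-p (≤-trans (*-monoʳ u 0≤u (ι-mono (ℕ.≤-trans (odd≤ j) (ℕ.*-monoʳ-≤ 2 j<J)))) 2Ju≤½))
    (bernoulli-≥ 0≤u u≤1 (suc (2 ℕ.* j)))
  half-recip : ∀ j → ½ * recip (ι (suc j)) ≤ inv (suc (2 ℕ.* j))
  half-recip j = subst (½ * recip (ι (suc j)) ≤_) (sym (inv≡recip (2 ℕ.* j)))
    (subst₂ _≤_ refl (*-identityˡ _) (p≤q*recip {r = ι (suc (2 ℕ.* j))} (0<ι-suc (2 ℕ.* j)) (begin
      ½ * r * ι (suc (2 ℕ.* j))   ≤⟨ *-monoˡ (½ * r) (0≤* 0≤½ (0≤recipι j)) (ι-mono (odd≤ j)) ⟩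
      ½ * r * ι (2 ℕ.* suc j)     ≡⟨ cong (½ * r *_) (ι-* 2 (suc j)) ⟩
      ½ * r * (2ℚ * ι (suc j))    ≡⟨ eq ½ r 2ℚ (ι (suc j)) ⟩
      ½ * 2ℚ * (ι (suc j) * r)    ≡⟨ cong (½ * 2ℚ *_) (recip-inverse (0<ι-suc j)) ⟩
      1ℚ                          ∎)))
    where
    r = recip (ι (suc j))
    eq : ∀ h r t i → h * r * (t * i) ≡ h * t * (i * r)
    eq = solve-∀ ℚ-ring
  term : ∀ j → j ℕ.< J → ½ * ½ * recip (ι (suc j)) ≤ artanhTerm j z
  term j j<J = ≤-trans (≤-reflexive (*-assoc ½ ½ (recip (ι (suc j)))))
    (*-mono (0≤^ (p≤q⇒0≤q-p u≤1) (suc (2 ℕ.* j))) (0≤* 0≤½ (0≤recipι j)) (½≤pow j j<J) (half-recip j))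

-- A mean value bound with the derivative taken at the right end x + c. Summed over j, it bounds the
-- increment of the exponential sum by that sum at x + c itself.
pow-increment : ∀ {x c} → 0ℚ ≤ x → 0ℚ ≤ c → ∀ j →
                (x + c) ^ℚ suc j ≤ x ^ℚ suc j + ι (suc j) * c * (x + c) ^ℚ j
pow-increment {x} {c} 0≤x 0≤c zero = ≤-reflexive (eq x c)
  where
  eq : ∀ x c → (x + c) * 1ℚ ≡ x * 1ℚ + 1ℚ * c * 1ℚ
  eq = solve-∀ ℚ-ring
pow-increment {x} {c} 0≤x 0≤c (suc j) = begin
  y * y ^ℚ suc j                                        ≡⟨ *-distribʳ-+ (y ^ℚ suc j) x c ⟩
  x * y ^ℚ suc j + c * y ^ℚ suc j                       ≤⟨ +-monoˡ-≤ _ (*-monoˡ x 0≤x (pow-increment 0≤x 0≤c j)) ⟩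
  x * (p + i * c * q) + c * (y * q)                     ≤⟨ p≤p+q (0≤* 0≤c (0≤* (0≤* (0≤ι (suc j)) 0≤c) (0≤^ (0≤+ 0≤x 0≤c) j))) ⟩
  x * (p + i * c * q) + c * (y * q) + c * (i * c * q)   ≡⟨ eq x c p i q ⟩
  x * p + (1ℚ + i) * c * (y * q)                        ≡⟨ cong (λ t → x * p + t * c * (y * q)) (sym (ι-suc (suc j))) ⟩
  x * p + ι (suc (suc j)) * c * (y * q)                 ∎
  where
  open ≤-Reasoning
  y = x + c
  p = x ^ℚ suc j
  q = y ^ℚ j
  i = ι (suc j)
  eq : ∀ x c p i q → x * (p + i * c * q) + c * ((x + c) * q) + c * (i * c * q) ≡ x * p + (1ℚ + i) * c * ((x + c) * q)
  eq = solve-∀ ℚ-ring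

expSum : ℕ → ℚ → ℚ
expSum k u = sumTo (λ j → expTerm j u) k

0≤expTerm : ∀ {u} → 0ℚ ≤ u → ∀ j → 0ℚ ≤ expTerm j u
0≤expTerm 0≤u j = 0≤* (0≤^ 0≤u j) (0≤inv (j !) {{ℕ._!≢0 j}})

expSum-mono : ∀ {u v} → 0ℚ ≤ u → u ≤ v → ∀ k → expSum k u ≤ expSum k v
expSum-mono 0≤u u≤v k = sumTo-≤ k λ j _ → *-monoʳ _ (0≤inv (j !) {{ℕ._!≢0 j}}) (^ℚ-mono 0≤u u≤v j)

-- The discrete form of exp' = exp.
expSum-increment : ∀ {x c} → 0ℚ ≤ x → 0ℚ ≤ c → ∀ k →
                   expSum (suc k) (x + c) ≤ expSum (suc k) x + c * expSum k (x + c)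
expSum-increment {x} {c} 0≤x 0≤c zero    = ≤-reflexive (eq c)
  where
  eq : ∀ c → 0ℚ + 1ℚ * 1ℚ ≡ 0ℚ + 1ℚ * 1ℚ + c * 0ℚ
  eq = solve-∀ ℚ-ring
expSum-increment {x} {c} 0≤x 0≤c (suc k) = begin
  expSum (suc k) y + expTerm (suc k) y                                 ≤⟨ +-mono-≤ (expSum-increment 0≤x 0≤c k) term ⟩
  (expSum (suc k) x + c * expSum k y) + (expTerm (suc k) x + c * expTerm k y)  ≡⟨ eq (expSum (suc k) x) c (expSum k y) (expTerm (suc k) x) (expTerm k y) ⟩
  expSum (suc k) x + expTerm (suc k) x + c * (expSum k y + expTerm k y)  ∎
  where
  open ≤-Reasoning
  y = x + c
  f = inv (suc k !) {{ℕ._!≢0 (suc k)}}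
  g = inv (k !) {{ℕ._!≢0 k}}
  eq : ∀ a c b d e → (a + c * b) + (d + c * e) ≡ a + d + c * (b + e)
  eq = solve-∀ ℚ-ring
  eq′ : ∀ p i c q f → (p + i * c * q) * f ≡ p * f + c * (q * (f * i))
  eq′ = solve-∀ ℚ-ring
  term : expTerm (suc k) y ≤ expTerm (suc k) x + c * expTerm k y
  term = begin
    y ^ℚ suc k * f                                     ≤⟨ *-monoʳ f (0≤inv (suc k !) {{ℕ._!≢0 (suc k)}}) (pow-increment 0≤x 0≤c k) ⟩
    (x ^ℚ suc k + ι (suc k) * c * y ^ℚ k) * f          ≡⟨ eq′ (x ^ℚ suc k) (ι (suc k)) c (y ^ℚ k) f ⟩
    x ^ℚ suc k * f + c * (y ^ℚ k * (f * ι (suc k)))    ≡⟨ cong (λ t → x ^ℚ suc k * f + c * (y ^ℚ k * t))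
                                                            (inv-cancel (suc k) (k !) {{ℕ._!≢0 k}} {{ℕ._!≢0 (suc k)}}) ⟩
    x ^ℚ suc k * f + c * (y ^ℚ k * g)                  ∎

-- In `expSum-increment` the k-term sum at x + c is at most the (k+1)-term sum there, which can then
-- be moved to the left side. This stands in for the functional equation of exp.
expSum-step : ∀ {x c} → 0ℚ ≤ x → 0ℚ ≤ c → ∀ k → (1ℚ - c) * expSum k (x + c) ≤ expSum k x
expSum-step {x} {c} 0≤x 0≤c zero = ≤-reflexive (*-zeroʳ (1ℚ - c))
expSum-step {x} {c} 0≤x 0≤c (suc k) = begin
  (1ℚ - c) * s                        ≡⟨ eq c s ⟩
  s - c * s                           ≤⟨ +-monoˡ-≤ (- (c * s)) (≤-trans (expSum-increment 0≤x 0≤c k)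
                                           (+-monoʳ-≤ (expSum (suc k) x) (*-monoˡ c 0≤c (p≤p+q {expSum k (x + c)} (0≤expTerm (0≤+ 0≤x 0≤c) k))))) ⟩
  expSum (suc k) x + c * s - c * s    ≡⟨ eq′ (expSum (suc k) x) (c * s) ⟩
  expSum (suc k) x                    ∎
  where
  open ≤-Reasoning
  s = expSum (suc k) (x + c)
  eq : ∀ c s → (1ℚ - c) * s ≡ s - c * s
  eq = solve-∀ ℚ-ring
  eq′ : ∀ a b → a + b - b ≡ a
  eq′ = solve-∀ ℚ-ring

expSum-0 : ∀ k → expSum k 0ℚ ≤ 1ℚ
expSum-0 zero = 0≤1
expSum-0 (suc zero) = ≤-refl
expSum-0 (suc (suc k)) = ≤-trans (+-monoʳ-≤ (expSum (suc k) 0ℚ) (≤-reflexive (eq (0ℚ ^ℚ k) (inv (suc k !) {{ℕ._!≢0 (suc k)}}))))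
  (≤-trans (≤-reflexive (+-identityʳ _)) (expSum-0 (suc k)))
  where
  eq : ∀ p f → 0ℚ * p * f ≡ 0ℚ
  eq = solve-∀ ℚ-ring

expSum-geometric : ∀ {c} → 0ℚ ≤ c → c ≤ 1ℚ → ∀ N k → (1ℚ - c) ^ℚ N * expSum k (ι N * c) ≤ 1ℚ
expSum-geometric {c} 0≤c c≤1 zero k = ≤-trans (≤-reflexive (trans (*-identityˡ _) (cong (expSum k) (*-zeroˡ c)))) (expSum-0 k)
expSum-geometric {c} 0≤c c≤1 (suc N) k = begin
  d * d ^ℚ N * expSum k (ι (suc N) * c)     ≡⟨ cong (λ t → d * d ^ℚ N * expSum k t) (trans (cong (_* c) (ι-suc N)) (eq (ι N) c)) ⟩
  d * d ^ℚ N * expSum k (ι N * c + c)       ≡⟨ eq′ d (d ^ℚ N) _ ⟩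
  d ^ℚ N * (d * expSum k (ι N * c + c))     ≤⟨ *-monoˡ _ (0≤^ (p≤q⇒0≤q-p c≤1) N) (expSum-step (0≤* (0≤ι N) 0≤c) 0≤c k) ⟩
  d ^ℚ N * expSum k (ι N * c)               ≤⟨ expSum-geometric 0≤c c≤1 N k ⟩
  1ℚ                                        ∎
  where
  open ≤-Reasoning
  d = 1ℚ - c
  eq : ∀ n c → (1ℚ + n) * c ≡ n * c + c
  eq = solve-∀ ℚ-ring
  eq′ : ∀ a b e → a * b * e ≡ b * (a * e)
  eq′ = solve-∀ ℚ-ring

n<2^n : ∀ n → n ℕ.< 2 ℕ.^ n
n<2^n zero    = s≤s z≤n
n<2^n (suc n) = subst (suc n ℕ.<_) (sym (2^suc n)) (ℕ.+-mono-≤-< (1≤2^ n) (n<2^n n))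

-- Bounds for ln and ln ln

cayleyℚ : ℚ → ℚ
cayleyℚ x = (x - 1ℚ) * recip (x + 1ℚ)

0<x+1ℚ : ∀ {x} → 0ℚ ≤ x → 0ℚ < x + 1ℚ
0<x+1ℚ {x} 0≤x = <-≤-trans 0<1 (subst (1ℚ ≤_) (+-comm 1ℚ x) (p≤p+q 0≤x))

cayleyℚ≡ : ∀ {x} → 0ℚ ≤ x → cayleyℚ x ≡ 1ℚ - 2ℚ * recip (x + 1ℚ)
cayleyℚ≡ {x} 0≤x = trans (eq x (recip (x + 1ℚ))) (cong (_- 2ℚ * recip (x + 1ℚ)) (recip-inverse (0<x+1ℚ 0≤x)))
  where
  eq : ∀ x r → (x - 1ℚ) * r ≡ (x + 1ℚ) * r - (1ℚ + 1ℚ) * r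
  eq = solve-∀ ℚ-ring

cayleyℚ-mono : ∀ {x y} → 0ℚ ≤ x → x ≤ y → cayleyℚ x ≤ cayleyℚ y
cayleyℚ-mono {x} {y} 0≤x x≤y = subst₂ _≤_ (sym (cayleyℚ≡ 0≤x)) (sym (cayleyℚ≡ (≤-trans 0≤x x≤y)))
  (1-q≤1-p (*-monoˡ 2ℚ (<⇒≤ 0<2) (recip-anti (0<x+1ℚ 0≤x) (+-monoˡ-≤ 1ℚ x≤y))))

0≤cayleyℚ : ∀ {x} → 1ℚ ≤ x → 0ℚ ≤ cayleyℚ x
0≤cayleyℚ {x} 1≤x = 0≤* (p≤q⇒0≤q-p 1≤x) (0≤recip (0<x+1ℚ (≤-trans 0≤1 1≤x)))

-- Definitionally the k-th approximation of `ln` when x is the k-th approximation of its argument,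
-- so `logSum k (logSum k x)` is that of ln ln.
logSum : ℕ → ℚ → ℚ
logSum k x = 2ℚ * artanhSum k (cayleyℚ x)

0≤logSum : ∀ k {x} → 1ℚ ≤ x → 0ℚ ≤ logSum k x
0≤logSum k 1≤x = 0≤* (<⇒≤ 0<2) (0≤sumTo (0≤artanhTerm (0≤cayleyℚ 1≤x)) k)

-- Here 1 - `cayleyℚ x` = 2 / (x + 1), and x + 1 ≤ 2 · 2ᵐ makes it at least 2⁻ᵐ, as
-- `artanhSum-upper` requires.
logSum-upper : ∀ m {x} → 1ℚ ≤ x → x ≤ ι (2 ℕ.^ m) → ∀ k → logSum k x ≤ 2ℚ * (ι (suc m) + 1ℚ)
logSum-upper m {x} 1≤x x≤2^m k = *-monoˡ 2ℚ (<⇒≤ 0<2)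
  (artanhSum-upper m (cayleyℚ x) (0≤cayleyℚ 1≤x)
    (subst (_< 1ℚ) (sym (cayleyℚ≡ 0≤x)) (1-q<1 (0<* 0<2 (0<recip 0<y)))) bound k)
  where
  open ≤-Reasoning
  y = x + 1ℚ
  0≤x = ≤-trans 0≤1 1≤x
  0<y = 0<x+1ℚ 0≤x
  eq : ∀ a → 1ℚ - (1ℚ - a) ≡ a
  eq = solve-∀ ℚ-ring
  eq′ : ∀ r j → (j + j) * r ≡ (1ℚ + 1ℚ) * r * j
  eq′ = solve-∀ ℚ-ring
  bound : 1ℚ ≤ (1ℚ - cayleyℚ x) * ι (2 ℕ.^ m)
  bound = begin
    1ℚ                                          ≡⟨ sym (recip-inverse 0<y) ⟩
    (x + 1ℚ) * recip y                          ≤⟨ *-monoʳ (recip y) (0≤recip 0<y) (+-mono-≤ x≤2^m (≤-trans 1≤x x≤2^m)) ⟩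
    (ι (2 ℕ.^ m) + ι (2 ℕ.^ m)) * recip y       ≡⟨ eq′ (recip y) (ι (2 ℕ.^ m)) ⟩
    2ℚ * recip y * ι (2 ℕ.^ m)                  ≡⟨ cong (_* ι (2 ℕ.^ m)) (sym (trans (cong (λ t → 1ℚ - t) (cayleyℚ≡ 0≤x)) (eq (2ℚ * recip y)))) ⟩
    (1ℚ - cayleyℚ x) * ι (2 ℕ.^ m)              ∎

-- With u = 2 / (x + 1), the condition 2^(s+1) u ≤ ½ of `artanhSum-lower` amounts to x + 1 ≥
-- 2^(s+3); hence the exponent 3 + s.
logSum-lower : ∀ s {x} → ι (2 ℕ.^ (3 ℕ.+ s)) ≤ x → ∀ k → 2 ℕ.^ s ℕ.≤ k →
               ½ * (½ * ι s + 1ℚ) ≤ logSum k x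
logSum-lower s {x} 2^≤x k 2^s≤k = begin
  ½ * (½ * ι s + 1ℚ)                  ≡⟨ trans (sym (*-identityˡ _)) (eq ½ 2ℚ (½ * ι s + 1ℚ)) ⟩
  2ℚ * (½ * ½ * (½ * ι s + 1ℚ))       ≤⟨ *-monoˡ 2ℚ (<⇒≤ 0<2) (artanhSum-lower s u 0≤u u≤1 small k 2^s≤k) ⟩
  2ℚ * artanhSum k (1ℚ - u)           ≡⟨ cong (λ t → 2ℚ * artanhSum k t) (sym (cayleyℚ≡ 0≤x)) ⟩
  logSum k x                          ∎
  where
  open ≤-Reasoning
  y = x + 1ℚ
  u = 2ℚ * recip y
  J = ι (2 ℕ.^ suc s)
  0≤x : 0ℚ ≤ x
  0≤x = ≤-trans (0≤ι (2 ℕ.^ (3 ℕ.+ s))) 2^≤x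
  0<y = 0<x+1ℚ 0≤x
  0≤u = 0≤* (<⇒≤ 0<2) (0≤recip 0<y)
  eq : ∀ h t a → t * h * (h * a) ≡ t * (h * h * a)
  eq = solve-∀ ℚ-ring
  double : 2ℚ * ι (2 ℕ.^ suc s) ≡ ½ * ι (2 ℕ.^ (3 ℕ.+ s))
  double = sym (trans (cong (½ *_) (trans (ι-* 2 (2 ℕ.^ (2 ℕ.+ s))) (cong (2ℚ *_) (ι-* 2 (2 ℕ.^ suc s)))))
    (trans (sym (*-assoc ½ 2ℚ (2ℚ * J))) (*-identityˡ (2ℚ * J))))
  small : J * u ≤ ½
  small = subst (_≤ ½) (eq′ 2ℚ J (recip y)) (p*recip≤q 0<y (begin
    2ℚ * J                      ≡⟨ double ⟩
    ½ * ι (2 ℕ.^ (3 ℕ.+ s))     ≤⟨ *-monoˡ ½ (from-yes (0ℚ ≤? ½)) (≤-trans 2^≤x (p≤p+q 0≤1)) ⟩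
    ½ * y                       ∎))
    where
    eq′ : ∀ t j r → t * j * r ≡ j * (t * r)
    eq′ = solve-∀ ℚ-ring
  u≤1 : u ≤ 1ℚ
  u≤1 = begin
    u        ≡⟨ sym (*-identityˡ u) ⟩
    1ℚ * u   ≤⟨ *-monoʳ u 0≤u (ι-mono (1≤2^ (suc s))) ⟩
    J * u    ≤⟨ small ⟩
    ½        ≤⟨ from-yes (½ ≤? 1ℚ) ⟩
    1ℚ       ∎

2^suc≤ : ∀ m → 2 ℕ.^ m ℕ.≤ 2 ℕ.^ suc m ℕ.∸ 1
2^suc≤ m = subst (λ t → 2 ℕ.^ m ℕ.≤ t ℕ.∸ 1) (sym (2^suc m))
  (subst (2 ℕ.^ m ℕ.≤_) (sym (ℕ.+-∸-assoc (2 ℕ.^ m) (1≤2^ m))) (ℕ.m≤m+n (2 ℕ.^ m) _))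

-- The first artanh term suffices: the Cayley transform of 13/12 is 1/25, and 2/25 = 6 · (1/75). The
-- slope 1/75 is chosen to cover suc h ≤ 6 in this way.
lnln-small : ∀ {x} → 1ℚ + ℤ.+ 1 / 12 ≤ x → ∀ k → 1 ℕ.≤ k → ι 6 * (ℤ.+ 1 / 75) ≤ logSum k x
lnln-small {x} 13/12≤x k 1≤k = begin
  2ℚ * (ℤ.+ 1 / 25)          ≤⟨ *-monoˡ 2ℚ (<⇒≤ 0<2) (cayleyℚ-mono (from-yes (0ℚ ≤? (1ℚ + ℤ.+ 1 / 12))) 13/12≤x) ⟩
  2ℚ * z                     ≡⟨ cong (2ℚ *_) (sym (trans (+-identityˡ _) (trans (*-identityʳ _) (*-identityʳ z)))) ⟩
  2ℚ * artanhSum 1 z         ≤⟨ *-monoˡ 2ℚ (<⇒≤ 0<2) (sumTo-mono _ (0≤artanhTerm (0≤cayleyℚ 1≤x)) 1≤k) ⟩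
  2ℚ * artanhSum k z         ∎
  where
  open ≤-Reasoning
  z = cayleyℚ x
  1≤x = ≤-trans (from-yes (1ℚ ≤? (1ℚ + ℤ.+ 1 / 12))) 13/12≤x

-- Two applications of `logSum-lower`. The first, with s = 2ʰ - 3, gives ln x ≥ (2ʰ - 1) / 4 ≥
-- 2^(h-3). As h - 3 = 3 + g, this is exactly the size that the second needs with s = g.
lnln-large : ∀ g h → 6 ℕ.+ g ≡ h → ∀ {x} → ι (2 ℕ.^ (2 ℕ.^ h)) ≤ x → ∀ k → 2 ℕ.^ (2 ℕ.^ h) ℕ.≤ k →
             ι (suc h) * (ℤ.+ 1 / 75) ≤ logSum k (logSum k x)
lnln-large g h 6+g≡h {x} 2^≤x k N≤k = ≤-trans final (logSum-lower g x′-large k (ℕ.≤-trans (ℕ.^-monoʳ-≤ 2 g≤N) N≤k))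
  where
  open ≤-Reasoning
  N = 2 ℕ.^ h
  6≤h : 6 ℕ.≤ h
  6≤h = subst (6 ℕ.≤_) 6+g≡h (ℕ.m≤m+n 6 g)
  g≤h : g ℕ.≤ h
  g≤h = subst (g ℕ.≤_) 6+g≡h (ℕ.m≤n+m g 6)
  s = N ℕ.∸ 3
  3≤N : 3 ℕ.≤ N
  3≤N = ℕ.≤-trans (from-yes (3 ℕ.≤? 2 ℕ.^ 6)) (ℕ.^-monoʳ-≤ 2 6≤h)
  3+s≡N : 3 ℕ.+ s ≡ N
  3+s≡N = ℕ.m+[n∸m]≡n 3≤N
  g≤N : g ℕ.≤ N
  g≤N = ℕ.≤-trans g≤h (ℕ.<⇒≤ (n<2^n h))
  eq : ∀ h s → h * h * ((1ℚ + 1ℚ) + s) ≡ h * (h * s + (h + h))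
  eq = solve-∀ ℚ-ring
  s-large : 2 ℕ.^ (5 ℕ.+ g) ℕ.≤ 2 ℕ.+ s
  s-large = ℕ.≤-trans (2^suc≤ (5 ℕ.+ g)) (ℕ.≤-reflexive (cong (ℕ._∸ 1) (trans (cong (2 ℕ.^_) 6+g≡h) (sym 3+s≡N))))
  x′-large : ι (2 ℕ.^ (3 ℕ.+ g)) ≤ logSum k x
  x′-large = begin
    ι (2 ℕ.^ (3 ℕ.+ g))                   ≡⟨ sym (trans (sym (*-assoc (½ * ½) (ι 4) (ι (2 ℕ.^ (3 ℕ.+ g))))) (*-identityˡ (ι (2 ℕ.^ (3 ℕ.+ g))))) ⟩
    ½ * ½ * (ι 4 * ι (2 ℕ.^ (3 ℕ.+ g)))   ≡⟨ cong (½ * ½ *_) (sym (trans (cong ι (ℕ.^-distribˡ-+-* 2 2 (3 ℕ.+ g))) (ι-* 4 (2 ℕ.^ (3 ℕ.+ g))))) ⟩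
    ½ * ½ * ι (2 ℕ.^ (5 ℕ.+ g))           ≤⟨ *-monoˡ (½ * ½) (from-yes (0ℚ ≤? ½ * ½)) (ι-mono s-large) ⟩
    ½ * ½ * ι (2 ℕ.+ s)                   ≡⟨ cong (½ * ½ *_) (ι-+ 2 s) ⟩
    ½ * ½ * (2ℚ + ι s)                    ≡⟨ eq ½ (ι s) ⟩
    ½ * (½ * ι s + 1ℚ)                    ≤⟨ logSum-lower s (subst (λ t → ι (2 ℕ.^ t) ≤ x) (sym 3+s≡N) 2^≤x) k
                                               (ℕ.≤-trans (ℕ.^-monoʳ-≤ 2 (ℕ.m∸n≤m N 3)) N≤k) ⟩
    logSum k x                            ∎
  final : ι (suc h) * (ℤ.+ 1 / 75) ≤ ½ * (½ * ι g + 1ℚ)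
  final = begin
    ι (suc h) * (ℤ.+ 1 / 75)                    ≡⟨ cong (λ t → ι (suc t) * (ℤ.+ 1 / 75)) (sym 6+g≡h) ⟩
    ι (7 ℕ.+ g) * (ℤ.+ 1 / 75)                  ≡⟨ cong (_* (ℤ.+ 1 / 75)) (ι-+ 7 g) ⟩
    (ι 7 + ι g) * (ℤ.+ 1 / 75)                  ≡⟨ *-distribʳ-+ (ℤ.+ 1 / 75) (ι 7) (ι g) ⟩
    ι 7 * (ℤ.+ 1 / 75) + ι g * (ℤ.+ 1 / 75)     ≤⟨ +-mono-≤ (from-yes (ι 7 * (ℤ.+ 1 / 75) ≤? ½)) (*-monoˡ (ι g) (0≤ι g) (from-yes ((ℤ.+ 1 / 75) ≤? ½ * ½))) ⟩
    ½ + ι g * (½ * ½)                           ≡⟨ eq″ ½ (ι g) ⟩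
    ½ * (½ * ι g + 1ℚ)                          ∎
    where
    eq″ : ∀ h g → h + g * (h * h) ≡ h * (h * g + 1ℚ)
    eq″ = solve-∀ ℚ-ring

-- Since ln n ≥ 13/12 for n ≥ 3, the case h ≤ 5 is settled by ln (13/12) ≥ 2/25.
logSum-logSum-lower : ∀ n h → 2 ℕ.^ (2 ℕ.^ h) ℕ.≤ n →
  (∀ k → 2 ℕ.≤ k → 1ℚ + ℤ.+ 1 / 12 ≤ logSum k (ι n)) →
  Eventually (λ k → ι (suc h) * (ℤ.+ 1 / 75) ≤ logSum k (logSum k (ι n)))
logSum-logSum-lower n h 2^2^h≤n 13/12≤ = [ small , large ]′ (ℕ.≤-<-connex h 5)
  where
  Bound = Eventually (λ k → ι (suc h) * (ℤ.+ 1 / 75) ≤ logSum k (logSum k (ι n)))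
  small : h ℕ.≤ 5 → Bound
  small h≤5 = 2 , λ k 2≤k → ≤-trans
    (*-monoʳ (ℤ.+ 1 / 75) (from-yes (0ℚ ≤? (ℤ.+ 1 / 75))) (ι-mono (s≤s h≤5)))
    (lnln-small (13/12≤ k 2≤k) k (ℕ.≤-trans (s≤s z≤n) 2≤k))
  large : 5 ℕ.< h → Bound
  large 5<h = 2 ℕ.^ (2 ℕ.^ h) , lnln-large (h ℕ.∸ 6) h (ℕ.m+[n∸m]≡n 5<h) (ι-mono 2^2^h≤n)

lnln-lower : ∀ n (3≤n : 3 ℕ.≤ n) h → 2 ℕ.^ (2 ℕ.^ h) ℕ.≤ n →
             Eventually (λ k → ι (suc h) * (ℤ.+ 1 / 75) ≤ seq (proj₁ (lnln n 3≤n)) k)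
lnln-lower n 3≤n h 2^2^h≤n = logSum-logSum-lower n h 2^2^h≤n
  (proj₂ (proj₂ (proj₂ (1<ln n (ℕ.≤-trans (s≤s z≤n) 3≤n) 3≤n))))

ln-nonNeg : ∀ A (0<A : 0ℝ <ℝ ℕ→ℝ A) → 1 ℕ.≤ A → ∀ k → 0ℚ ≤ seq (ln (ℕ→ℝ A , 0<A)) k
ln-nonNeg A _ 1≤A k = 0≤logSum k (ι-mono 1≤A)

-- The bound 2 (m + 2) is at most 6 m because 1 ≤ m; a purely multiplicative form is easier to
-- compare with φ(n).
ln-upper : ∀ A (0<A : 0ℝ <ℝ ℕ→ℝ A) m → 1 ℕ.≤ A → A ℕ.≤ 2 ℕ.^ m → 1 ℕ.≤ m →
           ∀ k → seq (ln (ℕ→ℝ A , 0<A)) k ≤ ι (6 ℕ.* m)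
ln-upper A _ m 1≤A A≤2^m 1≤m k = begin
  logSum k (ι A)                   ≤⟨ logSum-upper m (ι-mono 1≤A) (ι-mono A≤2^m) k ⟩
  2ℚ * (ι (suc m) + 1ℚ)            ≡⟨ cong (2ℚ *_) (trans (+-comm (ι (suc m)) 1ℚ) (sym (ι-suc (suc m)))) ⟩
  2ℚ * ι (2 ℕ.+ m)                 ≤⟨ *-monoˡ 2ℚ (<⇒≤ 0<2) (ι-mono (ℕ.+-monoˡ-≤ m (ℕ.*-monoʳ-≤ 2 1≤m))) ⟩
  2ℚ * ι (2 ℕ.* m ℕ.+ m)           ≡⟨ sym (ι-* 2 (2 ℕ.* m ℕ.+ m)) ⟩
  ι (2 ℕ.* (2 ℕ.* m ℕ.+ m))        ≡⟨ cong ι (solve 1 (λ m → con 2 :* (con 2 :* m :+ m) := con 6 :* m) refl m) ⟩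
  ι (6 ℕ.* m)                      ∎
  where
  open ≤-Reasoning
  open +-*-Solver

-- Sums and products over lists

sumL prodL : {A : Set} → (A → ℚ) → List A → ℚ
sumL f []       = 0ℚ
sumL f (x ∷ xs) = f x + sumL f xs
prodL f []       = 1ℚ
prodL f (x ∷ xs) = f x * prodL f xs

module _ {A : Set} where

  sumL-++ : ∀ (f : A → ℚ) xs ys → sumL f (xs ++ ys) ≡ sumL f xs + sumL f ys
  sumL-++ f []       ys = sym (+-identityˡ _)
  sumL-++ f (x ∷ xs) ys = trans (cong (λ t → f x + t) (sumL-++ f xs ys)) (sym (+-assoc (f x) _ _))

  0≤sumL : ∀ {f : A → ℚ} → (∀ x → 0ℚ ≤ f x) → ∀ xs → 0ℚ ≤ sumL f xs
  0≤sumL 0≤f []       = ≤-refl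
  0≤sumL 0≤f (x ∷ xs) = 0≤+ (0≤f x) (0≤sumL 0≤f xs)

  sumL-≤ : ∀ {f g : A → ℚ} {xs} → All (λ x → f x ≤ g x) xs → sumL f xs ≤ sumL g xs
  sumL-≤ []       = ≤-refl
  sumL-≤ (h ∷ hs) = +-mono-≤ h (sumL-≤ hs)

  sumL-+ : ∀ (f g : A → ℚ) xs → sumL (λ x → f x + g x) xs ≡ sumL f xs + sumL g xs
  sumL-+ f g []       = refl
  sumL-+ f g (x ∷ xs) = trans (cong (λ t → f x + g x + t) (sumL-+ f g xs)) (eq (f x) (g x) (sumL f xs) (sumL g xs))
    where
    eq : ∀ a b c d → a + b + (c + d) ≡ a + c + (b + d)
    eq = solve-∀ ℚ-ring

  sumL-* : ∀ c (f : A → ℚ) xs → sumL (λ x → c * f x) xs ≡ c * sumL f xs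
  sumL-* c f []       = sym (*-zeroʳ c)
  sumL-* c f (x ∷ xs) = trans (cong (λ t → c * f x + t) (sumL-* c f xs)) (sym (*-distribˡ-+ c (f x) _))

  -- Each head of `xs` is cut out of `ys`. It is never asked for again, because `xs` has no
  -- repetitions.
  sumL-⊆ : ∀ {f : A → ℚ} → (∀ x → 0ℚ ≤ f x) → ∀ {xs} ys → Unique xs → (∀ {x} → x ∈ xs → x ∈ ys) →
           sumL f xs ≤ sumL f ys
  sumL-⊆ 0≤f {[]}     ys _ _ = 0≤sumL 0≤f ys
  sumL-⊆ {f} 0≤f {x ∷ xs} ys (x∉xs ∷ uxs) xs⊆ys with ∈-∃++ (xs⊆ys (here refl))
  ... | as , bs , refl = begin
    f x + sumL f xs                       ≤⟨ +-monoʳ-≤ (f x) (sumL-⊆ 0≤f (as ++ bs) uxs rest) ⟩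
    f x + sumL f (as ++ bs)               ≡⟨ cong (λ t → f x + t) (sumL-++ f as bs) ⟩
    f x + (sumL f as + sumL f bs)         ≡⟨ eq (f x) (sumL f as) (sumL f bs) ⟩
    sumL f as + (f x + sumL f bs)         ≡⟨ sym (sumL-++ f as (x ∷ bs)) ⟩
    sumL f (as ++ x ∷ bs)                 ∎
    where
    open ≤-Reasoning
    eq : ∀ a b c → a + (b + c) ≡ b + (a + c)
    eq = solve-∀ ℚ-ring
    rest : ∀ {y} → y ∈ xs → y ∈ as ++ bs
    rest y∈xs with ∈-++⁻ as (xs⊆ys (there y∈xs))
    ... | inj₁ y∈as         = ∈-++⁺ˡ y∈as
    ... | inj₂ (here refl)  = contradiction refl (All.lookup x∉xs y∈xs)
    ... | inj₂ (there y∈bs) = ∈-++⁺ʳ as y∈bs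

  0≤prodL : ∀ {f : A → ℚ} {xs} → All (λ x → 0ℚ ≤ f x) xs → 0ℚ ≤ prodL f xs
  0≤prodL []       = 0≤1
  0≤prodL (h ∷ hs) = 0≤* h (0≤prodL hs)

  prodL-* : ∀ (f g : A → ℚ) xs → prodL (λ x → f x * g x) xs ≡ prodL f xs * prodL g xs
  prodL-* f g []       = refl
  prodL-* f g (x ∷ xs) = trans (cong (λ t → f x * g x * t) (prodL-* f g xs)) (eq (f x) (g x) (prodL f xs) (prodL g xs))
    where
    eq : ∀ a b c d → a * b * (c * d) ≡ a * c * (b * d)
    eq = solve-∀ ℚ-ring

  -- The Weierstrass product inequality. The bound by 1 is carried along because the induction step
  -- needs `f x` times the remaining product to be at most `f x`.
  1-sumL≤prodL : ∀ {f : A → ℚ} {xs} → All (λ x → 0ℚ ≤ f x × f x ≤ 1ℚ) xs →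
                 1ℚ - sumL f xs ≤ prodL (λ x → 1ℚ - f x) xs × prodL (λ x → 1ℚ - f x) xs ≤ 1ℚ
  1-sumL≤prodL [] = ≤-refl , ≤-refl
  1-sumL≤prodL {f} {x ∷ xs} ((0≤fx , fx≤1) ∷ hs) with 1-sumL≤prodL hs
  ... | lower , P≤1 = (begin
      1ℚ - (f x + sumL f xs)             ≡⟨ eq (f x) (sumL f xs) ⟩
      (1ℚ - sumL f xs) - f x * 1ℚ        ≤⟨ +-mono-≤ lower (neg-antimono-≤ (*-monoˡ (f x) 0≤fx P≤1)) ⟩
      P - f x * P                        ≡⟨ eq′ (f x) P ⟩
      (1ℚ - f x) * P                     ∎)
    , *-mono 0≤1 (0≤prodL (All.map (λ h → p≤q⇒0≤q-p (proj₂ h)) hs)) (p-q≤p 0≤fx) P≤1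
    where
    open ≤-Reasoning
    P = prodL (λ x → 1ℚ - f x) xs
    eq : ∀ a b → 1ℚ - (a + b) ≡ (1ℚ - b) - a * 1ℚ
    eq = solve-∀ ℚ-ring
    eq′ : ∀ a p → p - a * p ≡ (1ℚ - a) * p
    eq′ = solve-∀ ℚ-ring

sumL-applyDownFrom : ∀ (f : ℕ → ℚ) g n → sumL f (List.applyDownFrom g n) ≡ sumTo (λ i → f (g i)) n
sumL-applyDownFrom f g zero    = refl
sumL-applyDownFrom f g (suc n) = trans (+-comm (f (g n)) _) (cong (_+ f (g n)) (sumL-applyDownFrom f g n))

sumL-unique : ∀ {f : ℕ → ℚ} → (∀ x → 0ℚ ≤ f x) → ∀ s N {xs} → Unique xs →
              All (λ x → s ℕ.≤ x × x ℕ.< s ℕ.+ N) xs → sumL f xs ≤ sumTo (λ i → f (s ℕ.+ i)) N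
sumL-unique {f} 0≤f s N {xs} uxs hs = subst (sumL f xs ≤_) (sumL-applyDownFrom f (s ℕ.+_) N)
  (sumL-⊆ 0≤f (List.applyDownFrom (s ℕ.+_) N) uxs inRange)
  where
  inRange : ∀ {x} → x ∈ xs → x ∈ List.applyDownFrom (s ℕ.+_) N
  inRange {x} x∈xs with All.lookup hs x∈xs
  ... | s≤x , x<s+N = subst (_∈ List.applyDownFrom (s ℕ.+_) N) (ℕ.m+[n∸m]≡n s≤x)
    (∈-applyDownFrom⁺ (s ℕ.+_) (ℕ.+-cancelˡ-< s _ _ (subst (ℕ._< s ℕ.+ N) (sym (ℕ.m+[n∸m]≡n s≤x)) x<s+N)))

≥2⇒nonZero : ∀ {n} → 2 ℕ.≤ n → ℕ.NonZero n
≥2⇒nonZero 2≤n = ℕ.>-nonZero (ℕ.≤-trans (s≤s z≤n) 2≤n)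

-- Replaces a sum over distinct numbers by an initial segment of a series, which can telescope. The
-- product of the list serves as a crude bound for its entries.
sumL-unique-≥2 : ∀ {f : ℕ → ℚ} → (∀ x → 0ℚ ≤ f x) → ∀ {xs} → Unique xs → All (2 ℕ.≤_) xs →
                 Σ[ N ∈ ℕ ] sumL f xs ≤ sumTo (λ i → f (2 ℕ.+ i)) N
sumL-unique-≥2 0≤f {xs} uxs 2≤xs = suc (product xs) , sumL-unique 0≤f 2 (suc (product xs)) uxs
  (All.tabulate λ x∈xs → All.lookup 2≤xs x∈xs , s≤s (ℕ.≤-trans (∈⇒≤product (All.map ≥2⇒nonZero 2≤xs) x∈xs)
    (ℕ.m≤n+m (product xs) 2)))

-- The ratio Φₙ(a) / a^φ(n)

0≤½ : 0ℚ ≤ ½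
0≤½ = from-yes (0ℚ ≤? ½)

½≤1 : ½ ≤ 1ℚ
½≤1 = from-yes (½ ≤? 1ℚ)

½≤1-v : ∀ {v} → v ≤ ½ → ½ ≤ 1ℚ - v
½≤1-v v≤½ = 1-q≤1-p v≤½

-- Compare with Σ_{p ≥ 2} vᵖ = v² / (1 - v) ≤ v.
1-v≤prodL : ∀ {v} → 0ℚ ≤ v → v ≤ ½ → ∀ {ps} → Unique ps → All (2 ℕ.≤_) ps →
            1ℚ - v ≤ prodL (λ p → 1ℚ - v ^ℚ p) ps
1-v≤prodL {v} 0≤v v≤½ {ps} ups 2≤ps = ≤-trans
  (1-q≤1-p (≤-trans (proj₂ range) (≤-trans (geometric N₀) (p-q≤p {v} {v ^ℚ suc N₀} (0≤^ 0≤v (suc N₀))))))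
  (proj₁ (1-sumL≤prodL (All.universal (λ p → 0≤^ 0≤v p , ^≤1 0≤v (≤-trans v≤½ ½≤1) p) ps)))
  where
  open ≤-Reasoning
  range = sumL-unique-≥2 (0≤^ 0≤v) ups 2≤ps
  N₀ = proj₁ range
  eq : ∀ v → v - v * 1ℚ ≡ 0ℚ
  eq = solve-∀ ℚ-ring
  eq″ : ∀ v q r → v - q + (q - r) ≡ v - r
  eq″ = solve-∀ ℚ-ring
  eq‴ : ∀ h q → h * q ≡ q * (h + h) - h * q
  eq‴ = solve-∀ ℚ-ring
  -- As v ≤ ½, each power is at most the drop to it from the preceding power, so the sum of the
  -- powers telescopes.
  halve : ∀ q → 0ℚ ≤ q → v * q ≤ q - v * q
  halve q 0≤q = begin
    v * q            ≤⟨ *-monoʳ q 0≤q v≤½ ⟩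
    ½ * q            ≡⟨ eq‴ ½ q ⟩
    q * 1ℚ - ½ * q   ≤⟨ +-mono-≤ (≤-reflexive (*-identityʳ q)) (neg-antimono-≤ (*-monoʳ q 0≤q v≤½)) ⟩
    q - v * q        ∎
  geometric : ∀ N → sumTo (λ i → v ^ℚ (2 ℕ.+ i)) N ≤ v - v ^ℚ suc N
  geometric zero    = ≤-reflexive (sym (eq v))
  geometric (suc N) = ≤-trans (+-mono-≤ (geometric N) (halve (v ^ℚ suc N) (0≤^ 0≤v (suc N))))
    (≤-reflexive (eq″ v (v ^ℚ suc N) (v ^ℚ (2 ℕ.+ N))))

-- For distinct primes ps with product m, evenProd ps x / oddProd ps x = Φₘ(x).
evenProd oddProd : List ℕ → ℕ → ℕ
evenProd []       x = x ℕ.∸ 1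
evenProd (p ∷ ps) x = evenProd ps (x ℕ.^ p) ℕ.* oddProd ps x
oddProd []       x = 1
oddProd (p ∷ ps) x = oddProd ps (x ℕ.^ p) ℕ.* evenProd ps x

totient : List ℕ → ℕ
totient ps = product (List.map ℕ.pred ps)

-- Satisfied by X / Y = ∏ (1 - uᵈ)^μ(d), with d running over the products of subsets of ps.
record Ratio (ps : List ℕ) (u X Y : ℚ) : Set where
  constructor ratio
  field
    below : (1ℚ - u) * Y ≤ X
    above : X * prodL (λ p → 1ℚ - u ^ℚ p) ps ≤ (1ℚ - u) * Y

module _ {ps : List ℕ} (ups : Unique ps) (2≤ps : All (2 ℕ.≤_) ps) where

  -- By `1-v≤prodL` the product in `above` is at least 1 - u, and this factor cancels.
  ratio≤1 : ∀ {u X Y} → 0ℚ ≤ u → u ≤ ½ → 0ℚ ≤ X → Ratio ps u X Y → X ≤ Y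
  ratio≤1 {u} {X} {Y} 0≤u u≤½ 0≤X (ratio _ above) = *-cancel-≤ (1ℚ - u)
    (<-≤-trans (from-yes (0ℚ <? ½)) (½≤1-v u≤½))
    (≤-trans (*-monoˡ X 0≤X (1-v≤prodL 0≤u u≤½ ups 2≤ps)) (≤-trans above (≤-reflexive (*-comm (1ℚ - u) Y))))

  -- The new quotient is (X/Y) / (X′/Y′), the second one belonging to uᵖ. From X′/Y′ ≤ 1 the lower
  -- bound persists. From X′/Y′ ≥ 1 - uᵖ the upper bound loses one factor 1 - uᵖ, precisely the one
  -- that the product gains with p.
  ratio-step : ∀ {p u X Y X′ Y′} → 0ℚ ≤ u → u ≤ ½ → u ^ℚ p ≤ ½ →
               0ℚ ≤ X → 0ℚ ≤ Y → 0ℚ ≤ X′ → 0ℚ ≤ Y′ → Ratio ps u X Y → Ratio ps (u ^ℚ p) X′ Y′ →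
               Ratio (p ∷ ps) u (X * Y′) (Y * X′)
  ratio-step {p} {u} {X} {Y} {X′} {Y′} 0≤u u≤½ v≤½ 0≤X 0≤Y 0≤X′ 0≤Y′ (ratio lo up) r′@(ratio lo′ up′) = ratio
    (begin
      (1ℚ - u) * (Y * X′)           ≡⟨ sym (*-assoc (1ℚ - u) Y X′) ⟩
      (1ℚ - u) * Y * X′             ≤⟨ *-mono 0≤X 0≤X′ lo (ratio≤1 (0≤^ 0≤u p) v≤½ 0≤X′ r′) ⟩
      X * Y′                        ∎)
    (begin
      X * Y′ * ((1ℚ - v) * Π)       ≡⟨ eq X Y′ (1ℚ - v) Π ⟩
      X * Π * ((1ℚ - v) * Y′)       ≤⟨ *-mono (0≤* 0≤1-u 0≤Y) (0≤* (≤-trans 0≤½ (½≤1-v v≤½)) 0≤Y′) up lo′ ⟩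
      (1ℚ - u) * Y * X′             ≡⟨ *-assoc (1ℚ - u) Y X′ ⟩
      (1ℚ - u) * (Y * X′)           ∎)
    where
    open ≤-Reasoning
    v = u ^ℚ p
    Π = prodL (λ p → 1ℚ - u ^ℚ p) ps
    0≤1-u = ≤-trans 0≤½ (½≤1-v u≤½)
    eq : ∀ a b c d → a * b * (c * d) ≡ a * d * (c * b)
    eq = solve-∀ ℚ-ring

ratio-cancel : ∀ {ps u X Y} c → 0ℚ < c → Ratio ps u (X * c) (Y * c) → Ratio ps u X Y
ratio-cancel {ps} {u} {X} {Y} c 0<c (ratio lo up) = ratio
  (*-cancel-≤ c 0<c (subst (_≤ X * c) (sym (*-assoc (1ℚ - u) Y c)) lo))
  (*-cancel-≤ c 0<c (subst₂ _≤_ (eq X c (prodL (λ p → 1ℚ - u ^ℚ p) ps)) (sym (*-assoc (1ℚ - u) Y c)) up))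
  where
  eq : ∀ a b c → a * b * c ≡ a * c * b
  eq = solve-∀ ℚ-ring

0<ι^ : ∀ x n → 2 ℕ.≤ x → 0ℚ < ι (x ℕ.^ n)
0<ι^ x n 2≤x = 0<ι (x ℕ.^ n) (ℕ.m^n>0 x {{≥2⇒nonZero 2≤x}} n)

recip-^ : ∀ x n → 2 ℕ.≤ x → recip (ι (x ℕ.^ n)) ≡ recip (ι x) ^ℚ n
recip-^ x n 2≤x = sym (recip-unique {recip (ι x) ^ℚ n} {ι (x ℕ.^ n)} (0<ι^ x n 2≤x)
  (trans (cong (recip (ι x) ^ℚ n *_) (ι-^ x n)) (trans (sym (^-* (recip (ι x)) (ι x) n))
    (trans (cong (_^ℚ n) (trans (*-comm (recip (ι x)) (ι x)) (recip-inverse (0<ι x (ℕ.≤-trans (s≤s z≤n) 2≤x))))) (1^ n)))))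
  where
  1^ : ∀ n → 1ℚ ^ℚ n ≡ 1ℚ
  1^ zero    = refl
  1^ (suc n) = trans (*-identityˡ _) (1^ n)

recip≤½ : ∀ x → 2 ℕ.≤ x → recip (ι x) ≤ ½
recip≤½ x 2≤x = recip-anti 0<2 (ι-mono 2≤x)

2≤x^ : ∀ {x p} → 2 ℕ.≤ x → 1 ℕ.≤ p → 2 ℕ.≤ x ℕ.^ p
2≤x^ {x} {p} 2≤x 1≤p = ℕ.≤-trans 2≤x (ℕ.≤-trans (ℕ.≤-reflexive (sym (ℕ.^-identityʳ x)))
  (ℕ.^-monoʳ-≤ x {{≥2⇒nonZero 2≤x}} 1≤p))

-- With u = 1/x and m the product of distinct primes, Φₘ(x) / x^φ(m) is the product of the (1 -
-- uᵈ)^μ(m/d), and μ(m/d) = μ(m) μ(d). The parity of the number of primes thus decides whether this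
-- quotient or its inverse has the form that `Ratio` bounds.
EvenRatio OddRatio : List ℕ → Set
EvenRatio ps = ∀ x → 2 ℕ.≤ x → Ratio ps (recip (ι x)) (ι (evenProd ps x)) (ι (oddProd ps x ℕ.* x ℕ.^ totient ps))
OddRatio  ps = ∀ x → 2 ℕ.≤ x → Ratio ps (recip (ι x)) (ι (oddProd ps x ℕ.* x ℕ.^ totient ps)) (ι (evenProd ps x))

-- The powers of x in the two members of the new ratio differ from those
-- prescribed by totient (p ∷ ps) by the common factor x ^ totient ps.
pow-totient : ∀ p ps x → 1 ℕ.≤ p → (x ℕ.^ p) ℕ.^ totient ps ≡ x ℕ.^ totient (p ∷ ps) ℕ.* x ℕ.^ totient ps
pow-totient (suc p) ps x _ = begin
  (x ℕ.^ suc p) ℕ.^ t          ≡⟨ ℕ.^-*-assoc x (suc p) t ⟩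
  x ℕ.^ (t ℕ.+ p ℕ.* t)        ≡⟨ ℕ.^-distribˡ-+-* x t (p ℕ.* t) ⟩
  x ℕ.^ t ℕ.* x ℕ.^ (p ℕ.* t)  ≡⟨ ℕ.*-comm (x ℕ.^ t) _ ⟩
  x ℕ.^ (p ℕ.* t) ℕ.* x ℕ.^ t  ∎
  where
  open ≡-Reasoning
  t = totient ps

module _ (p : ℕ) (ps : List ℕ) (1≤p : 1 ℕ.≤ p) (x : ℕ) where
  private
    t = totient ps
    t′ = totient (p ∷ ps)
    y = x ℕ.^ p

  scaled-odd : ι (evenProd ps x) * ι (oddProd ps y ℕ.* y ℕ.^ t) ≡ ι (oddProd (p ∷ ps) x ℕ.* x ℕ.^ t′) * ι (x ℕ.^ t)
  scaled-odd = trans (sym (ι-* (evenProd ps x) (oddProd ps y ℕ.* y ℕ.^ t))) (trans (cong ι (trans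
    (cong (λ z → evenProd ps x ℕ.* (oddProd ps y ℕ.* z)) (pow-totient p ps x 1≤p))
    (solve 4 (λ e o a b → e :* (o :* (a :* b)) := o :* e :* a :* b) refl
      (evenProd ps x) (oddProd ps y) (x ℕ.^ t′) (x ℕ.^ t))))
    (ι-* (oddProd (p ∷ ps) x ℕ.* x ℕ.^ t′) (x ℕ.^ t)))
    where open +-*-Solver

  scaled-even : ι (oddProd ps x ℕ.* x ℕ.^ t) * ι (evenProd ps y) ≡ ι (evenProd (p ∷ ps) x) * ι (x ℕ.^ t)
  scaled-even = trans (sym (ι-* (oddProd ps x ℕ.* x ℕ.^ t) (evenProd ps y))) (trans (cong ι
    (solve 3 (λ o a e → o :* a :* e := e :* o :* a) refl (oddProd ps x) (x ℕ.^ t) (evenProd ps y)))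
    (ι-* (evenProd (p ∷ ps) x) (x ℕ.^ t)))
    where open +-*-Solver

-- Φₘₚ(x) = Φₘ(xᵖ) / Φₘ(x) is inverted relative to the quotient of `ratio-step`, so each prime
-- exchanges the two cases. The induction hypothesis is used at x and at xᵖ, which is why both
-- predicates quantify over x.
ratio-bounds : ∀ {ps} → Unique ps → All (2 ℕ.≤_) ps → EvenRatio ps ⊎ OddRatio ps
ratio-bounds [] [] = inj₁ λ x 2≤x → base x 2≤x
  where
  base : ∀ x → 2 ℕ.≤ x → Ratio [] (recip (ι x)) (ι (x ℕ.∸ 1)) (ι (1 ℕ.* x ℕ.^ 1))
  base x@(suc y) 2≤x = ratio (≤-reflexive eq) (≤-reflexive (trans (*-identityʳ (ι y)) (sym eq)))
    where
    eq′ : ∀ r x → (1ℚ - r) * x ≡ x - x * r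
    eq′ = solve-∀ ℚ-ring
    eq″ : ∀ y → 1ℚ + y - 1ℚ ≡ y
    eq″ = solve-∀ ℚ-ring
    eq : (1ℚ - recip (ι x)) * ι (1 ℕ.* x ℕ.^ 1) ≡ ι y
    eq = trans (cong (λ t → (1ℚ - recip (ι x)) * ι t) (trans (ℕ.*-identityˡ (x ℕ.^ 1)) (ℕ.^-identityʳ x)))
      (trans (eq′ (recip (ι x)) (ι x)) (trans (cong₂ _-_ (ι-suc y) (recip-inverse (0<ι-suc y))) (eq″ (ι y))))
ratio-bounds {p ∷ ps} (_ ∷ ups) (2≤p ∷ 2≤ps) = [ inj₂ ∘ toOdd , inj₁ ∘ toEven ]′ (ratio-bounds ups 2≤ps)
  where
  1≤p = ℕ.≤-trans (s≤s z≤n) 2≤p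
  module _ (x : ℕ) (2≤x : 2 ℕ.≤ x) where
    u = recip (ι x)
    c = ι (x ℕ.^ totient ps)
    0≤u = 0≤recip (0<ι x (ℕ.≤-trans (s≤s z≤n) 2≤x))
    2≤y = 2≤x^ 2≤x 1≤p
    v≤½ = subst (_≤ ½) (recip-^ x p 2≤x) (recip≤½ (x ℕ.^ p) 2≤y)
    step : ∀ {X Y X′ Y′} → Ratio ps u (ι X) (ι Y) → Ratio ps (recip (ι (x ℕ.^ p))) (ι X′) (ι Y′) →
           Ratio (p ∷ ps) u (ι X * ι Y′) (ι Y * ι X′)
    step {X} {Y} {X′} {Y′} r r′ = ratio-step ups 2≤ps 0≤u (recip≤½ x 2≤x) v≤½
      (0≤ι X) (0≤ι Y) (0≤ι X′) (0≤ι Y′) r (subst (λ t → Ratio ps t (ι X′) (ι Y′)) (recip-^ x p 2≤x) r′)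
  toOdd : EvenRatio ps → OddRatio (p ∷ ps)
  toOdd h x 2≤x = ratio-cancel (c x 2≤x) (0<ι^ x (totient ps) 2≤x)
    (subst₂ (Ratio (p ∷ ps) (u x 2≤x)) (scaled-odd p ps 1≤p x) (scaled-even p ps 1≤p x)
      (step x 2≤x {evenProd ps x} {oddProd ps x ℕ.* x ℕ.^ totient ps} {evenProd ps (x ℕ.^ p)} {oddProd ps (x ℕ.^ p) ℕ.* (x ℕ.^ p) ℕ.^ totient ps}
        (h x 2≤x) (h (x ℕ.^ p) (2≤y x 2≤x))))
  toEven : OddRatio ps → EvenRatio (p ∷ ps)
  toEven h x 2≤x = ratio-cancel (c x 2≤x) (0<ι^ x (totient ps) 2≤x)
    (subst₂ (Ratio (p ∷ ps) (u x 2≤x)) (scaled-even p ps 1≤p x) (scaled-odd p ps 1≤p x)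
      (step x 2≤x {oddProd ps x ℕ.* x ℕ.^ totient ps} {evenProd ps x} {oddProd ps (x ℕ.^ p) ℕ.* (x ℕ.^ p) ℕ.^ totient ps} {evenProd ps (x ℕ.^ p)}
        (h x 2≤x) (h (x ℕ.^ p) (2≤y x 2≤x))))

ι-cancel-≤ : ∀ m n → ι m ≤ ι n → m ℕ.≤ n
ι-cancel-≤ m n ιm≤ιn = ℕ.≮⇒≥ λ n<m → <-irrefl refl (<-≤-trans
  (subst₂ _<_ (+-identityˡ (ι n)) (sym (ι-suc n)) (+-monoˡ-< (ι n) 0<1)) (≤-trans (ι-mono {suc n} {m} n<m) ιm≤ιn))

-- In the even case the normalised quotient is at least 1 - u ≥ ½; in the odd case its inverse is at
-- most 1.
oddProd-pow≤2*evenProd : ∀ {ps} → Unique ps → All (2 ℕ.≤_) ps → ∀ x → 2 ℕ.≤ x →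
                         oddProd ps x ℕ.* x ℕ.^ totient ps ℕ.≤ 2 ℕ.* evenProd ps x
oddProd-pow≤2*evenProd {ps} ups 2≤ps x 2≤x = ι-cancel-≤ Y (2 ℕ.* X)
  ([ even , odd ]′ (ratio-bounds ups 2≤ps))
  where
  open ≤-Reasoning
  X = evenProd ps x
  Y = oddProd ps x ℕ.* x ℕ.^ totient ps
  0≤u = 0≤recip (0<ι x (ℕ.≤-trans (s≤s z≤n) 2≤x))
  even : EvenRatio ps → ι Y ≤ ι (2 ℕ.* X)
  even h = begin
    ι Y                  ≡⟨ sym (trans (sym (*-assoc 2ℚ ½ (ι Y))) (*-identityˡ (ι Y))) ⟩
    2ℚ * (½ * ι Y)       ≤⟨ *-monoˡ 2ℚ (<⇒≤ 0<2) (≤-trans (*-monoʳ (ι Y) (0≤ι Y) (½≤1-v (recip≤½ x 2≤x))) (Ratio.below (h x 2≤x))) ⟩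
    2ℚ * ι X             ≡⟨ sym (ι-* 2 X) ⟩
    ι (2 ℕ.* X)          ∎
  odd : OddRatio ps → ι Y ≤ ι (2 ℕ.* X)
  odd h = ≤-trans (ratio≤1 ups 2≤ps 0≤u (recip≤½ x 2≤x) (0≤ι Y) (h x 2≤x)) (ι-mono (ℕ.m≤m+n X _))

-- Products over the cube in terms of the radical

filter-map : ∀ {A B : Set} {P : Pred B 0ℓ} (P? : Decidable P) (g : A → B) xs →
             filter P? (List.map g xs) ≡ List.map g (filter (P? ∘ g) xs)
filter-map P? g []       = refl
filter-map P? g (x ∷ xs) with P? (g x)
... | yes _ = cong (g x ∷_) (filter-map P? g xs)
... | no  _ = filter-map P? g xs

cubeProduct : ∀ {k} {P : Pred (Vec (Fin 2) k) 0ℓ} → Decidable P → (Vec (Fin 2) k → ℕ) → ℕ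
cubeProduct {k} P? f = product (List.map f (filter P? (cube k)))

cubeProduct-cong : ∀ {k} {P Q : Pred (Vec (Fin 2) k) 0ℓ} (P? : Decidable P) (Q? : Decidable Q) {f g : Vec (Fin 2) k → ℕ} →
                   (∀ {ε} → P ε → Q ε) → (∀ {ε} → Q ε → P ε) → (∀ ε → f ε ≡ g ε) → cubeProduct P? f ≡ cubeProduct Q? g
cubeProduct-cong {k} P? Q? {g = g} P⊆Q Q⊆P f≗g = cong product (trans (map-cong f≗g (filter P? (cube k)))
  (cong (List.map g) (filter-≐ P? Q? (P⊆Q , Q⊆P) (cube k))))

cubeProduct-suc : ∀ {k} {P : Pred (Vec (Fin 2) (suc k)) 0ℓ} (P? : Decidable P) f →
                  cubeProduct P? f ≡ cubeProduct (P? ∘ (0F ∷_)) (f ∘ (0F ∷_)) ℕ.* cubeProduct (P? ∘ (1F ∷_)) (f ∘ (1F ∷_))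
cubeProduct-suc {k} P? f = begin
  product (List.map f (filter P? (List.map (0F ∷_) (cube k) ++ List.map (1F ∷_) (cube k))))
    ≡⟨ cong (product ∘ List.map f) (filter-++ P? (List.map (0F ∷_) (cube k)) (List.map (1F ∷_) (cube k))) ⟩
  product (List.map f (filter P? (List.map (0F ∷_) (cube k)) ++ filter P? (List.map (1F ∷_) (cube k))))
    ≡⟨ cong product (map-++ f (filter P? (List.map (0F ∷_) (cube k))) _) ⟩
  product (List.map f (filter P? (List.map (0F ∷_) (cube k))) ++ List.map f (filter P? (List.map (1F ∷_) (cube k))))
    ≡⟨ product-++ (List.map f (filter P? (List.map (0F ∷_) (cube k)))) _ ⟩
  product (List.map f (filter P? (List.map (0F ∷_) (cube k)))) ℕ.* product (List.map f (filter P? (List.map (1F ∷_) (cube k))))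
    ≡⟨ cong₂ (λ xs ys → product xs ℕ.* product ys) (face 0F) (face 1F) ⟩
  cubeProduct (P? ∘ (0F ∷_)) (f ∘ (0F ∷_)) ℕ.* cubeProduct (P? ∘ (1F ∷_)) (f ∘ (1F ∷_)) ∎
  where
  open ≡-Reasoning
  face : ∀ e → List.map f (filter P? (List.map (e ∷_) (cube k))) ≡ List.map (f ∘ (e ∷_)) (filter (P? ∘ (e ∷_)) (cube k))
  face e = trans (cong (List.map f) (filter-map P? (e ∷_) (cube k))) (sym (map-∘ (filter (P? ∘ (e ∷_)) (cube k))))

even? : ∀ {k} → Decidable {A = Vec (Fin 2) k} (λ ε → 2 ∣ weight ε)
even? ε = 2 ∣? weight ε

odd? : ∀ {k} → Decidable {A = Vec (Fin 2) k} (λ ε → ¬ 2 ∣ weight ε)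
odd? ε = ¬? (2 ∣? weight ε)

2∣suc⇒2∤ : ∀ w → 2 ∣ suc w → ¬ 2 ∣ w
2∣suc⇒2∤ w 2∣1+w 2∣w = contradiction (∣1⇒≡1 (∣m+n∣m⇒∣n (subst (2 ∣_) (ℕ.+-comm 1 w) 2∣1+w) 2∣w)) λ ()

2∤⇒2∣suc : ∀ w → ¬ 2 ∣ w → 2 ∣ suc w
2∤⇒2∣suc zero          2∤w = contradiction (divides 0 refl) 2∤w
2∤⇒2∣suc (suc zero)    2∤w = ∣-refl
2∤⇒2∣suc (suc (suc w)) 2∤w = ∣m∣n⇒∣m+n ∣-refl (2∤⇒2∣suc w λ 2∣w → 2∤w (∣m∣n⇒∣m+n ∣-refl 2∣w))

2∤suc⇒2∣ : ∀ w → ¬ 2 ∣ suc w → 2 ∣ w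
2∤suc⇒2∣ w 2∤1+w with 2 ∣? w
... | yes 2∣w = 2∣w
... | no  2∤w = contradiction (2∤⇒2∣suc w 2∤w) 2∤1+w

reducedExp : ∀ {k} (p l : Fin k → ℕ) → Vec (Fin 2) k → ℕ
reducedExp p l ε = product (tabulate (λ i → p i ℕ.^ (l i ℕ.∸ toℕ (Vec.lookup ε i))))

radCofactor : ∀ {k} (p l : Fin k → ℕ) → ℕ
radCofactor p l = product (tabulate (λ i → p i ℕ.^ (l i ℕ.∸ 1)))

-- Split the cube by its first coordinate. The face 0 is the cube of the remaining primes for the
-- base a^(p₀^l₀) and leads to xᵖ; the face 1 is the one for the base a^(p₀^(l₀-1)), leads to x and
-- exchanges the parities. This is the recursion of `evenProd` and `oddProd`.
cubeProduct≡ : ∀ {k} (p l : Fin k → ℕ) → (∀ i → 1 ℕ.≤ l i) → ∀ a →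
  cubeProduct even? (λ ε → a ℕ.^ reducedExp p l ε ℕ.∸ 1) ≡ evenProd (tabulate p) (a ℕ.^ radCofactor p l) ×
  cubeProduct odd?  (λ ε → a ℕ.^ reducedExp p l ε ℕ.∸ 1) ≡ oddProd  (tabulate p) (a ℕ.^ radCofactor p l)
cubeProduct≡ {zero}  p l 1≤l a = ℕ.*-identityʳ _ , refl
cubeProduct≡ {suc k} p l 1≤l a =
    trans (cubeProduct-suc even? f)
      (cong₂ ℕ._*_ (trans (cubeProduct-cong (even? ∘ (0F ∷_)) even? (λ h → h) (λ h → h) f₀) (trans (proj₁ IH₀) (cong (evenProd ps) x₀)))
        (trans (cubeProduct-cong (even? ∘ (1F ∷_)) odd? (2∣suc⇒2∤ _) (2∤⇒2∣suc _) f₁) (trans (proj₂ IH₁) (cong (oddProd ps) x₁))))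
  , trans (cubeProduct-suc odd? f)
      (cong₂ ℕ._*_ (trans (cubeProduct-cong (odd? ∘ (0F ∷_)) odd? (λ h → h) (λ h → h) f₀) (trans (proj₂ IH₀) (cong (oddProd ps) x₀)))
        (trans (cubeProduct-cong (odd? ∘ (1F ∷_)) even? (2∤suc⇒2∣ _) (λ 2∣w 2∣1+w → 2∣suc⇒2∤ _ 2∣1+w 2∣w) f₁)
          (trans (proj₁ IH₁) (cong (evenProd ps) x₁))))
  where
  open ≡-Reasoning
  p′ = p ∘ Fin.suc
  l′ = l ∘ Fin.suc
  ps = tabulate p′
  R′ = radCofactor p′ l′
  p₀ = p Fin.zero
  l₀ = l Fin.zero
  a₀ = a ℕ.^ (p₀ ℕ.^ l₀)
  a₁ = a ℕ.^ (p₀ ℕ.^ (l₀ ℕ.∸ 1))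
  f : Vec (Fin 2) (suc k) → ℕ
  f ε = a ℕ.^ reducedExp p l ε ℕ.∸ 1
  f₀ : ∀ ε → f (0F ∷ ε) ≡ a₀ ℕ.^ reducedExp p′ l′ ε ℕ.∸ 1
  f₀ ε = cong (ℕ._∸ 1) (sym (ℕ.^-*-assoc a (p₀ ℕ.^ l₀) (reducedExp p′ l′ ε)))
  f₁ : ∀ ε → f (1F ∷ ε) ≡ a₁ ℕ.^ reducedExp p′ l′ ε ℕ.∸ 1
  f₁ ε = cong (ℕ._∸ 1) (sym (ℕ.^-*-assoc a (p₀ ℕ.^ (l₀ ℕ.∸ 1)) (reducedExp p′ l′ ε)))
  IH₀ = cubeProduct≡ p′ l′ (1≤l ∘ Fin.suc) a₀
  IH₁ = cubeProduct≡ p′ l′ (1≤l ∘ Fin.suc) a₁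
  x₁ : a₁ ℕ.^ R′ ≡ a ℕ.^ radCofactor p l
  x₁ = ℕ.^-*-assoc a (p₀ ℕ.^ (l₀ ℕ.∸ 1)) R′
  x₀ : a₀ ℕ.^ R′ ≡ (a ℕ.^ radCofactor p l) ℕ.^ p₀
  x₀ = begin
    a₀ ℕ.^ R′                                          ≡⟨ ℕ.^-*-assoc a (p₀ ℕ.^ l₀) R′ ⟩
    a ℕ.^ (p₀ ℕ.^ l₀ ℕ.* R′)                           ≡⟨ cong (λ t → a ℕ.^ (p₀ ℕ.^ t ℕ.* R′)) (sym (ℕ.m+[n∸m]≡n (1≤l Fin.zero))) ⟩
    a ℕ.^ (p₀ ℕ.* p₀ ℕ.^ (l₀ ℕ.∸ 1) ℕ.* R′)            ≡⟨ cong (a ℕ.^_) (trans (ℕ.*-assoc p₀ (p₀ ℕ.^ (l₀ ℕ.∸ 1)) R′) (ℕ.*-comm p₀ _)) ⟩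
    a ℕ.^ (p₀ ℕ.^ (l₀ ℕ.∸ 1) ℕ.* R′ ℕ.* p₀)            ≡⟨ sym (ℕ.^-*-assoc a (p₀ ℕ.^ (l₀ ℕ.∸ 1) ℕ.* R′) p₀) ⟩
    (a ℕ.^ radCofactor p l) ℕ.^ p₀                     ∎

n≡radCofactor*rad : ∀ {k} (p l : Fin k → ℕ) → (∀ i → 1 ℕ.≤ l i) →
                    product (tabulate (λ i → p i ℕ.^ l i)) ≡ radCofactor p l ℕ.* product (tabulate p)
n≡radCofactor*rad {zero}  p l 1≤l = refl
n≡radCofactor*rad {suc k} p l 1≤l = begin
  p₀ ℕ.^ l₀ ℕ.* product (tabulate (λ i → p (Fin.suc i) ℕ.^ l (Fin.suc i)))
    ≡⟨ cong₂ (λ s t → p₀ ℕ.^ s ℕ.* t) (sym (ℕ.m+[n∸m]≡n (1≤l Fin.zero))) (n≡radCofactor*rad (p ∘ Fin.suc) (l ∘ Fin.suc) (1≤l ∘ Fin.suc)) ⟩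
  p₀ ℕ.* q ℕ.* (R ℕ.* P)
    ≡⟨ solve 4 (λ p q r s → p :* q :* (r :* s) := q :* r :* (p :* s)) refl p₀ q R P ⟩
  q ℕ.* R ℕ.* (p₀ ℕ.* P) ∎
  where
  open ≡-Reasoning
  open +-*-Solver
  p₀ = p Fin.zero
  l₀ = l Fin.zero
  q = p₀ ℕ.^ (l₀ ℕ.∸ 1)
  R = radCofactor (p ∘ Fin.suc) (l ∘ Fin.suc)
  P = product (tabulate (p ∘ Fin.suc))

-- Primes in dyadic intervals

-- Stated for every accessibility proof, because `⌊log2⌋` recurses on it.
⌊log2⌋-bounds : ∀ n (rs : Acc ℕ._<_ (suc n)) →
                2 ℕ.^ ⌊log2⌋ (suc n) rs ℕ.≤ suc n × suc n ℕ.< 2 ℕ.^ suc (⌊log2⌋ (suc n) rs)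
⌊log2⌋-bounds zero    _        = ℕ.≤-refl , ℕ.≤-refl
⌊log2⌋-bounds (suc n) (acc rs) with ⌊log2⌋-bounds ⌊ n /2⌋ (rs (ℕ.⌊n/2⌋<n (suc n)))
... | lo , hi = ℕ.≤-trans (ℕ.*-monoʳ-≤ 2 lo) (ℕ.≤-trans (ℕ.≤-reflexive (ℕ.*-suc 2 ⌊ n /2⌋)) (s≤s (s≤s below)))
              , ℕ.≤-trans (s≤s (s≤s (s≤s above))) (ℕ.≤-trans (ℕ.≤-reflexive (sym eq)) (ℕ.*-monoʳ-≤ 2 hi))
  where
  h = ⌊ n /2⌋
  eq : 2 ℕ.* suc (suc h) ≡ suc (suc (suc (suc (2 ℕ.* h))))
  eq = trans (ℕ.*-suc 2 (suc h)) (cong (2 ℕ.+_) (ℕ.*-suc 2 h))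
  below : 2 ℕ.* h ℕ.≤ n
  below = ℕ.≤-trans (ℕ.+-monoʳ-≤ h (ℕ.≤-trans (ℕ.≤-reflexive (ℕ.+-identityʳ h)) (ℕ.⌊n/2⌋≤⌈n/2⌉ n)))
    (ℕ.≤-reflexive (ℕ.⌊n/2⌋+⌈n/2⌉≡n n))
  ⌈n/2⌉≤ : ∀ n → ⌈ n /2⌉ ℕ.≤ suc ⌊ n /2⌋
  ⌈n/2⌉≤ zero          = z≤n
  ⌈n/2⌉≤ (suc zero)    = s≤s z≤n
  ⌈n/2⌉≤ (suc (suc n)) = s≤s (⌈n/2⌉≤ n)
  above : n ℕ.≤ suc (2 ℕ.* h)
  above = ℕ.≤-trans (ℕ.≤-reflexive (sym (ℕ.⌊n/2⌋+⌈n/2⌉≡n n))) (ℕ.≤-trans (ℕ.+-monoʳ-≤ h (⌈n/2⌉≤ n))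
    (ℕ.≤-reflexive (trans (ℕ.+-suc h h) (cong (λ t → suc (h ℕ.+ t)) (sym (ℕ.+-identityʳ h))))))

2^⌊log₂n⌋≤n : ∀ n → 1 ℕ.≤ n → 2 ℕ.^ ⌊log₂ n ⌋ ℕ.≤ n
2^⌊log₂n⌋≤n (suc n) _ = proj₁ (⌊log2⌋-bounds n (<-wellFounded (suc n)))

n<2^[1+⌊log₂n⌋] : ∀ n → 1 ℕ.≤ n → n ℕ.< 2 ℕ.^ suc ⌊log₂ n ⌋
n<2^[1+⌊log₂n⌋] (suc n) _ = proj₂ (⌊log2⌋-bounds n (<-wellFounded (suc n)))

2^-cancel-≤ : ∀ m n → 2 ℕ.^ m ℕ.≤ 2 ℕ.^ n → m ℕ.≤ n
2^-cancel-≤ m n 2^m≤2^n = ℕ.≮⇒≥ λ n<m → ℕ.<⇒≱ (ℕ.^-monoʳ-< 2 (s≤s (s≤s z≤n)) n<m) 2^m≤2^n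

prime≥2 : ∀ {p} → Prime p → 2 ℕ.≤ p
prime≥2 {p} pp = ℕ.nonTrivial⇒n>1 p {{prime⇒nonTrivial pp}}

prime∣prime⇒≡ : ∀ {p q} → Prime p → Prime q → p ∣ q → p ≡ q
prime∣prime⇒≡ pp pq p∣q with prime⇒irreducible pq p∣q
... | inj₁ refl = contradiction pp ¬prime[1]
... | inj₂ p≡q  = p≡q

prime∣!⇒≤ : ∀ {p} → Prime p → ∀ n → p ∣ n ! → p ℕ.≤ n
prime∣!⇒≤ pp zero    p∣1 = contradiction (subst Prime (∣1⇒≡1 p∣1) pp) ¬prime[1]
prime∣!⇒≤ pp (suc n) p∣n! = [ ∣⇒≤ , (λ h → ℕ.m≤n⇒m≤1+n (prime∣!⇒≤ pp n h)) ]′ (euclidsLemma (suc n) (n !) pp p∣n!)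

p∣p! : ∀ p → 1 ℕ.≤ p → p ∣ p !
p∣p! (suc p) _ = m∣m*n (p !)

central-factorials : ∀ N → ((N ℕ.+ N) C N) ℕ.* (N ! ℕ.* (N ℕ.+ N ℕ.∸ N) !) ≡ (N ℕ.+ N) !
central-factorials N = trans (cong (ℕ._* (N ! ℕ.* (N ℕ.+ N ℕ.∸ N) !)) (nCk≡n!/k![n-k]! (ℕ.m≤m+n N N)))
  (m/n*n≡m (k![n∸k]!∣n! (ℕ.m≤m+n N N)))
  where
  instance
    _ = ℕ.m*n≢0 (N !) ((N ℕ.+ N ℕ.∸ N) !) {{ℕ._!≢0 N}} {{ℕ._!≢0 (N ℕ.+ N ℕ.∸ N)}}

-- The prime p divides (2N)! but not N!, so it must divide the remaining factor of (2N)! = C(2N, N)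
-- N! N!.
prime∣central : ∀ {p} → Prime p → ∀ N → N ℕ.< p → p ℕ.≤ N ℕ.+ N → p ∣ (N ℕ.+ N) C N
prime∣central {p} pp N N<p p≤2N = [ (λ h → h) , (λ h → contradiction h p∤) ]′
  (euclidsLemma ((N ℕ.+ N) C N) (N ! ℕ.* (N ℕ.+ N ℕ.∸ N) !) pp (subst (p ∣_) (sym (central-factorials N)) p∣[2N]!))
  where
  p∣[2N]! : p ∣ (N ℕ.+ N) !
  p∣[2N]! = ∣-trans (p∣p! p (ℕ.≤-trans (s≤s z≤n) N<p)) (m≤n⇒m!∣n! p≤2N)
  p∤N! : ¬ p ∣ N !
  p∤N! h = ℕ.<⇒≱ N<p (prime∣!⇒≤ pp N h)
  p∤ : ¬ p ∣ N ! ℕ.* (N ℕ.+ N ℕ.∸ N) !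
  p∤ h = [ p∤N! , (λ h′ → p∤N! (subst (λ t → p ∣ t !) (ℕ.m+n∸n≡m N N) h′)) ]′ (euclidsLemma (N !) _ pp h)

nCk≤2^n : ∀ n k → n C k ℕ.≤ 2 ℕ.^ n
nCk≤2^n zero    zero    = ℕ.≤-refl
nCk≤2^n zero    (suc k) = z≤n
nCk≤2^n (suc n) zero    = ℕ.m^n>0 2 (suc n)
nCk≤2^n (suc n) (suc k) = subst₂ ℕ._≤_ (nCk+nC[k+1]≡[n+1]C[k+1] n k) (sym (2^suc n))
  (ℕ.+-mono-≤ (nCk≤2^n n k) (nCk≤2^n n (suc k)))

product-primes∣ : ∀ {ps} → Unique ps → All Prime ps → ∀ m → All (_∣ m) ps → product ps ∣ m
product-primes∣ []          []         m []  = 1∣ m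
product-primes∣ {p ∷ ps} (p∉ps ∷ ups) (pp ∷ pps) _ (divides m refl ∷ hs) =
  subst (p ℕ.* product ps ∣_) (ℕ.*-comm p m) (*-monoʳ-∣ p (product-primes∣ ups pps m (All.tabulate λ q∈ps →
    [ (λ h → h) , (λ q∣p → contradiction (sym (prime∣prime⇒≡ (All.lookup pps q∈ps) pp q∣p)) (All.lookup p∉ps q∈ps)) ]′
      (euclidsLemma m p (All.lookup pps q∈ps) (All.lookup hs q∈ps)))))

m^length≤product : ∀ m {qs} → All (m ℕ.≤_) qs → m ℕ.^ List.length qs ℕ.≤ product qs
m^length≤product m []       = ℕ.≤-refl
m^length≤product m (h ∷ hs) = ℕ.*-mono-≤ h (m^length≤product m hs)

-- Chebyshev's argument: the primes in (N, 2N] all divide the central binomial coefficient.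
dyadic-primes : ∀ i {qs} → Unique qs → All Prime qs → All (λ q → 2 ℕ.^ i ℕ.< q × q ℕ.≤ 2 ℕ.^ suc i) qs →
                i ℕ.* List.length qs ℕ.≤ 2 ℕ.^ suc i
dyadic-primes i {qs} uqs pqs hs = 2^-cancel-≤ _ _ (begin
  2 ℕ.^ (i ℕ.* List.length qs)       ≡⟨ sym (ℕ.^-*-assoc 2 i (List.length qs)) ⟩
  (2 ℕ.^ i) ℕ.^ List.length qs       ≤⟨ m^length≤product (2 ℕ.^ i) (All.map (λ h → ℕ.<⇒≤ (proj₁ h)) hs) ⟩
  product qs                         ≤⟨ ∣⇒≤ {{C≢0}} (product-primes∣ uqs pqs _ (All.tabulate λ {q} q∈qs → prime∣central (All.lookup pqs q∈qs) N
                                          (proj₁ (All.lookup hs q∈qs)) (subst (q ℕ.≤_) (2^suc i) (proj₂ (All.lookup hs q∈qs))))) ⟩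
  (N ℕ.+ N) C N                      ≤⟨ nCk≤2^n (N ℕ.+ N) N ⟩
  2 ℕ.^ (N ℕ.+ N)                    ≡⟨ cong (2 ℕ.^_) (sym (2^suc i)) ⟩
  2 ℕ.^ (2 ℕ.^ suc i)                ∎)
  where
  open ℕ.≤-Reasoning
  N = 2 ℕ.^ i
  C≢0 : ℕ.NonZero ((N ℕ.+ N) C N)
  C≢0 = ℕ.≢-nonZero λ C≡0 → ℕ.≢-nonZero⁻¹ ((N ℕ.+ N) !) {{ℕ._!≢0 (N ℕ.+ N)}}
    (trans (sym (central-factorials N)) (cong (ℕ._* (N ! ℕ.* (N ℕ.+ N ℕ.∸ N) !)) C≡0))

-- The index of the dyadic interval (2ⁱ, 2ⁱ⁺¹] containing p ≥ 2, and the
-- resulting integer upper bound for log₂ p.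
dyadic : ℕ → ℕ
dyadic p = ⌊log₂ (p ℕ.∸ 1) ⌋

size : ℕ → ℕ
size p = suc (dyadic p)

2^dyadic<p : ∀ p → 2 ℕ.≤ p → 2 ℕ.^ dyadic p ℕ.< p
2^dyadic<p (suc p) (s≤s 1≤p) = s≤s (2^⌊log₂n⌋≤n p 1≤p)

p≤2^size : ∀ p → 2 ℕ.≤ p → p ℕ.≤ 2 ℕ.^ size p
p≤2^size (suc p) (s≤s 1≤p) = n<2^[1+⌊log₂n⌋] p 1≤p

-- As p ≥ 2, the factor 2 lost by rounding log₂ p up is at most p: 2^`size p` = 2 · 2^`dyadic p` ≤
-- p².
2^sum-size≤ : ∀ {ps} → All (2 ℕ.≤_) ps → 2 ℕ.^ sum (List.map size ps) ℕ.≤ product ps ℕ.* product ps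
2^sum-size≤ []                 = ℕ.≤-refl
2^sum-size≤ {p ∷ ps} (2≤p ∷ hs) = begin
  2 ℕ.^ (size p ℕ.+ s)                     ≡⟨ ℕ.^-distribˡ-+-* 2 (size p) s ⟩
  2 ℕ.^ size p ℕ.* 2 ℕ.^ s                 ≤⟨ ℕ.*-mono-≤ (ℕ.*-mono-≤ 2≤p (ℕ.<⇒≤ (2^dyadic<p p 2≤p))) (2^sum-size≤ hs) ⟩
  p ℕ.* p ℕ.* (product ps ℕ.* product ps)  ≡⟨ ℕ.[m*n]*[o*p]≡[m*o]*[n*p] p p (product ps) (product ps) ⟩
  product (p ∷ ps) ℕ.* product (p ∷ ps)    ∎
  where
  open ℕ.≤-Reasoning
  s = sum (List.map size ps)

sum-size≤ : ∀ {ps} → All (2 ℕ.≤_) ps → ∀ m → product ps ℕ.≤ 2 ℕ.^ m → sum (List.map size ps) ℕ.≤ m ℕ.+ m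
sum-size≤ {ps} 2≤ps m P≤2^m = 2^-cancel-≤ _ _ (ℕ.≤-trans (2^sum-size≤ 2≤ps)
  (ℕ.≤-trans (ℕ.*-mono-≤ P≤2^m P≤2^m) (ℕ.≤-reflexive (sym (ℕ.^-distribˡ-+-* 2 m m)))))

-- The lower bound for φ(n)

sumL-map : ∀ {A B : Set} (f : B → ℚ) (g : A → B) xs → sumL f (List.map g xs) ≡ sumL (f ∘ g) xs
sumL-map f g []       = refl
sumL-map f g (x ∷ xs) = cong (λ t → f (g x) + t) (sumL-map f g xs)

sumL-const : ∀ {A : Set} c (xs : List A) → sumL (λ _ → c) xs ≡ ι (List.length xs) * c
sumL-const c []       = sym (*-zeroˡ c)
sumL-const c (x ∷ xs) = trans (cong (λ t → c + t) (sumL-const c xs))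
  (trans (eq c (ι (List.length xs))) (cong (_* c) (sym (ι-suc (List.length xs)))))
  where
  eq : ∀ c n → c + n * c ≡ (1ℚ + n) * c
  eq = solve-∀ ℚ-ring

sumL-filter-⊎ : ∀ {A : Set} {f : A → ℚ} → (∀ x → 0ℚ ≤ f x) →
                ∀ {P Q R : Pred A 0ℓ} (P? : Decidable P) (Q? : Decidable Q) (R? : Decidable R) →
                (∀ {x} → P x → Q x ⊎ R x) → ∀ {xs} → Unique xs →
                sumL f (filter P? xs) ≤ sumL f (filter Q? xs) + sumL f (filter R? xs)
sumL-filter-⊎ {f = f} 0≤f P? Q? R? P⊆Q⊎R {xs} uxs = subst (sumL f (filter P? xs) ≤_) (sumL-++ f (filter Q? xs) (filter R? xs))
  (sumL-⊆ 0≤f (filter Q? xs ++ filter R? xs) (Unique.filter⁺ P? uxs) split)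
  where
  split : ∀ {x} → x ∈ filter P? xs → x ∈ filter Q? xs ++ filter R? xs
  split x∈ with ∈-filter⁻ P? {xs = xs} x∈
  ... | x∈xs , Px with P⊆Q⊎R Px
  ...   | inj₁ Qx = ∈-++⁺ˡ (∈-filter⁺ Q? x∈xs Qx)
  ...   | inj₂ Rx = ∈-++⁺ʳ (filter Q? xs) (∈-filter⁺ R? x∈xs Rx)

-- The majorant `h` is summed over all of `xs` rather than over the complement of `P`, since its sum
-- over a full list is what the applications can estimate.
sumL≤filter+ : ∀ {A : Set} {f h : A → ℚ} {P : Pred A 0ℓ} (P? : Decidable P) → (∀ x → 0ℚ ≤ h x) →
               ∀ {xs} → All (λ x → ¬ P x → f x ≤ h x) xs → sumL f xs ≤ sumL f (filter P? xs) + sumL h xs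
sumL≤filter+ P? 0≤h [] = ≤-refl
sumL≤filter+ {f = f} {h} P? 0≤h {x ∷ xs} (fx≤hx ∷ hs) with P? x | sumL≤filter+ P? 0≤h hs
... | yes _  | ih = ≤-trans (+-monoʳ-≤ (f x) (≤-trans ih (+-monoʳ-≤ (sumL f (filter P? xs)) (subst (_≤ h x + sumL h xs) (+-identityˡ _) (+-monoˡ-≤ (sumL h xs) (0≤h x))))))
    (≤-reflexive (sym (+-assoc (f x) (sumL f (filter P? xs)) (h x + sumL h xs))))
... | no ¬Px | ih = ≤-trans (+-mono-≤ (fx≤hx ¬Px) ih) (≤-reflexive (eq (h x) (sumL f (filter P? xs)) (sumL h xs)))
  where
  eq : ∀ a b c → a + (b + c) ≡ b + (a + c)
  eq = solve-∀ ℚ-ring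

-- The default value 0 at 0 makes nonnegativity, multiplicativity and the bound by 1 hold for every
-- n.
rec : ℕ → ℚ
rec n = recip (ι n)

0≤rec : ∀ n → 0ℚ ≤ rec n
0≤rec zero    = ≤-refl
0≤rec (suc n) = 0≤recipι n

ι*rec : ∀ n → 1 ℕ.≤ n → ι n * rec n ≡ 1ℚ
ι*rec n 1≤n = recip-inverse (0<ι n 1≤n)

rec-anti : ∀ {m n} → 1 ℕ.≤ m → m ℕ.≤ n → rec n ≤ rec m
rec-anti {m} {n} 1≤m m≤n = recip-anti (0<ι m 1≤m) (ι-mono m≤n)

rec-* : ∀ m n → rec (m ℕ.* n) ≡ rec m * rec n
rec-* zero    n    = sym (*-zeroˡ (rec n))
rec-* (suc m) zero = trans (cong rec (ℕ.*-zeroʳ m)) (sym (*-zeroʳ (rec (suc m))))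
rec-* (suc m) (suc n) = sym (recip-unique {rec (suc m) * rec (suc n)} {ι (suc m ℕ.* suc n)} (0<ι-suc (n ℕ.+ m ℕ.* suc n)) (begin
  rec (suc m) * rec (suc n) * ι (suc m ℕ.* suc n)            ≡⟨ cong (rec (suc m) * rec (suc n) *_) (ι-* (suc m) (suc n)) ⟩
  rec (suc m) * rec (suc n) * (ι (suc m) * ι (suc n))        ≡⟨ eq (rec (suc m)) (rec (suc n)) (ι (suc m)) (ι (suc n)) ⟩
  (ι (suc m) * rec (suc m)) * (ι (suc n) * rec (suc n))      ≡⟨ cong₂ _*_ (ι*rec (suc m) (s≤s z≤n)) (ι*rec (suc n) (s≤s z≤n)) ⟩
  1ℚ                                                         ∎))
  where
  open ≡-Reasoning
  eq : ∀ a b c d → a * b * (c * d) ≡ (c * a) * (d * b)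
  eq = solve-∀ ℚ-ring

logWeight : ℕ → ℚ
logWeight p = ι (size p) * rec p

0≤logWeight : ∀ p → 0ℚ ≤ logWeight p
0≤logWeight p = 0≤* (0≤ι (size p)) (0≤rec p)

dyadic? : ∀ i → Decidable (λ p → dyadic p ≡ i)
dyadic? i p = dyadic p ℕ.≟ i

below? : ∀ I → Decidable (λ p → dyadic p ℕ.< I)
below? I p = dyadic p ℕ.<? I

-- For i ≥ 1 each term is at most (i + 1) / 2ⁱ, there are at most 2^(i+1) / i primes, and i + 1 ≤ 2
-- i; together this gives 4. For i = 0 the Chebyshev bound is empty, but 2 is the only candidate.
logWeight-class : ∀ i {qs} → Unique qs → All Prime qs → All (λ q → dyadic q ≡ i) qs → sumL logWeight qs ≤ ι 4
logWeight-class zero {qs} uqs pqs d≡0 = ≤-trans (sumL-⊆ 0≤logWeight (2 ∷ []) uqs is-2) (from-yes (sumL logWeight (2 ∷ []) ≤? ι 4))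
  where
  is-2 : ∀ {q} → q ∈ qs → q ∈ 2 ∷ []
  is-2 {q} q∈qs = here (ℕ.≤-antisym (subst (λ t → q ℕ.≤ 2 ℕ.^ suc t) (All.lookup d≡0 q∈qs) (p≤2^size q 2≤q)) 2≤q)
    where 2≤q = prime≥2 (All.lookup pqs q∈qs)
logWeight-class (suc j) {qs} uqs pqs d≡i = begin
  sumL logWeight qs                   ≤⟨ sumL-≤ (All.tabulate term) ⟩
  sumL (λ _ → c) qs                   ≡⟨ sumL-const c qs ⟩
  ι k * (ι (suc i) * rec N)           ≡⟨ sym (*-assoc (ι k) (ι (suc i)) (rec N)) ⟩
  ι k * ι (suc i) * rec N             ≤⟨ p*recip≤q (0<ι N (1≤2^ i)) (subst₂ _≤_ (ι-* k (suc i)) (ι-* 4 N) (ι-mono count)) ⟩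
  ι 4                                 ∎
  where
  open ≤-Reasoning
  i = suc j
  N = 2 ℕ.^ i
  k = List.length qs
  c = ι (suc i) * rec N
  2^i<q : ∀ {q} → q ∈ qs → N ℕ.< q
  2^i<q {q} q∈qs = subst (λ t → 2 ℕ.^ t ℕ.< q) (All.lookup d≡i q∈qs) (2^dyadic<p q (prime≥2 (All.lookup pqs q∈qs)))
  q≤2^ : ∀ {q} → q ∈ qs → q ℕ.≤ 2 ℕ.^ suc i
  q≤2^ {q} q∈qs = subst (λ t → q ℕ.≤ 2 ℕ.^ suc t) (All.lookup d≡i q∈qs) (p≤2^size q (prime≥2 (All.lookup pqs q∈qs)))
  term : ∀ {q} → q ∈ qs → logWeight q ≤ c
  term {q} q∈qs = subst (λ t → ι (suc t) * rec q ≤ c) (sym (All.lookup d≡i q∈qs))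
    (*-monoˡ (ι (suc i)) (0≤ι (suc i)) (rec-anti (1≤2^ i) (ℕ.<⇒≤ (2^i<q q∈qs))))
  count : k ℕ.* suc i ℕ.≤ 4 ℕ.* N
  count = ℕ.≤-trans (ℕ.*-monoʳ-≤ k (ℕ.+-monoˡ-≤ i (s≤s (z≤n {j})))) (ℕ.≤-trans
    (ℕ.≤-reflexive (solve 2 (λ k i → k :* (i :+ i) := con 2 :* (i :* k)) refl k i))
    (ℕ.≤-trans (ℕ.*-monoʳ-≤ 2 (dyadic-primes i uqs pqs (All.tabulate λ q∈qs → 2^i<q q∈qs , q≤2^ q∈qs)))
      (ℕ.≤-reflexive (sym (ℕ.*-assoc 2 2 N)))))
    where open +-*-Solver

logWeight-below : ∀ {ps} → Unique ps → All Prime ps → ∀ I → sumL logWeight (filter (below? I) ps) ≤ ι (4 ℕ.* I)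
logWeight-below {ps} ups pps zero = ≤-reflexive (cong (sumL logWeight) (filter-none (below? 0) (All.universal (λ _ ()) ps)))
logWeight-below {ps} ups pps (suc I) = begin
  sumL logWeight (filter (below? (suc I)) ps)
    ≤⟨ sumL-filter-⊎ 0≤logWeight (below? (suc I)) (below? I) (dyadic? I) (λ { (s≤s d≤I) → ℕ.m≤n⇒m<n∨m≡n d≤I }) ups ⟩
  sumL logWeight (filter (below? I) ps) + sumL logWeight (filter (dyadic? I) ps)
    ≤⟨ +-mono-≤ (logWeight-below ups pps I) (logWeight-class I (Unique.filter⁺ (dyadic? I) ups) (All.filter⁺ (dyadic? I) pps) (All.all-filter (dyadic? I) ps)) ⟩
  ι (4 ℕ.* I) + ι 4
    ≡⟨ trans (sym (ι-+ (4 ℕ.* I) 4)) (cong ι (trans (ℕ.+-comm (4 ℕ.* I) 4) (sym (ℕ.*-suc 4 I)))) ⟩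
  ι (4 ℕ.* suc I) ∎
  where open ≤-Reasoning

sumL-size : ∀ c ps → sumL (λ p → ι (size p) * c) ps ≡ ι (sum (List.map size ps)) * c
sumL-size c []       = sym (*-zeroˡ c)
sumL-size c (p ∷ ps) = trans (cong (λ t → ι (size p) * c + t) (sumL-size c ps))
  (trans (sym (*-distribʳ-+ c (ι (size p)) (ι s))) (cong (_* c) (sym (ι-+ (size p) s))))
  where s = sum (List.map size ps)

logWeight-sum : ∀ {ps} → Unique ps → All Prime ps → ∀ I → product ps ℕ.≤ 2 ℕ.^ (2 ℕ.^ I) →
                sumL logWeight ps ≤ ι (4 ℕ.* I ℕ.+ 2)
logWeight-sum {ps} ups pps I P≤ = begin
  sumL logWeight ps
    ≤⟨ sumL≤filter+ (below? I) (λ p → 0≤* (0≤ι (size p)) (0≤rec N)) (All.map large pps) ⟩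
  sumL logWeight (filter (below? I) ps) + sumL (λ p → ι (size p) * rec N) ps
    ≤⟨ +-mono-≤ (logWeight-below ups pps I) tail ⟩
  ι (4 ℕ.* I) + ι 2
    ≡⟨ sym (ι-+ (4 ℕ.* I) 2) ⟩
  ι (4 ℕ.* I ℕ.+ 2) ∎
  where
  open ≤-Reasoning
  N = 2 ℕ.^ I
  large : ∀ {p} → Prime p → ¬ dyadic p ℕ.< I → logWeight p ≤ ι (size p) * rec N
  large {p} pp d≮I = *-monoˡ (ι (size p)) (0≤ι (size p)) (rec-anti (1≤2^ I)
    (ℕ.≤-trans (ℕ.^-monoʳ-≤ 2 (ℕ.≮⇒≥ d≮I)) (ℕ.<⇒≤ (2^dyadic<p p (prime≥2 pp)))))
  tail : sumL (λ p → ι (size p) * rec N) ps ≤ ι 2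
  tail = begin
    sumL (λ p → ι (size p) * rec N) ps        ≡⟨ sumL-size (rec N) ps ⟩
    ι (sum (List.map size ps)) * rec N        ≤⟨ p*recip≤q (0<ι N (1≤2^ I)) (≤-trans
                                                   (ι-mono (sum-size≤ (All.map prime≥2 pps) N P≤))
                                                   (≤-reflexive (trans (cong ι (cong (N ℕ.+_) (sym (ℕ.+-identityʳ N)))) (ι-* 2 N)))) ⟩
    ι 2                                       ∎

extend : ℕ → ℕ × ℕ → ℕ × ℕ
extend p (d , s) = p ℕ.* d , size p ℕ.+ s

-- The products d of the subsets of ps, each with the sum s of the sizes of the
-- elements, so that d ≤ 2ˢ.
subsetProducts : List ℕ → List (ℕ × ℕ)
subsetProducts []       = (1 , 0) ∷ []
subsetProducts (p ∷ ps) = subsetProducts ps ++ List.map (extend p) (subsetProducts ps)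

recOf weightOf : ℕ × ℕ → ℚ
recOf    (d , s) = rec d
weightOf (d , s) = ι s * rec d

invSum : List ℕ → ℚ
invSum ps = prodL (λ p → 1ℚ + rec p) ps

0≤invSum : ∀ ps → 0ℚ ≤ invSum ps
0≤invSum ps = 0≤prodL (All.universal (λ p → 0≤+ 0≤1 (0≤rec p)) ps)

sumL-cong : ∀ {A : Set} {f g : A → ℚ} → (∀ x → f x ≡ g x) → ∀ xs → sumL f xs ≡ sumL g xs
sumL-cong f≗g []       = refl
sumL-cong f≗g (x ∷ xs) = cong₂ _+_ (f≗g x) (sumL-cong f≗g xs)

sumL-recOf : ∀ ps → sumL recOf (subsetProducts ps) ≡ invSum ps
sumL-recOf []       = refl
sumL-recOf (p ∷ ps) = begin
  sumL recOf (D ++ List.map (extend p) D)            ≡⟨ sumL-++ recOf D (List.map (extend p) D) ⟩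
  sumL recOf D + sumL recOf (List.map (extend p) D)  ≡⟨ cong (λ t → sumL recOf D + t) (trans (sumL-map recOf (extend p) D)
                                                          (trans (sumL-cong (λ x → rec-* p (proj₁ x)) D) (sumL-* (rec p) recOf D))) ⟩
  sumL recOf D + rec p * sumL recOf D                ≡⟨ eq (rec p) (sumL recOf D) ⟩
  (1ℚ + rec p) * sumL recOf D                        ≡⟨ cong ((1ℚ + rec p) *_) (sumL-recOf ps) ⟩
  (1ℚ + rec p) * invSum ps                           ∎
  where
  open ≡-Reasoning
  D = subsetProducts ps
  eq : ∀ a b → b + a * b ≡ (1ℚ + a) * b
  eq = solve-∀ ℚ-ring

-- Sizes add over a subset, and the subsets containing p carry the share 1/(p + 1) ≤ 1/p of the
-- whole sum `invSum ps`. The added term l r² S makes up the difference between the two shares.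
sumL-weightOf : ∀ ps → sumL weightOf (subsetProducts ps) ≤ sumL logWeight ps * invSum ps
sumL-weightOf []       = ≤-reflexive (sym (*-zeroˡ (invSum [])))
sumL-weightOf (p ∷ ps) = begin
  sumL weightOf (D ++ List.map (extend p) D)                ≡⟨ sumL-++ weightOf D (List.map (extend p) D) ⟩
  W + sumL weightOf (List.map (extend p) D)                 ≡⟨ cong (λ t → W + t) (trans (sumL-map weightOf (extend p) D) (trans (sumL-cong expand D)
                                                                 (trans (sumL-+ (λ x → r * weightOf x) (λ x → r * l * recOf x) D)
                                                                   (cong₂ _+_ (sumL-* r weightOf D) (sumL-* (r * l) recOf D))))) ⟩
  W + (r * W + r * l * sumL recOf D)                        ≡⟨ cong (λ t → W + (r * W + r * l * t)) (sumL-recOf ps) ⟩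
  W + (r * W + r * l * S)                                   ≡⟨ eq₁ W r l S ⟩
  (1ℚ + r) * W + r * l * S                                  ≤⟨ +-monoˡ-≤ (r * l * S) (*-monoˡ (1ℚ + r) (0≤+ 0≤1 (0≤rec p)) (sumL-weightOf ps)) ⟩
  (1ℚ + r) * (M * S) + r * l * S                            ≤⟨ p≤p+q (0≤* (0≤* (0≤* (0≤ι (size p)) (0≤rec p)) (0≤rec p)) (0≤invSum ps)) ⟩
  (1ℚ + r) * (M * S) + r * l * S + l * r * r * S            ≡⟨ eq₂ r l M S ⟩
  (l * r + M) * ((1ℚ + r) * S)                              ∎
  where
  open ≤-Reasoning
  D = subsetProducts ps
  W = sumL weightOf D
  S = invSum ps
  M = sumL logWeight ps
  r = rec p
  l = ι (size p)
  eq₀ : ∀ l s r q → (l + s) * (r * q) ≡ r * (s * q) + r * l * q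
  eq₀ = solve-∀ ℚ-ring
  expand : ∀ x → weightOf (extend p x) ≡ r * weightOf x + r * l * recOf x
  expand (d , s) = trans (cong₂ _*_ (ι-+ (size p) s) (rec-* p d)) (eq₀ l (ι s) r (rec d))
  eq₁ : ∀ w r l s → w + (r * w + r * l * s) ≡ (1ℚ + r) * w + r * l * s
  eq₁ = solve-∀ ℚ-ring
  eq₂ : ∀ r l m s → (1ℚ + r) * (m * s) + r * l * s + l * r * r * s ≡ (l * r + m) * ((1ℚ + r) * s)
  eq₂ = solve-∀ ℚ-ring

subsetProducts-range : ∀ {ps} → All Prime ps → All (λ { (d , s) → 1 ℕ.≤ d × d ℕ.≤ 2 ℕ.^ s }) (subsetProducts ps)
subsetProducts-range []         = (ℕ.≤-refl , ℕ.≤-refl) ∷ []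
subsetProducts-range {p ∷ ps} (pp ∷ pps) = All.++⁺ ih (All.map⁺ (All.map step ih))
  where
  ih = subsetProducts-range pps
  2≤p = prime≥2 pp
  step : ∀ {x} → 1 ℕ.≤ proj₁ x × proj₁ x ℕ.≤ 2 ℕ.^ proj₂ x →
         1 ℕ.≤ proj₁ (extend p x) × proj₁ (extend p x) ℕ.≤ 2 ℕ.^ proj₂ (extend p x)
  step {d , s} (1≤d , d≤2^s) = ℕ.*-mono-≤ (ℕ.≤-trans (s≤s z≤n) 2≤p) 1≤d
    , ℕ.≤-trans (ℕ.*-mono-≤ (p≤2^size p 2≤p) d≤2^s) (ℕ.≤-reflexive (sym (ℕ.^-distribˡ-+-* 2 (size p) s)))

∤subsetProducts : ∀ {q ps} → Prime q → All Prime ps → All (q ≢_) ps → All (λ x → ¬ q ∣ proj₁ x) (subsetProducts ps)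
∤subsetProducts pq [] [] = (λ q∣1 → ¬prime[1] (subst Prime (∣1⇒≡1 q∣1) pq)) ∷ []
∤subsetProducts {q} {p ∷ ps} pq (pp ∷ pps) (q≢p ∷ q∉ps) = All.++⁺ ih (All.map⁺ (All.map (λ {x} → step {x}) ih))
  where
  ih = ∤subsetProducts pq pps q∉ps
  step : ∀ {x : ℕ × ℕ} → ¬ q ∣ proj₁ x → ¬ q ∣ p ℕ.* proj₁ x
  step {d , _} q∤d q∣pd = [ (λ q∣p → q≢p (prime∣prime⇒≡ pq pp q∣p)) , q∤d ]′ (euclidsLemma p d pq q∣pd)

-- Products that use p are multiples of p, the others are not. Distinctness is what allows the
-- comparison of the small products with the harmonic sum.
subsetProducts-unique : ∀ {ps} → Unique ps → All Prime ps → Unique (List.map proj₁ (subsetProducts ps))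
subsetProducts-unique [] [] = [] ∷ []
subsetProducts-unique {p ∷ ps} (p∉ps ∷ ups) (pp ∷ pps) = subst Unique (sym split)
  (Unique.++⁺ ih (Unique.map⁺ (ℕ.*-cancelˡ-≡ _ _ p {{prime⇒nonZero pp}}) ih) disjoint)
  where
  D = subsetProducts ps
  ih = subsetProducts-unique ups pps
  split : List.map proj₁ (subsetProducts (p ∷ ps)) ≡ List.map proj₁ D ++ List.map (p ℕ.*_) (List.map proj₁ D)
  split = trans (map-++ proj₁ D (List.map (extend p) D)) (cong (List.map proj₁ D ++_) (trans (sym (map-∘ D)) (map-∘ D)))
  disjoint : ∀ {d} → d ∈ List.map proj₁ D × d ∈ List.map (p ℕ.*_) (List.map proj₁ D) → _
  disjoint (d∈D , d∈pD) with ∈-map⁻ (p ℕ.*_) d∈pD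
  ... | e , _ , refl = All.lookup (All.map⁺ (∤subsetProducts pp pps p∉ps)) d∈D (m∣m*n e)

small? : ∀ T → Decidable {A = ℕ × ℕ} (λ x → proj₂ x ℕ.≤ T)
small? T x = proj₂ x ℕ.≤? T

sumL-small : ∀ {ps} → Unique ps → All Prime ps → ∀ T → sumL recOf (filter (small? T) (subsetProducts ps)) ≤ ι (suc T)
sumL-small {ps} ups pps T = begin
  sumL recOf E                        ≡⟨ sym (sumL-map rec proj₁ E) ⟩
  sumL rec (List.map proj₁ E)         ≤⟨ sumL-unique 0≤rec 1 (2 ℕ.^ T) unique (All.map⁺ (All.tabulate range)) ⟩
  harmonic (2 ℕ.^ T)                  ≤⟨ harmonic-2^≤ T ⟩
  ι (suc T)                           ∎
  where
  open ≤-Reasoning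
  D = subsetProducts ps
  E = filter (small? T) D
  unique : Unique (List.map proj₁ E)
  unique = AllPairs.map⁺ (AllPairs.filter⁺ (small? T) (AllPairs.map⁻ (subsetProducts-unique ups pps)))
  range : ∀ {x} → x ∈ E → 1 ℕ.≤ proj₁ x × proj₁ x ℕ.< 1 ℕ.+ 2 ℕ.^ T
  range x∈E with ∈-filter⁻ (small? T) {xs = D} x∈E
  ... | x∈D , s≤T = proj₁ (All.lookup (subsetProducts-range pps) x∈D)
    , s≤s (ℕ.≤-trans (proj₂ (All.lookup (subsetProducts-range pps) x∈D)) (ℕ.^-monoʳ-≤ 2 s≤T))

-- The subsets of total size at most T contribute at most the harmonic sum up to
-- 2ᵀ, the others at most a fraction (Σ log p / p) / T ≤ ½ of the whole.
invSum-bound : ∀ {ps} → Unique ps → All Prime ps → ∀ T → 1 ℕ.≤ T → 2ℚ * sumL logWeight ps ≤ ι T →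
               invSum ps ≤ 2ℚ * ι (suc T)
invSum-bound {ps} ups pps T 1≤T 2M≤T = *-cancel-≤ t (0<ι T 1≤T) (≤-trans
  (≤-reflexive (eq₀ S t)) (≤-trans (+-monoˡ-≤ (- (t * S)) 2tS≤) (≤-reflexive (eq₁ 2ℚ t (ι (suc T)) (t * S)))))
  where
  open ≤-Reasoning
  D = subsetProducts ps
  S = invSum ps
  M = sumL logWeight ps
  t = ι T
  eq₀ : ∀ s t → s * t ≡ (1ℚ + 1ℚ) * (t * s) - t * s
  eq₀ = solve-∀ ℚ-ring
  eq₁ : ∀ c t u a → c * (t * u) + a - a ≡ c * u * t
  eq₁ = solve-∀ ℚ-ring
  eq₂ : ∀ c a m s → c * (a + m * s) ≡ c * a + c * m * s
  eq₂ = solve-∀ ℚ-ring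
  scale : ∀ xs → sumL (λ x → t * recOf x) xs ≡ t * sumL recOf xs
  scale = sumL-* t recOf
  large : ∀ x → ¬ proj₂ x ℕ.≤ T → t * recOf x ≤ weightOf x
  large (d , s) s≰T = *-monoʳ (rec d) (0≤rec d) (ι-mono (ℕ.<⇒≤ (ℕ.≰⇒> s≰T)))
  tS≤ : t * S ≤ t * ι (suc T) + M * S
  tS≤ = begin
    t * S                                                           ≡⟨ sym (trans (scale D) (cong (t *_) (sumL-recOf ps))) ⟩
    sumL (λ x → t * recOf x) D                                      ≤⟨ sumL≤filter+ (small? T) (λ x → 0≤* (0≤ι (proj₂ x)) (0≤rec (proj₁ x)))
                                                                         (All.universal large D) ⟩
    sumL (λ x → t * recOf x) (filter (small? T) D) + sumL weightOf D  ≤⟨ +-mono-≤ (≤-trans (≤-reflexive (scale (filter (small? T) D)))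
                                                                         (*-monoˡ t (0≤ι T) (sumL-small ups pps T))) (sumL-weightOf ps) ⟩
    t * ι (suc T) + M * S                                           ∎
  2tS≤ : 2ℚ * (t * S) ≤ 2ℚ * (t * ι (suc T)) + t * S
  2tS≤ = begin
    2ℚ * (t * S)                              ≤⟨ *-monoˡ 2ℚ (<⇒≤ 0<2) tS≤ ⟩
    2ℚ * (t * ι (suc T) + M * S)              ≡⟨ eq₂ 2ℚ (t * ι (suc T)) M S ⟩
    2ℚ * (t * ι (suc T)) + 2ℚ * M * S         ≤⟨ +-monoʳ-≤ (2ℚ * (t * ι (suc T))) (*-monoʳ S (0≤invSum ps) 2M≤T) ⟩
    2ℚ * (t * ι (suc T)) + t * S              ∎

-- From the product of the 1 + 1/p to Euler's totient

-- The telescoping step 1/m² ≤ 1/(m - 1) - 1/m for m = n + 2, free of subtraction. With denominators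
-- cleared it says (m - 1)(m + 1) ≤ m².
rec-suc : ∀ n → rec (2 ℕ.+ n) * rec (2 ℕ.+ n) + rec (2 ℕ.+ n) ≤ rec (suc n)
rec-suc n = *-cancel-≤ (ι m) (0<ι-suc n) (*-cancel-≤ (a * a) (0<* 0<a 0<a) (begin
  (r * r + r) * ι m * (a * a)          ≡⟨ eq r (ι m) a ⟩
  ι m * (a * r) * (a * r + a)          ≡⟨ cong (λ t → ι m * t * (t + a)) (ι*rec (suc m) (s≤s z≤n)) ⟩
  ι m * 1ℚ * (1ℚ + a)                  ≤⟨ p≤p+q 0≤1 ⟩
  ι m * 1ℚ * (1ℚ + a) + 1ℚ             ≡⟨ cong (λ t → ι m * 1ℚ * (1ℚ + t) + 1ℚ) (ι-suc m) ⟩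
  ι m * 1ℚ * (1ℚ + (1ℚ + ι m)) + 1ℚ    ≡⟨ eq′ (ι m) ⟩
  1ℚ * ((1ℚ + ι m) * (1ℚ + ι m))       ≡⟨ cong₂ (λ s t → s * (t * t)) (sym (trans (*-comm (rec m) (ι m)) (ι*rec m (s≤s z≤n)))) (sym (ι-suc m)) ⟩
  rec m * ι m * (a * a)                ∎))
  where
  open ≤-Reasoning
  m = suc n
  a = ι (suc m)
  r = rec (suc m)
  0<a = 0<ι-suc m
  eq : ∀ r m a → (r * r + r) * m * (a * a) ≡ m * (a * r) * (a * r + a)
  eq = solve-∀ ℚ-ring
  eq′ : ∀ m → m * 1ℚ * (1ℚ + (1ℚ + m)) + 1ℚ ≡ 1ℚ * ((1ℚ + m) * (1ℚ + m))
  eq′ = solve-∀ ℚ-ring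

-- The term 1/4 is kept and the remaining ones telescope to at most 1/2. The bound must stay below
-- 1, since its distance from 1 becomes the constant of `¼≤prodL*invSum`.
recSquare-sum : ∀ N → sumTo (λ i → rec (2 ℕ.+ i) * rec (2 ℕ.+ i)) N ≤ 1ℚ - ½ * ½
recSquare-sum zero    = from-yes (0ℚ ≤? 1ℚ - ½ * ½)
recSquare-sum (suc N) = ≤-trans (p≤p+q (0≤rec (2 ℕ.+ N))) (telescope N)
  where
  telescope : ∀ N → sumTo (λ i → rec (2 ℕ.+ i) * rec (2 ℕ.+ i)) (suc N) + rec (2 ℕ.+ N) ≤ 1ℚ - ½ * ½
  telescope zero    = ≤-refl
  telescope (suc N) = ≤-trans (≤-reflexive (+-assoc (sumTo (λ i → rec (2 ℕ.+ i) * rec (2 ℕ.+ i)) (suc N)) _ _))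
    (≤-trans (+-monoʳ-≤ (sumTo (λ i → rec (2 ℕ.+ i) * rec (2 ℕ.+ i)) (suc N)) (rec-suc (suc N))) (telescope N))

prodL-cong : ∀ {A : Set} {f g : A → ℚ} → (∀ x → f x ≡ g x) → ∀ xs → prodL f xs ≡ prodL g xs
prodL-cong f≗g []       = refl
prodL-cong f≗g (x ∷ xs) = cong₂ _*_ (f≗g x) (prodL-cong f≗g xs)

rec≤1 : ∀ n → rec n ≤ 1ℚ
rec≤1 zero    = 0≤1
rec≤1 (suc n) = rec-anti {1} {suc n} (s≤s z≤n) (s≤s z≤n)

-- The two products multiply to that of the 1 - 1/p², at least 1 - Σ 1/p². This turns an upper bound
-- for `invSum` into a lower bound for φ(n) / n.
¼≤prodL*invSum : ∀ {ps} → Unique ps → All (2 ℕ.≤_) ps → ½ * ½ ≤ prodL (λ p → 1ℚ - rec p) ps * invSum ps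
¼≤prodL*invSum {ps} ups 2≤ps = begin
  ½ * ½                                          ≡⟨⟩
  1ℚ - (1ℚ - ½ * ½)                              ≤⟨ 1-q≤1-p (≤-trans (proj₂ range) (recSquare-sum (proj₁ range))) ⟩
  1ℚ - sumL (λ p → rec p * rec p) ps             ≤⟨ proj₁ (1-sumL≤prodL (All.universal (λ p → 0≤² p , *-mono 0≤1 (0≤rec p) (rec≤1 p) (rec≤1 p)) ps)) ⟩
  prodL (λ p → 1ℚ - rec p * rec p) ps            ≡⟨ prodL-cong (λ p → eq (rec p)) ps ⟩
  prodL (λ p → (1ℚ - rec p) * (1ℚ + rec p)) ps   ≡⟨ prodL-* (λ p → 1ℚ - rec p) (λ p → 1ℚ + rec p) ps ⟩
  prodL (λ p → 1ℚ - rec p) ps * invSum ps        ∎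
  where
  open ≤-Reasoning
  0≤² : ∀ p → 0ℚ ≤ rec p * rec p
  0≤² p = 0≤* (0≤rec p) (0≤rec p)
  range = sumL-unique-≥2 0≤² ups 2≤ps
  eq : ∀ r → 1ℚ - r * r ≡ (1ℚ - r) * (1ℚ + r)
  eq = solve-∀ ℚ-ring

ι-totient : ∀ {ps} → All (2 ℕ.≤_) ps → ι (totient ps) ≡ ι (product ps) * prodL (λ p → 1ℚ - rec p) ps
ι-totient [] = refl
ι-totient {suc p ∷ ps} (_ ∷ 2≤ps) = begin
  ι (p ℕ.* totient ps)                              ≡⟨ ι-* p (totient ps) ⟩
  ι p * ι (totient ps)                              ≡⟨ cong₂ _*_ pred≡ (ι-totient 2≤ps) ⟩
  ι (suc p) * (1ℚ - rec (suc p)) * (ι P * V)        ≡⟨ eq (ι (suc p)) (1ℚ - rec (suc p)) (ι P) V ⟩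
  ι (suc p) * ι P * ((1ℚ - rec (suc p)) * V)        ≡⟨ cong (_* ((1ℚ - rec (suc p)) * V)) (sym (ι-* (suc p) P)) ⟩
  ι (suc p ℕ.* P) * ((1ℚ - rec (suc p)) * V)        ∎
  where
  open ≡-Reasoning
  P = product ps
  V = prodL (λ p → 1ℚ - rec p) ps
  eq : ∀ a b c d → a * b * (c * d) ≡ a * c * (b * d)
  eq = solve-∀ ℚ-ring
  eq′ : ∀ a r → a * (1ℚ - r) ≡ a - a * r
  eq′ = solve-∀ ℚ-ring
  eq″ : ∀ p → 1ℚ + p - 1ℚ ≡ p
  eq″ = solve-∀ ℚ-ring
  pred≡ : ι p ≡ ι (suc p) * (1ℚ - rec (suc p))
  pred≡ = sym (trans (eq′ (ι (suc p)) (rec (suc p))) (trans (cong₂ _-_ (ι-suc p) (ι*rec (suc p) (s≤s z≤n))) (eq″ (ι p))))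

-- With T twice the bound 4 I + 2 of `logWeight-sum`, `invSum` is at most 2 (T + 1) = 16 I + 10 ≤ 26
-- I. The loss in `¼≤prodL*invSum` contributes the factor 4, and 104 = 4 · 26.
product≤totient : ∀ {ps} → Unique ps → All Prime ps → ∀ I → 1 ℕ.≤ I → product ps ℕ.≤ 2 ℕ.^ (2 ℕ.^ I) →
                  product ps ℕ.≤ 104 ℕ.* I ℕ.* totient ps
product≤totient {ps} ups pps I 1≤I P≤ = ι-cancel-≤ P (104 ℕ.* I ℕ.* totient ps) (begin
  ι P                                       ≡⟨ sym (trans (eq₁ (ι P) ½ (ι 4)) (*-identityʳ (ι P))) ⟩
  ι 4 * (ι P * (½ * ½))                     ≤⟨ *-monoˡ (ι 4) (0≤ι 4) (*-monoˡ (ι P) (0≤ι P) (¼≤prodL*invSum ups 2≤ps)) ⟩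
  ι 4 * (ι P * (V * S))                     ≡⟨ cong (ι 4 *_) (trans (sym (*-assoc (ι P) V S)) (cong (_* S) (sym (ι-totient 2≤ps)))) ⟩
  ι 4 * (ι φ * S)                           ≤⟨ *-monoˡ (ι 4) (0≤ι 4) (*-monoˡ (ι φ) (0≤ι φ) S≤) ⟩
  ι 4 * (ι φ * ι (26 ℕ.* I))                ≡⟨ sym (trans (ι-* 4 (φ ℕ.* (26 ℕ.* I))) (cong (ι 4 *_) (ι-* φ (26 ℕ.* I)))) ⟩
  ι (4 ℕ.* (φ ℕ.* (26 ℕ.* I)))              ≡⟨ cong ι (solve 2 (λ f i → con 4 :* (f :* (con 26 :* i)) := con 104 :* i :* f) refl φ I) ⟩
  ι (104 ℕ.* I ℕ.* φ)                       ∎)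
  where
  open ≤-Reasoning
  open +-*-Solver
  P = product ps
  φ = totient ps
  V = prodL (λ p → 1ℚ - rec p) ps
  S = invSum ps
  T = 2 ℕ.* (4 ℕ.* I ℕ.+ 2)
  2≤ps = All.map prime≥2 pps
  eq₁ : ∀ p h c → c * (p * (h * h)) ≡ p * (c * (h * h))
  eq₁ = solve-∀ ℚ-ring
  1≤T : 1 ℕ.≤ T
  1≤T = ℕ.≤-trans (s≤s z≤n) (ℕ.*-monoʳ-≤ 2 (ℕ.m≤n+m 2 (4 ℕ.* I)))
  2M≤T : 2ℚ * sumL logWeight ps ≤ ι T
  2M≤T = ≤-trans (*-monoˡ 2ℚ (<⇒≤ 0<2) (logWeight-sum ups pps I P≤)) (≤-reflexive (sym (ι-* 2 (4 ℕ.* I ℕ.+ 2))))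
  S≤ : S ≤ ι (26 ℕ.* I)
  S≤ = begin
    S                                         ≤⟨ invSum-bound ups pps T 1≤T 2M≤T ⟩
    2ℚ * ι (suc T)                            ≡⟨ sym (ι-* 2 (suc T)) ⟩
    ι (2 ℕ.* suc T)                           ≡⟨ cong ι (solve 1 (λ i → con 2 :* (con 1 :+ con 2 :* (con 4 :* i :+ con 2)) := con 16 :* i :+ con 10 :* con 1) refl I) ⟩
    ι (16 ℕ.* I ℕ.+ 10 ℕ.* 1)                 ≤⟨ ι-mono (ℕ.+-monoʳ-≤ (16 ℕ.* I) (ℕ.*-monoʳ-≤ 10 1≤I)) ⟩
    ι (16 ℕ.* I ℕ.+ 10 ℕ.* I)                 ≡⟨ cong ι (sym (ℕ.*-distribʳ-+ I 16 10)) ⟩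
    ι (26 ℕ.* I)                              ∎

-- Comparison of the exponents

-- The proof passes to unnormalised rationals because `_/_` divides out the gcd, and e and o need
-- not be coprime.
/-*-cancel : ∀ e o .{{_ : ℕ.NonZero o}} → (ℤ.+ e / o) * ι o ≡ ι e
/-*-cancel e o@(suc d) = toℚᵘ-injective (begin
  toℚᵘ ((ℤ.+ e / o) * ι o)                ≈⟨ toℚᵘ-homo-* (ℤ.+ e / o) (ι o) ⟩
  toℚᵘ (ℤ.+ e / o) ℚᵘ.* toℚᵘ (ι o)        ≈⟨ ℚᵘ.*-cong (toℚᵘ-fromℚᵘ (mkℚᵘ (ℤ.+ e) d)) (toℚᵘ-fromℚᵘ (mkℚᵘ (ℤ.+ o) 0)) ⟩
  mkℚᵘ (ℤ.+ e) d ℚᵘ.* mkℚᵘ (ℤ.+ o) 0      ≈⟨ *≡* (trans (ℤ.*-identityʳ (ℤ.+ e ℤ.* ℤ.+ o)) (cong (λ t → ℤ.+ e ℤ.* ℤ.+ t) (sym (ℕ.*-identityʳ o)))) ⟩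
  mkℚᵘ (ℤ.+ e) 0                          ≈⟨ ℚᵘ.≃-sym (toℚᵘ-fromℚᵘ (mkℚᵘ (ℤ.+ e) 0)) ⟩
  toℚᵘ (ι e)                              ∎)
  where open ℚᵘ.≃-Reasoning

pred≥1 : ∀ {p} → 2 ℕ.≤ p → 1 ℕ.≤ ℕ.pred p
pred≥1 = ℕ.pred-mono-≤

totient≥1 : ∀ {ps} → All (2 ℕ.≤_) ps → 1 ℕ.≤ totient ps
totient≥1 []         = ℕ.≤-refl
totient≥1 (2≤p ∷ hs) = ℕ.*-mono-≤ (pred≥1 2≤p) (totient≥1 hs)

-- At most one of the primes is 2, so φ (n) = 1 only for n ≤ 2.
totient≥2 : ∀ R {ps} → 1 ℕ.≤ R → Unique ps → All (2 ℕ.≤_) ps → 3 ℕ.≤ R ℕ.* product ps → 2 ℕ.≤ R ℕ.* totient ps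
totient≥2 R {[]}         1≤R _ _ 3≤ = ℕ.≤-trans (s≤s (s≤s z≤n)) 3≤
totient≥2 R {p ∷ []}     1≤R _ (2≤p ∷ []) 3≤ = ℕ.*-cancelˡ-< 2 1 (R ℕ.* (ℕ.pred p ℕ.* 1)) (ℕ.≤-trans 3≤
  (ℕ.≤-trans (ℕ.*-monoʳ-≤ R (ℕ.*-monoˡ-≤ 1 (double p 2≤p)))
    (ℕ.≤-reflexive (solve 2 (λ r q → r :* ((con 2 :* q) :* con 1) := con 2 :* (r :* (q :* con 1))) refl R (ℕ.pred p)))))
  where
  open +-*-Solver
  double : ∀ p → 2 ℕ.≤ p → p ℕ.≤ 2 ℕ.* ℕ.pred p
  double (suc p) (s≤s 1≤p) = ℕ.+-mono-≤ 1≤p (ℕ.≤-reflexive (sym (ℕ.+-identityʳ p)))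
totient≥2 R {p ∷ q ∷ ps} 1≤R ((p≢q ∷ _) ∷ _) (2≤p ∷ 2≤q ∷ hs) _ with ℕ.<-cmp p q
... | tri< p<q _ _ = ℕ.*-mono-≤ 1≤R (ℕ.*-mono-≤ (pred≥1 2≤p) (ℕ.*-mono-≤ (ℕ.pred-mono-≤ (ℕ.≤-trans (s≤s 2≤p) p<q)) (totient≥1 hs)))
... | tri≈ _ p≡q _ = contradiction p≡q p≢q
... | tri> _ _ q<p = ℕ.*-mono-≤ 1≤R (ℕ.*-mono-≤ (ℕ.pred-mono-≤ (ℕ.≤-trans (s≤s 2≤q) q<p)) (ℕ.*-mono-≤ (pred≥1 2≤q) (totient≥1 hs)))

1≤⌊log₂⌋ : ∀ n → 2 ℕ.≤ n → 1 ℕ.≤ ⌊log₂ n ⌋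
1≤⌊log₂⌋ n 2≤n = ℕ.n≢0⇒n>0 λ log≡0 → ℕ.<⇒≱ (subst (λ t → n ℕ.< 2 ℕ.^ suc t) log≡0 (n<2^[1+⌊log₂n⌋] n (ℕ.≤-trans (s≤s z≤n) 2≤n))) 2≤n

-- Written as 1 - c for the step length c = 1/4 at which `expSum-geometric` is applied.
¾ : ℚ
¾ = 1ℚ - ½ * ½

2≤w^ : ∀ {w} → 2ℚ * ¾ ≤ w → ∀ {n} → 2 ℕ.≤ n → 2ℚ ≤ w ^ℚ n
2≤w^ {w} 3/2≤w (s≤s (s≤s {n = n} _)) = begin
  2ℚ                              ≤⟨ from-yes (2ℚ ≤? 2ℚ * ¾ * (2ℚ * ¾ * 1ℚ)) ⟩
  2ℚ * ¾ * (2ℚ * ¾ * 1ℚ)          ≤⟨ *-mono 0≤w (from-yes (0ℚ ≤? 2ℚ * ¾ * 1ℚ)) 3/2≤w (*-mono 0≤w 0≤1 3/2≤w (1≤^ n)) ⟩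
  w * (w * w ^ℚ n)                ∎
  where
  open ≤-Reasoning
  1≤w = ≤-trans (from-yes (1ℚ ≤? 2ℚ * ¾)) 3/2≤w
  0≤w = ≤-trans 0≤1 1≤w
  1≤^ : ∀ n → 1ℚ ≤ w ^ℚ n
  1≤^ zero    = ≤-refl
  1≤^ (suc n) = *-mono 0≤w 0≤1 1≤w (1≤^ n)

^-*-assocℚ : ∀ q m n → q ^ℚ (m ℕ.* n) ≡ (q ^ℚ m) ^ℚ n
^-*-assocℚ q m zero    = cong (q ^ℚ_) (ℕ.*-zeroʳ m)
^-*-assocℚ q m (suc n) = trans (cong (q ^ℚ_) (ℕ.*-suc m n)) (trans (^-+ q m (m ℕ.* n)) (cong (q ^ℚ m *_) (^-*-assocℚ q m n)))

-- (3/4)ᵝ a ≥ (3/2)ᵝ ≥ 3/2 and (3/2)² ≥ 2.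
2≤¾^N*a^φ : ∀ a β φ → 1 ℕ.≤ β → 2 ℕ.^ β ℕ.≤ a → 2 ℕ.≤ φ → 2ℚ ≤ ¾ ^ℚ (β ℕ.* φ) * ι (a ℕ.^ φ)
2≤¾^N*a^φ a (suc β) φ _ 2^β≤a 2≤φ = subst (2ℚ ≤_) (sym eq) (2≤w^ 3/2≤w 2≤φ)
  where
  open ≤-Reasoning
  0≤¾ : 0ℚ ≤ ¾
  0≤¾ = from-yes (0ℚ ≤? ¾)
  eq : ¾ ^ℚ (suc β ℕ.* φ) * ι (a ℕ.^ φ) ≡ (¾ ^ℚ suc β * ι a) ^ℚ φ
  eq = trans (cong₂ _*_ (^-*-assocℚ ¾ (suc β) φ) (ι-^ a φ)) (sym (^-* (¾ ^ℚ suc β) (ι a) φ))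
  1≤^ : ∀ n → 1ℚ ≤ (¾ * 2ℚ) ^ℚ n
  1≤^ zero    = ≤-refl
  1≤^ (suc n) = *-mono (from-yes (0ℚ ≤? ¾ * 2ℚ)) 0≤1 (from-yes (1ℚ ≤? ¾ * 2ℚ)) (1≤^ n)
  3/2≤w : 2ℚ * ¾ ≤ ¾ ^ℚ suc β * ι a
  3/2≤w = begin
    ¾ * 2ℚ * 1ℚ                           ≤⟨ *-monoˡ (¾ * 2ℚ) (from-yes (0ℚ ≤? ¾ * 2ℚ)) (1≤^ β) ⟩
    (¾ * 2ℚ) ^ℚ suc β                     ≡⟨ trans (^-* ¾ 2ℚ (suc β)) (cong (¾ ^ℚ suc β *_) (sym (ι-^ 2 (suc β)))) ⟩
    ¾ ^ℚ suc β * ι (2 ℕ.^ suc β)          ≤⟨ *-monoˡ (¾ ^ℚ suc β) (0≤^ 0≤¾ (suc β)) (ι-mono 2^β≤a) ⟩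
    ¾ ^ℚ suc β * ι a                      ∎

-- 374400 = 4 · 75 · 12 · 104, from exp (1/4) ≤ 4/3, ln ln n ≥ I/75, ln (aⁿ - 1) ≤ 12 β n and
-- n ≤ 104 I φ(n), where I = 1 + ⌊log₂ ⌊log₂ n⌋⌋ and β = ⌊log₂ a⌋.
c₁ : ℚ
c₁ = ℤ.+ 1 / 374400

-- `L` and `ℓ` stand for approximations of ln ln n and ln (aⁿ - 1) at a common index. Replacing n by
-- 104 I φ brings in a factor I, which L ≥ I / 75 cancels.
exponent-bound : ∀ {L ℓ} β n φ I → 1 ℕ.≤ I → n ℕ.≤ 104 ℕ.* I ℕ.* φ →
                 ι I * (ℤ.+ 1 / 75) ≤ L → ℓ ≤ ι (6 ℕ.* ((β ℕ.+ β) ℕ.* n)) →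
                 c₁ * recip L * ℓ ≤ ι (β ℕ.* φ) * (½ * ½)
exponent-bound {L} {ℓ} β n φ I 1≤I n≤ I≤L ℓ≤ = begin
  c₁ * recip L * ℓ                             ≤⟨ *-monoˡ (c₁ * recip L) (0≤* 0≤c₁ (0≤recip 0<L)) (≤-trans ℓ≤ (ι-mono large)) ⟩
  c₁ * recip L * ι (1248 ℕ.* (I ℕ.* N))        ≡⟨ cong (c₁ * recip L *_) (trans (ι-* 1248 (I ℕ.* N)) (cong (ι 1248 *_) (ι-* I N))) ⟩
  c₁ * recip L * (ι 1248 * (ι I * ι N))        ≡⟨ eq c₁ (recip L) (ι 1248) (ι I) (ι N) ⟩
  c₁ * ι 1248 * (ι I * ι N) * recip L          ≤⟨ p*recip≤q 0<L (begin
    -- By computation `c₁` · 1248 = 1/300 = (1/4) · (1/75).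
    c₁ * ι 1248 * (ι I * ι N)                    ≡⟨ eq′ (½ * ½) (ℤ.+ 1 / 75) (ι I) (ι N) ⟩
    ι N * (½ * ½) * (ι I * (ℤ.+ 1 / 75))        ≤⟨ *-monoˡ (ι N * (½ * ½)) (0≤* (0≤ι N) (from-yes (0ℚ ≤? ½ * ½))) I≤L ⟩
    ι N * (½ * ½) * L                           ∎) ⟩
  ι N * (½ * ½)                               ∎
  where
  open ≤-Reasoning
  open +-*-Solver
  N = β ℕ.* φ
  0≤c₁ = from-yes (0ℚ ≤? c₁)
  0<L : 0ℚ < L
  0<L = <-≤-trans (0<* (0<ι I 1≤I) (from-yes (0ℚ <? (ℤ.+ 1 / 75)))) I≤L
  large : 6 ℕ.* ((β ℕ.+ β) ℕ.* n) ℕ.≤ 1248 ℕ.* (I ℕ.* N)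
  large = ℕ.≤-trans (ℕ.*-monoʳ-≤ 6 (ℕ.*-monoʳ-≤ (β ℕ.+ β) n≤)) (ℕ.≤-reflexive
    (solve 3 (λ b i f → con 6 :* ((b :+ b) :* (con 104 :* i :* f)) := con 1248 :* (i :* (b :* f))) refl β I φ))
  eq : ∀ c r k i n → c * r * (k * (i * n)) ≡ c * k * (i * n) * r
  eq = solve-∀ ℚ-ring
  eq′ : ∀ q s i n → q * s * (i * n) ≡ n * q * (i * s)
  eq′ = solve-∀ ℚ-ring

-- The chain is exp (β φ / 4) ≤ (4/3)^(β φ) ≤ a^φ / 2 ≤ e / o, with the denominators cleared and
-- with a partial sum of any length in place of exp.
expSum≤ : ∀ {y e o} a β φ → 1 ℕ.≤ β → 2 ℕ.^ β ℕ.≤ a → 2 ℕ.≤ φ → .{{_ : ℕ.NonZero o}} →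
          o ℕ.* a ℕ.^ φ ℕ.≤ 2 ℕ.* e → 0ℚ ≤ y → y ≤ ι (β ℕ.* φ) * (½ * ½) → ∀ k → expSum k y ≤ ℤ.+ e / o
expSum≤ {y} {e} {o} a β φ 1≤β 2^β≤a 2≤φ oa^φ≤2e 0≤y y≤ k = *-cancel-≤ (ι o) (0<ι o (ℕ.>-nonZero⁻¹ o))
  (subst (expSum k y * ι o ≤_) (sym (/-*-cancel e o)) (*-cancel-≤ 2ℚ 0<2 (begin
    X * ι o * 2ℚ                           ≤⟨ *-monoˡ (X * ι o) (0≤* 0≤X (0≤ι o)) (2≤¾^N*a^φ a β φ 1≤β 2^β≤a 2≤φ) ⟩
    X * ι o * (¾ ^ℚ N * ι (a ℕ.^ φ))       ≡⟨ eq X (ι o) (¾ ^ℚ N) (ι (a ℕ.^ φ)) ⟩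
    ¾ ^ℚ N * X * (ι o * ι (a ℕ.^ φ))       ≤⟨ *-monoʳ _ (0≤* (0≤ι o) (0≤ι (a ℕ.^ φ))) (≤-trans
                                                (*-monoˡ (¾ ^ℚ N) (0≤^ (from-yes (0ℚ ≤? ¾)) N) (expSum-mono 0≤y y≤ k))
                                                (expSum-geometric (from-yes (0ℚ ≤? ½ * ½)) (from-yes (½ * ½ ≤? 1ℚ)) N k)) ⟩
    1ℚ * (ι o * ι (a ℕ.^ φ))               ≡⟨ trans (*-identityˡ _) (sym (ι-* o (a ℕ.^ φ))) ⟩
    ι (o ℕ.* a ℕ.^ φ)                      ≤⟨ ι-mono oa^φ≤2e ⟩
    ι (2 ℕ.* e)                            ≡⟨ trans (ι-* 2 e) (*-comm 2ℚ (ι e)) ⟩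
    ι e * 2ℚ                               ∎)))
  where
  open ≤-Reasoning
  N = β ℕ.* φ
  X = expSum k y
  0≤X = 0≤sumTo (0≤expTerm 0≤y) k
  eq : ∀ x o q p → x * o * (q * p) ≡ q * x * (o * p)
  eq = solve-∀ ℚ-ring

-- The estimate for fixed a and n

module Bound (a n : ℕ) (2≤a : 2 ℕ.≤ a) (3≤n : 3 ℕ.≤ n) (F : PrimePowerFactorisation n) where
  open PrimePowerFactorisation F

  ps : List ℕ
  ps = tabulate p

  ups : Unique ps
  ups = Unique.tabulate⁺ p-distinct

  pps : All Prime ps
  pps = All.tabulate⁺ p-prime

  2≤ps : All (2 ℕ.≤_) ps
  2≤ps = All.map prime≥2 pps

  -- n / rad n and Euler's φ(n) = (n / rad n) φ(rad n).
  R φ : ℕ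
  R = radCofactor p l
  φ = R ℕ.* totient ps

  n≡R*rad : n ≡ R ℕ.* product ps
  n≡R*rad = trans n≡∏p^l (n≡radCofactor*rad p l l≥1)

  1≤R : 1 ℕ.≤ R
  1≤R = ℕ.>-nonZero⁻¹ R {{product≢0 (All.tabulate⁺ λ i → ℕ.m^n≢0 (p i) (l i ℕ.∸ 1) {{prime⇒nonZero (p-prime i)}})}}

  2≤φ : 2 ℕ.≤ φ
  2≤φ = totient≥2 R 1≤R ups 2≤ps (subst (3 ℕ.≤_) n≡R*rad 3≤n)

  odd*a^φ≤2*even : oddProduct a F ℕ.* a ℕ.^ φ ℕ.≤ 2 ℕ.* evenProduct a F
  odd*a^φ≤2*even = subst₂ ℕ._≤_
    (cong₂ ℕ._*_ (sym (proj₂ products)) (ℕ.^-*-assoc a R (totient ps))) (cong (2 ℕ.*_) (sym (proj₁ products)))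
    (oddProd-pow≤2*evenProd ups 2≤ps (a ℕ.^ R) (2≤x^ 2≤a 1≤R))
    where products = cubeProduct≡ p l l≥1 a

  β g h : ℕ
  β = ⌊log₂ a ⌋
  g = ⌊log₂ n ⌋
  h = ⌊log₂ g ⌋

  1≤a = ℕ.≤-trans (s≤s z≤n) 2≤a
  1≤n = ℕ.≤-trans (s≤s z≤n) 3≤n

  1≤β : 1 ℕ.≤ β
  1≤β = 1≤⌊log₂⌋ a 2≤a

  1≤g : 1 ℕ.≤ g
  1≤g = 1≤⌊log₂⌋ n (ℕ.≤-trans (s≤s (s≤s z≤n)) 3≤n)

  2^2^h≤n : 2 ℕ.^ (2 ℕ.^ h) ℕ.≤ n
  2^2^h≤n = ℕ.≤-trans (ℕ.^-monoʳ-≤ 2 (2^⌊log₂n⌋≤n g 1≤g)) (2^⌊log₂n⌋≤n n 1≤n)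

  n≤2^2^[1+h] : n ℕ.≤ 2 ℕ.^ (2 ℕ.^ suc h)
  n≤2^2^[1+h] = ℕ.≤-trans (ℕ.<⇒≤ (n<2^[1+⌊log₂n⌋] n 1≤n)) (ℕ.^-monoʳ-≤ 2 (n<2^[1+⌊log₂n⌋] g 1≤g))

  n≤104Iφ : n ℕ.≤ 104 ℕ.* suc h ℕ.* φ
  n≤104Iφ = begin
    n                                              ≡⟨ n≡R*rad ⟩
    R ℕ.* product ps                               ≤⟨ ℕ.*-monoʳ-≤ R (product≤totient ups pps (suc h) (s≤s z≤n) rad≤) ⟩
    R ℕ.* (104 ℕ.* suc h ℕ.* totient ps)           ≡⟨ solve 3 (λ r i t → r :* (con 104 :* i :* t) := con 104 :* i :* (r :* t)) refl R (suc h) (totient ps) ⟩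
    104 ℕ.* suc h ℕ.* φ                            ∎
    where
    open ℕ.≤-Reasoning
    open +-*-Solver
    rad≤ : product ps ℕ.≤ 2 ℕ.^ (2 ℕ.^ suc h)
    rad≤ = ℕ.≤-trans (ℕ.m≤n*m (product ps) R {{ℕ.>-nonZero 1≤R}}) (ℕ.≤-trans (ℕ.≤-reflexive (sym n≡R*rad)) n≤2^2^[1+h])

  A m : ℕ
  A = a ℕ.^ n ℕ.∸ 1
  m = (β ℕ.+ β) ℕ.* n

  1≤A : 1 ℕ.≤ A
  1≤A = ℕ.m<n⇒0<n∸m (2≤x^ 2≤a 1≤n)

  1≤m : 1 ℕ.≤ m
  1≤m = ℕ.*-mono-≤ (ℕ.≤-trans 1≤β (ℕ.m≤m+n β β)) 1≤n

  -- From a < 2^(1+β) and 1 + β ≤ 2 β. The exponent is kept proportional to β because the lower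
  -- bound for Pr enters through a ≥ 2^β.
  A≤2^m : A ℕ.≤ 2 ℕ.^ m
  A≤2^m = ℕ.≤-trans (ℕ.m∸n≤m (a ℕ.^ n) 1) (ℕ.≤-trans
    (ℕ.^-monoˡ-≤ n (ℕ.≤-trans (ℕ.<⇒≤ (n<2^[1+⌊log₂n⌋] a 1≤a)) (ℕ.^-monoʳ-≤ 2 (ℕ.+-monoˡ-≤ β 1≤β))))
    (ℕ.≤-reflexive (ℕ.^-*-assoc 2 (β ℕ.+ β) n)))

  0<A : 0ℝ <ℝ ℕ→ℝ A
  0<A = 0<aⁿ-1 a n 2≤a 3≤n

  K = proj₁ (lnln-lower n 3≤n h 2^2^h≤n)

  I≤lnln : ∀ k → K ℕ.≤ k → ι (suc h) * (ℤ.+ 1 / 75) ≤ seq (proj₁ (lnln n 3≤n)) k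
  I≤lnln = proj₂ (lnln-lower n 3≤n h 2^2^h≤n)

  -- By definition the left side is `expSum k` at the product of `c₁`, the reciprocal of ln ln n and
  -- ln (aⁿ - 1), all at index k, so the rational estimates apply index by index. `K` is the index
  -- from which the lower bound for ln ln n holds.
  power≤Pr : ∀ k → K ℕ.≤ k →
             seq ((ℕ→ℝ A , 0<A) ^ℝ (ℚ→ℝ c₁ ÷ℝ lnln n 3≤n)) k ≤ Pr a 2≤a F
  power≤Pr k K≤k = expSum≤ {e = evenProduct a F} {o = oddProduct a F} a β φ 1≤β (2^⌊log₂n⌋≤n a 1≤a) 2≤φ {{oddProduct≢0 a F 2≤a}} odd*a^φ≤2*even
    (0≤* (0≤* (from-yes (0ℚ ≤? c₁)) (0≤recip 0<L)) (ln-nonNeg A 0<A 1≤A k))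
    (exponent-bound β n φ (suc h) (s≤s z≤n) n≤104Iφ (I≤lnln k K≤k) (ln-upper A 0<A m 1≤A A≤2^m 1≤m k)) k
    where
    0<L : 0ℚ < seq (proj₁ (lnln n 3≤n)) k
    0<L = <-≤-trans (0<* (0<ι-suc h) (from-yes (0ℚ <? (ℤ.+ 1 / 75)))) (I≤lnln k K≤k)

theorem12 : Σ[ C₁ ∈ ℝ ] (0ℝ <ℝ C₁ ×
    (∀ (a n : ℕ) (2≤a : 2 ℕ.≤ a) (3≤n : 3 ℕ.≤ n) (F : PrimePowerFactorisation n) →
    (ℕ→ℝ (a ℕ.^ n ℕ.∸ 1) , 0<aⁿ-1 a n 2≤a 3≤n) ^ℝ (C₁ ÷ℝ lnln n 3≤n) ≤ℝ ℚ→ℝ (Pr a 2≤a F)))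
theorem12 = ℚ→ℝ c₁ , (c₁ , from-yes (0ℚ <? c₁) , 0 , λ _ _ → ≤-reflexive (+-identityˡ c₁)) ,
  λ a n 2≤a 3≤n F ε 0<ε → let open Bound a n 2≤a 3≤n F in
    K , λ k K≤k → ≤-trans (power≤Pr k K≤k) (p≤p+q (<⇒≤ 0<ε))
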